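{- There is a universal constant $K$ such that, if $p = p(n) \ge K/\sqrt{n}$, then \[ \Pr\big(G_{n,p} \text{ contains the square of a Hamilton cycle}\big) \to 1 \quad \text{as } n \to \infty. \]
   Context: $G_{n,p}$ is the binomial random graph on vertex set $\{1,\dots,n\}$ in which each of the $\binom n2$ possible edges is present independently with probability $p$. The square of a graph $G$ is the graph on $V(G)$ in which two vertices are adjacent iff their distance in $G$ is at most $2$; the square of a Hamilton cycle of $K_n$ is the square of an $n$-vertex cycle on the vertex set of $K_n$. "$G_{n,p}$ contains the square of a Hamilton cycle" means some such graph is a subgraph of $G_{n,p}$.
   Formalization: The edge probabilities p(n) are taken to be rational numbers in [0,1] instead of real numbers. -}

module Defs where

open import Data.Bool using (Bool; true; false; if_then_else_)
open import Data.Nat as ℕ using (ℕ; zero; suc)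
open import Data.Nat.DivMod using (_mod_)
open import Data.Fin using (Fin; toℕ)
open import Data.List as List using (List; []; _∷_; allFin; concatMap; length)
open import Data.Vec as Vec using (Vec; []; _∷_)
open import Data.Product using (Σ; _×_; _,_)
open import Data.Sum using (_⊎_)
open import Data.Integer using (+_)
open import Data.Rational using (ℚ; 0ℚ; 1ℚ; _+_; _*_; _-_; _/_)
open import Function.Definitions using (Injective)
open import Relation.Nullary using (Dec; does)
open import Relation.Binary.PropositionalEquality using (_≡_)

pairs : (n : ℕ) → List (Fin n × Fin n)
pairs n = concatMap (λ i → concatMap (λ j → if toℕ i ℕ.<ᵇ toℕ j then (i , j) ∷ [] else []) (allFin n)) (allFin n)

numPairs : ℕ → ℕ
numPairs n = length (pairs n)

-- A (simple) graph on vertex set Fin n: an indicator for each potential edge of K_n.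
Graph : ℕ → Set
Graph n = Vec Bool (numPairs n)

Adj : {n : ℕ} → Graph n → Fin n → Fin n → Set
Adj {n} G u v = Σ (Fin (numPairs n)) λ k →
  (List.lookup (pairs n) k ≡ (u , v) ⊎ List.lookup (pairs n) k ≡ (v , u)) × Vec.lookup G k ≡ true

shift : {n : ℕ} → ℕ → Fin n → Fin n
shift {zero} k ()
shift {suc n} k i = (toℕ i ℕ.+ k) mod (suc n)

ContainsSquareHamCycle : (n : ℕ) → Graph n → Set
ContainsSquareHamCycle n G =
  (3 ℕ.≤ n) × Σ (Fin n → Fin n) λ σ → Injective _≡_ _≡_ σ ×
    ((i : Fin n) → Adj G (σ i) (σ (shift 1 i)) × Adj G (σ i) (σ (shift 2 i)))

allVecs : (m : ℕ) → List (Vec Bool m)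
allVecs zero = [] ∷ []
allVecs (suc m) = List.map (true ∷_) (allVecs m) List.++ List.map (false ∷_) (allVecs m)

allGraphs : (n : ℕ) → List (Graph n)
allGraphs n = allVecs (numPairs n)

weight : {m : ℕ} → ℚ → Vec Bool m → ℚ
weight p [] = 1ℚ
weight p (b ∷ bs) = (if b then p else (1ℚ - p)) * weight p bs

Pr : (n : ℕ) → ℚ → {P : Graph n → Set} → ((G : Graph n) → Dec (P G)) → ℚ
Pr n p dec = List.foldr (λ G acc → (if does (dec G) then weight p G else 0ℚ) + acc) 0ℚ (allGraphs n)

ℕtoℚ : ℕ → ℚ
ℕtoℚ n = (+ n) / 1

{-# OPTIONS --safe #-}

-- Write S_π for the square of the Hamilton cycle that places vertex u at position π u, where π is a uniformly
-- random permutation, and let W be a random set of edges. A fragment of S_π is a set S_σ \ W ⊆ S_π of least size.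
-- If T is a fragment then T is contained in every S_σ ⊆ W ∪ T, so (W, T) is recovered from U = W ∪ T and a subset
-- of one square chosen from U alone; hence, if W has density 1/a, the probability that the fragment has more than
-- k′ edges, given that before exposing W it had at most k, is at most the maximum over F ⊆ S_τ with |F| ≤ k of
--   ∑_{T ⊆ F, |T| > k′} a^|T| P(T ⊆ S_π),   where   ∑_{T ⊆ F} b^|T| P(T ⊆ S_π) = E (1 + b)^|F ∩ S_π|.
-- Exposing the positions of the vertices met by F in their order along τ gives, for |F| ≤ n/8 and B = c √n with c
-- small, E B^|F ∩ S_π| ≤ (1 + 1/B)^(2|F|): a vertex can close two edges at once only if the two vertices before it
-- already lie close together. For larger F the same exposure gives only C^n. Four rounds, each of density O(1/√n),
-- shrink the fragments from 2n edges to n/8, to O(√n), to a constant depending on ε, and to 0.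
module Submission where

open import Defs

-- Four rounds suffice because a round divides the fragment size by an amount of order √n. Let `a`
-- be the inverse density and `B = 1 + x a`. Weighting T by x^(|T| - k′ - 1) bounds the tail by
-- x^(-k′-1) E B^|F ∩ S_π|, and this moment is at most (1 + 1/B)^(2k) ≤ 4^j once 2k ≤ B j. So k′
-- only has to exceed a fixed multiple of k / B: order B² passes to 5 B, and 5 B to a constant. The
-- two ends are different. While fragments may be the whole square, nearly all positions get exposed
-- and too few stay free for the potential; the price C^n is affordable there because x^(n/8) is
-- exponential as well, which dictates the size of `x` and hence of K. In the last round Markov's
-- inequality would gain only the constant `x`; instead the moment is within a factor 1 + 1/(4E) of
-- 1, and T = ∅ is removed from it exactly. All counting is done in natural numbers: probabilities
-- are multiplied by n! and by powers of 1 + a′, and the permitted error is 1/E. Rational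
-- probabilities enter only afterwards.

module Combinatorics where

  open import Data.Bool as Bool using (Bool; true; false; if_then_else_)
  open import Data.Nat
  open import Data.Nat.Properties
  open import Data.Nat.DivMod using (_/_; _%_; m%n<n; m<n⇒m%n≡m; [m+n]%n≡m%n; %-distribˡ-+; m%n%n≡m%n; m≤n⇒[n∸m]%m≡n%m; m/n*n≤m; m≡m%n+[m/n]*n)
  open import Data.Nat.Tactic.RingSolver using (solve-∀)
  open import Data.Fin using (Fin; zero; suc; toℕ; fromℕ<)
  import Data.Fin as Fin
  import Data.Fin.Properties as Fin
  open import Data.Fin.Properties using (toℕ-fromℕ<; toℕ<n; toℕ-injective)
  open import Data.Fin.Subset using (Subset; ∣_∣; _∪_; _∩_; _─_; _⊆_) renaming (_∈_ to _∈ₛ_; _∉_ to _∉ₛ_)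
  import Data.Fin.Subset as Subset
  open import Data.Fin.Subset.Properties using (drop-∷-⊆; ∣p∣≤n; _⊆?_; p─q⊆p; x∈p∩q⁻; x∈p∪q⁻; x∈p∪q⁺; x∈p∧x∉q⇒x∈p─q; p⊂q⇒∣p∣<∣q∣; p─q─r≡p─q∪r) renaming (_∈?_ to _∈ₛ?_)
  open import Data.List as List using (List; []; _∷_; _++_; length; map; filter; concatMap; allFin; take)
  open import Data.List.Properties using (length-++; length-tabulate; length-map; length-filter; filter-++; take-map; ++-identityʳ)
  open import Data.List.Membership.Propositional using (_∈_; _∉_; find; lose)
  open import Data.List.Membership.Propositional.Properties using (∈-∃++; ∈-++⁻; ∈-++⁺ˡ; ∈-++⁺ʳ; ∈-filter⁻; ∈-filter⁺; ∈-map⁺; ∈-map⁻; ∈-allFin; ∈-concatMap⁺; ∈-concatMap⁻; ∈-tabulate⁻; ∈-lookup)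
  open import Data.List.Relation.Unary.All as All using (All; []; _∷_)
  open import Data.List.Relation.Unary.Any as Any using (Any; here; there)
  open import Data.List.Relation.Unary.Any.Properties using (lookup-index)
  open import Data.List.Relation.Unary.AllPairs using ([]; _∷_)
  open import Data.List.Relation.Unary.Unique.Propositional using (Unique)
  import Data.List.Relation.Unary.Unique.Propositional.Properties as Unique
  open import Data.Maybe as Maybe using (Maybe; just; nothing)
  open import Data.Vec as Vec using (Vec; []; _∷_; toList; lookup; tabulate)
  open import Data.Vec.Properties using (∷-injectiveˡ; ∷-injectiveʳ; toList-map; toList∘fromList; tabulate∘lookup; tabulate-cong; lookup∘tabulate; lookup⇒[]=; []=⇒lookup; lookup-map)
  open import Data.Product using (Σ; ∃; ∃₂; _×_; _,_; proj₁; proj₂)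
  open import Data.Sum as Sum using (_⊎_; inj₁; inj₂)
  open import Data.Empty using (⊥-elim)
  open import Function using (_∘_; id)
  open import Algebra.Properties.CommutativeSemigroup +-commutativeSemigroup using (interchange)
  open import Relation.Nullary using (Dec; yes; no; does; ¬_; ¬?)
  open import Relation.Nullary.Decidable using (_⊎-dec_; _×-dec_; dec-true)
  open import Relation.Unary using (Decidable)
  open import Relation.Binary.Definitions using (tri<; tri≈; tri>)
  open import Relation.Binary.PropositionalEquality using (_≡_; _≢_; refl; sym; trans; cong; cong₂; subst; module ≡-Reasoning)

  -- Indicators and finite sums

  ⟦_⟧ : {P : Set} → Dec P → ℕ
  ⟦ d ⟧ = if does d then 1 else 0

  ⟦⟧-true : {P : Set} (d : Dec P) → P → ⟦ d ⟧ ≡ 1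
  ⟦⟧-true (yes _) _ = refl
  ⟦⟧-true (no ¬p) p = ⊥-elim (¬p p)

  ⟦⟧-false : {P : Set} (d : Dec P) → ¬ P → ⟦ d ⟧ ≡ 0
  ⟦⟧-false (yes p) ¬p = ⊥-elim (¬p p)
  ⟦⟧-false (no _) _ = refl

  ⟦⟧≤1 : {P : Set} (d : Dec P) → ⟦ d ⟧ ≤ 1
  ⟦⟧≤1 (yes _) = ≤-refl
  ⟦⟧≤1 (no _) = z≤n

  ^-distribʳ-* : ∀ j p q → (p * q) ^ j ≡ p ^ j * q ^ j
  ^-distribʳ-* zero p q = refl
  ^-distribʳ-* (suc j) p q = trans (cong (p * q *_) (^-distribʳ-* j p q)) ([m*n]*[o*p]≡[m*o]*[n*p] p q (p ^ j) (q ^ j))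

  module _ {A : Set} where

    ∑ : List A → (A → ℕ) → ℕ
    ∑ [] f = 0
    ∑ (x ∷ xs) f = f x + ∑ xs f

    ∑-cong : ∀ xs {f g : A → ℕ} → (∀ x → f x ≡ g x) → ∑ xs f ≡ ∑ xs g
    ∑-cong [] h = refl
    ∑-cong (x ∷ xs) h = cong₂ _+_ (h x) (∑-cong xs h)

    ∑-mono-∈ : ∀ xs {f g : A → ℕ} → (∀ {x} → x ∈ xs → f x ≤ g x) → ∑ xs f ≤ ∑ xs g
    ∑-mono-∈ [] h = z≤n
    ∑-mono-∈ (x ∷ xs) h = +-mono-≤ (h (here refl)) (∑-mono-∈ xs (h ∘ there))

    ∑-mono : ∀ xs {f g : A → ℕ} → (∀ x → f x ≤ g x) → ∑ xs f ≤ ∑ xs g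
    ∑-mono xs h = ∑-mono-∈ xs (λ {x} _ → h x)

    ∑-+ : ∀ xs (f g : A → ℕ) → ∑ xs (λ x → f x + g x) ≡ ∑ xs f + ∑ xs g
    ∑-+ [] f g = refl
    ∑-+ (x ∷ xs) f g = trans (cong (f x + g x +_) (∑-+ xs f g)) (interchange (f x) (g x) (∑ xs f) (∑ xs g))

    ∑-*ˡ : ∀ xs c (f : A → ℕ) → ∑ xs (λ x → c * f x) ≡ c * ∑ xs f
    ∑-*ˡ [] c f = sym (*-zeroʳ c)
    ∑-*ˡ (x ∷ xs) c f = trans (cong (c * f x +_) (∑-*ˡ xs c f)) (sym (*-distribˡ-+ c (f x) (∑ xs f)))

    ∑-const : ∀ (xs : List A) c → ∑ xs (λ _ → c) ≡ length xs * c
    ∑-const [] c = refl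
    ∑-const (x ∷ xs) c = cong (c +_) (∑-const xs c)

    ∑-++ : ∀ xs ys (f : A → ℕ) → ∑ (xs ++ ys) f ≡ ∑ xs f + ∑ ys f
    ∑-++ [] ys f = refl
    ∑-++ (x ∷ xs) ys f = trans (cong (f x +_) (∑-++ xs ys f)) (sym (+-assoc (f x) _ _))

    ∑-Unique-⊆ : ∀ {xs ys} (f : A → ℕ) → Unique xs → (∀ {x} → x ∈ xs → x ∈ ys) → ∑ xs f ≤ ∑ ys f
    ∑-Unique-⊆ {[]} f u h = z≤n
    ∑-Unique-⊆ {x ∷ xs} f (x∉ ∷ u) h with ∈-∃++ (h (here refl))
    ... | as , bs , refl = begin
        f x + ∑ xs f ≤⟨ +-monoʳ-≤ (f x) (∑-Unique-⊆ f u sub) ⟩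
        f x + ∑ (as ++ bs) f ≡⟨ cong (f x +_) (∑-++ as bs f) ⟩
        f x + (∑ as f + ∑ bs f) ≡⟨ swap (f x) (∑ as f) (∑ bs f) ⟩
        ∑ as f + (f x + ∑ bs f) ≡⟨ sym (∑-++ as (x ∷ bs) f) ⟩
        ∑ (as ++ x ∷ bs) f ∎
      where
        open ≤-Reasoning
        swap : ∀ a b c → a + (b + c) ≡ b + (a + c)
        swap = solve-∀
        sub : ∀ {y} → y ∈ xs → y ∈ as ++ bs
        sub y∈ with ∈-++⁻ as (h (there y∈))
        ... | inj₁ p = ∈-++⁺ˡ p
        ... | inj₂ (here refl) = ⊥-elim (All.lookup x∉ y∈ refl)
        ... | inj₂ (there p) = ∈-++⁺ʳ as p

    length-∑ : ∀ (xs : List A) → length xs ≡ ∑ xs (λ _ → 1)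
    length-∑ xs = sym (trans (∑-const xs 1) (*-identityʳ _))

    length-Unique-⊆ : ∀ {xs ys : List A} → Unique xs → (∀ {x} → x ∈ xs → x ∈ ys) → length xs ≤ length ys
    length-Unique-⊆ {xs} {ys} u h = ≤-trans (≤-reflexive (length-∑ xs)) (≤-trans (∑-Unique-⊆ (λ _ → 1) u h) (≤-reflexive (sym (length-∑ ys))))

    ∑-⟦⟧ : ∀ {P : A → Set} (P? : Decidable P) xs → ∑ xs (λ x → ⟦ P? x ⟧) ≡ length (filter P? xs)
    ∑-⟦⟧ P? [] = refl
    ∑-⟦⟧ P? (x ∷ xs) with P? x
    ... | yes _ = cong suc (∑-⟦⟧ P? xs)
    ... | no _ = ∑-⟦⟧ P? xs

    ∑-Unique-⟦⟧ : ∀ {P : A → Set} (P? : Decidable P) {xs} ys → Unique xs → (∀ {x} → P x → x ∈ ys) →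
      ∑ xs (λ x → ⟦ P? x ⟧) ≤ length ys
    ∑-Unique-⟦⟧ P? {xs} ys u h = ≤-trans (≤-reflexive (∑-⟦⟧ P? xs))
      (length-Unique-⊆ (Unique.filter⁺ P? u) (λ x∈ → h (proj₂ (∈-filter⁻ P? {xs = xs} x∈))))

  ∑-map : ∀ {A B : Set} (f : A → B) xs (g : B → ℕ) → ∑ (map f xs) g ≡ ∑ xs (g ∘ f)
  ∑-map f [] g = refl
  ∑-map f (x ∷ xs) g = cong (g (f x) +_) (∑-map f xs g)

  ∑-concatMap : ∀ {A B : Set} (f : A → List B) xs (g : B → ℕ) →
    ∑ (concatMap f xs) g ≡ ∑ xs (λ x → ∑ (f x) g)
  ∑-concatMap f [] g = refl
  ∑-concatMap f (x ∷ xs) g = trans (∑-++ (f x) _ g) (cong (∑ (f x) g +_) (∑-concatMap f xs g))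

  argmin : ∀ {A : Set} {P : A → Set} (P? : Decidable P) (f : A → ℕ) xs → Any P xs →
    ∃ λ x → x ∈ xs × P x × (∀ {y} → y ∈ xs → P y → f x ≤ f y)
  argmin {A} {P} P? f (x ∷ xs) any with Any.any? P? xs
  ... | no none = x , here refl , px any , λ { (here refl) _ → ≤-refl ; (there y∈) py → ⊥-elim (none (lose y∈ py)) }
    where
      px : Any P (x ∷ xs) → P x
      px (here p) = p
      px (there a) = ⊥-elim (none a)
  ... | yes some with argmin P? f xs some
  ... | z , z∈ , pz , zmin with P? x | f x ≤? f z
  ... | yes px | yes le = x , here refl , px , λ { (here refl) _ → ≤-refl ; (there y∈) py → ≤-trans le (zmin y∈ py) }
  ... | yes px | no gt = z , there z∈ , pz , λ { (here refl) _ → <⇒≤ (≰⇒> gt) ; (there y∈) py → zmin y∈ py }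
  ... | no ¬px | _ = z , there z∈ , pz , λ { (here refl) py → ⊥-elim (¬px py) ; (there y∈) py → zmin y∈ py }

  -- Sums over the cube of subsets of Fin m

  sumV : ∀ {m} → (Subset m → ℕ) → ℕ
  sumV {zero} f = f []
  sumV {suc m} f = sumV (f ∘ (true ∷_)) + sumV (f ∘ (false ∷_))

  -- (1 + a′)^m times the expectation over a random set with density 1 / (1 + a′)
  wsum : ∀ {m} → ℕ → (Subset m → ℕ) → ℕ
  wsum {zero} a′ f = f []
  wsum {suc m} a′ f = wsum a′ (f ∘ (true ∷_)) + a′ * wsum a′ (f ∘ (false ∷_))

  disjSum : ∀ {m} → Subset m → (Subset m → ℕ) → ℕ
  disjSum [] f = f []
  disjSum (true ∷ W) f = disjSum W (f ∘ (false ∷_))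
  disjSum (false ∷ W) f = disjSum W (f ∘ (true ∷_)) + disjSum W (f ∘ (false ∷_))

  -- The indicator of T ⊆ G as a product over coordinates, so that sums over the cube factor one
  -- coordinate at a time.
  sub : ∀ {m} → Subset m → Subset m → ℕ
  sub [] [] = 1
  sub (true ∷ T) (true ∷ G) = sub T G
  sub (true ∷ T) (false ∷ G) = 0
  sub (false ∷ T) (_ ∷ G) = sub T G

  sub-⊆ : ∀ {m} (T G : Subset m) → T ⊆ G → sub T G ≡ 1
  sub-⊆ [] [] h = refl
  sub-⊆ (true ∷ T) (true ∷ G) h = sub-⊆ T G (drop-∷-⊆ h)
  sub-⊆ (true ∷ T) (false ∷ G) h with h Vec.here
  ... | ()
  sub-⊆ (false ∷ T) (_ ∷ G) h = sub-⊆ T G (drop-∷-⊆ h)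

  sub-∩ : ∀ {m} (T F G : Subset m) → sub T F * sub T G ≡ sub T (F ∩ G)
  sub-∩ [] [] [] = refl
  sub-∩ (true ∷ T) (true ∷ F) (true ∷ G) = sub-∩ T F G
  sub-∩ (true ∷ T) (true ∷ F) (false ∷ G) = *-zeroʳ (sub T F)
  sub-∩ (true ∷ T) (false ∷ F) (_ ∷ G) = refl
  sub-∩ (false ∷ T) (_ ∷ F) (_ ∷ G) = sub-∩ T F G

  sumV-mono : ∀ {m} {f g : Subset m → ℕ} → (∀ T → f T ≤ g T) → sumV f ≤ sumV g
  sumV-mono {zero} h = h []
  sumV-mono {suc m} h = +-mono-≤ (sumV-mono (λ T → h (true ∷ T))) (sumV-mono (λ T → h (false ∷ T)))

  sumV-cong : ∀ {m} {f g : Subset m → ℕ} → (∀ T → f T ≡ g T) → sumV f ≡ sumV g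
  sumV-cong {zero} h = h []
  sumV-cong {suc m} h = cong₂ _+_ (sumV-cong (λ T → h (true ∷ T))) (sumV-cong (λ T → h (false ∷ T)))

  sumV-+ : ∀ {m} (f g : Subset m → ℕ) → sumV (λ T → f T + g T) ≡ sumV f + sumV g
  sumV-+ {zero} f g = refl
  sumV-+ {suc m} f g = trans (cong₂ _+_ (sumV-+ (f ∘ (true ∷_)) (g ∘ (true ∷_))) (sumV-+ (f ∘ (false ∷_)) (g ∘ (false ∷_))))
    (interchange (sumV (f ∘ (true ∷_))) (sumV (g ∘ (true ∷_))) (sumV (f ∘ (false ∷_))) (sumV (g ∘ (false ∷_))))

  sumV-*ˡ : ∀ {m} c (f : Subset m → ℕ) → sumV (λ T → c * f T) ≡ c * sumV f
  sumV-*ˡ {zero} c f = refl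
  sumV-*ˡ {suc m} c f = trans (cong₂ _+_ (sumV-*ˡ c (f ∘ (true ∷_))) (sumV-*ˡ c (f ∘ (false ∷_))))
    (sym (*-distribˡ-+ c (sumV (f ∘ (true ∷_))) (sumV (f ∘ (false ∷_)))))

  sumV-0 : ∀ {m} → sumV {m} (λ _ → 0) ≡ 0
  sumV-0 {zero} = refl
  sumV-0 {suc m} = cong₂ _+_ (sumV-0 {m}) (sumV-0 {m})

  sumV-∑ : ∀ {m} {A : Set} (xs : List A) (f : A → Subset m → ℕ) →
    sumV (λ T → ∑ xs (λ x → f x T)) ≡ ∑ xs (λ x → sumV (f x))
  sumV-∑ {m} [] f = sumV-0 {m}
  sumV-∑ (x ∷ xs) f = trans (sumV-+ (f x) _) (cong (sumV (f x) +_) (sumV-∑ xs f))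

  -- The binomial theorem: sets outside `G` contribute nothing, and each element of `G`
  -- independently contributes `b` if taken and 1 if not.
  sumV-sub : ∀ {m} b (G : Subset m) → sumV (λ T → b ^ ∣ T ∣ * sub T G) ≡ (1 + b) ^ ∣ G ∣
  sumV-sub b [] = refl
  sumV-sub {suc m} b (true ∷ G) = begin
      sumV (λ T → b * b ^ ∣ T ∣ * sub T G) + s
        ≡⟨ cong (_+ s) (trans (sumV-cong {m} (λ T → *-assoc b (b ^ ∣ T ∣) (sub T G))) (sumV-*ˡ b (λ T → b ^ ∣ T ∣ * sub T G))) ⟩
      b * s + s ≡⟨ cong (λ z → b * z + z) (sumV-sub b G) ⟩
      b * (1 + b) ^ ∣ G ∣ + (1 + b) ^ ∣ G ∣ ≡⟨ +-comm (b * (1 + b) ^ ∣ G ∣) _ ⟩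
      (1 + b) * (1 + b) ^ ∣ G ∣ ∎
    where
      open ≡-Reasoning
      s = sumV (λ T → b ^ ∣ T ∣ * sub T G)
  sumV-sub {suc m} b (false ∷ G) = cong₂ _+_
    (trans (sumV-cong {m} (λ T → *-zeroʳ (b * b ^ ∣ T ∣))) (sumV-0 {m})) (sumV-sub b G)

  wsum-mono : ∀ {m} a′ {f g : Subset m → ℕ} → (∀ W → f W ≤ g W) → wsum a′ f ≤ wsum a′ g
  wsum-mono {zero} a′ h = h []
  wsum-mono {suc m} a′ h = +-mono-≤ (wsum-mono a′ (λ W → h (true ∷ W))) (*-monoʳ-≤ a′ (wsum-mono a′ (λ W → h (false ∷ W))))

  wsum-cong : ∀ {m} a′ {f g : Subset m → ℕ} → (∀ W → f W ≡ g W) → wsum a′ f ≡ wsum a′ g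
  wsum-cong {zero} a′ h = h []
  wsum-cong {suc m} a′ h = cong₂ (λ p q → p + a′ * q) (wsum-cong a′ (λ W → h (true ∷ W))) (wsum-cong a′ (λ W → h (false ∷ W)))

  wsum-+ : ∀ {m} a′ (f g : Subset m → ℕ) → wsum a′ (λ W → f W + g W) ≡ wsum a′ f + wsum a′ g
  wsum-+ {zero} a′ f g = refl
  wsum-+ {suc m} a′ f g rewrite wsum-+ a′ (f ∘ (true ∷_)) (g ∘ (true ∷_)) | wsum-+ a′ (f ∘ (false ∷_)) (g ∘ (false ∷_)) =
      lem a′ (wsum a′ (f ∘ (true ∷_))) _ (wsum a′ (f ∘ (false ∷_))) _
    where
      lem : ∀ a p q r s → (p + q) + a * (r + s) ≡ (p + a * r) + (q + a * s)
      lem = solve-∀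

  wsum-*ˡ : ∀ {m} a′ c (f : Subset m → ℕ) → wsum a′ (λ W → c * f W) ≡ c * wsum a′ f
  wsum-*ˡ {zero} a′ c f = refl
  wsum-*ˡ {suc m} a′ c f rewrite wsum-*ˡ a′ c (f ∘ (true ∷_)) | wsum-*ˡ a′ c (f ∘ (false ∷_)) =
      lem a′ c (wsum a′ (f ∘ (true ∷_))) (wsum a′ (f ∘ (false ∷_)))
    where
      lem : ∀ a c p q → c * p + a * (c * q) ≡ c * (p + a * q)
      lem = solve-∀

  wsum-const : ∀ {m} a′ c → wsum {m} a′ (λ _ → c) ≡ (1 + a′) ^ m * c
  wsum-const {zero} a′ c = sym (+-identityʳ c)
  wsum-const {suc m} a′ c rewrite wsum-const {m} a′ c = lem a′ ((1 + a′) ^ m) c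
    where
      lem : ∀ a p c → p * c + a * (p * c) ≡ (1 + a) * p * c
      lem = solve-∀

  disjSum-+ : ∀ {m} (W : Subset m) (f g : Subset m → ℕ) → disjSum W (λ T → f T + g T) ≡ disjSum W f + disjSum W g
  disjSum-+ [] f g = refl
  disjSum-+ (true ∷ W) f g = disjSum-+ W (f ∘ (false ∷_)) (g ∘ (false ∷_))
  disjSum-+ (false ∷ W) f g rewrite disjSum-+ W (f ∘ (true ∷_)) (g ∘ (true ∷_)) | disjSum-+ W (f ∘ (false ∷_)) (g ∘ (false ∷_)) =
    interchange (disjSum W (f ∘ (true ∷_))) (disjSum W (g ∘ (true ∷_))) (disjSum W (f ∘ (false ∷_))) (disjSum W (g ∘ (false ∷_)))

  disjSum-0 : ∀ {m} (W : Subset m) → disjSum W (λ _ → 0) ≡ 0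
  disjSum-0 [] = refl
  disjSum-0 (true ∷ W) = disjSum-0 W
  disjSum-0 (false ∷ W) = cong₂ _+_ (disjSum-0 W) (disjSum-0 W)

  disjSum-∑ : ∀ {m} {A : Set} (W : Subset m) (xs : List A) (f : A → Subset m → ℕ) →
    ∑ xs (λ x → disjSum W (f x)) ≡ disjSum W (λ T → ∑ xs (λ x → f x T))
  disjSum-∑ W [] f = sym (disjSum-0 W)
  disjSum-∑ W (x ∷ xs) f = trans (cong (disjSum W (f x) +_) (disjSum-∑ W xs f)) (sym (disjSum-+ W (f x) _))

  -- `F ─ W` is one of the sets disjoint from `W`. This turns a statement about one fragment into a
  -- union bound over all candidates for what it leaves outside `W`.
  disjSum-─ : ∀ {m} (F W : Subset m) (f : Subset m → ℕ) → f (F ─ W) ≤ disjSum W f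
  disjSum-─ [] [] f = ≤-refl
  disjSum-─ (_ ∷ F) (true ∷ W) f = disjSum-─ F W (f ∘ (false ∷_))
  disjSum-─ (true ∷ F) (false ∷ W) f = ≤-trans (disjSum-─ F W (f ∘ (true ∷_))) (m≤m+n _ _)
  disjSum-─ (false ∷ F) (false ∷ W) f = ≤-trans (disjSum-─ F W (f ∘ (false ∷_))) (m≤n+m _ _)

  -- Substituting U = W ∪ T costs a factor 1 + a′ for every element moved into the random set.
  wsum-disjSum : ∀ {m} a′ (h : Subset m → Subset m → ℕ) →
    wsum a′ (λ W → disjSum W (λ T → h (W ∪ T) T)) ≤ wsum a′ (λ U → sumV (λ T → (1 + a′) ^ ∣ T ∣ * h U T))
  wsum-disjSum {zero} a′ h = ≤-reflexive (sym (+-identityʳ _))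
  wsum-disjSum {suc m} a′ h = begin
      L true false + a′ * wsum a′ (λ W → disjSum W (λ T → h (true ∷ (W ∪ T)) (true ∷ T)) + disjSum W (λ T → h (false ∷ (W ∪ T)) (false ∷ T)))
        ≡⟨ cong (λ z → L true false + a′ * z) (wsum-+ {m} a′ (λ W → disjSum W (λ T → h (true ∷ (W ∪ T)) (true ∷ T))) (λ W → disjSum W (λ T → h (false ∷ (W ∪ T)) (false ∷ T)))) ⟩
      L true false + a′ * (L true true + L false false)
        ≤⟨ +-mono-≤ (wsum-disjSum a′ (λ U T → h (true ∷ U) (false ∷ T)))
             (*-monoʳ-≤ a′ (+-mono-≤ (wsum-disjSum a′ (λ U T → h (true ∷ U) (true ∷ T))) (wsum-disjSum a′ (λ U T → h (false ∷ U) (false ∷ T))))) ⟩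
      -- An element of T has weight `a′` on the left and `1 + a′` on the right, so one `R true true`
      -- is given away here; the next step also adds the pairs in which T is not inside U.
      R true false + a′ * (R true true + R false false) ≤⟨ lem a′ (R true false) (R true true) (R false false) ⟩
      ((1 + a′) * R true true + R true false) + a′ * R false false
        ≤⟨ +-mono-≤ (≤-reflexive (sym top)) (*-monoʳ-≤ a′ (wsum-mono {m} a′ (λ U → m≤n+m (r false false U) (sumV (λ T → (1 + a′) * (1 + a′) ^ ∣ T ∣ * h (false ∷ U) (true ∷ T)))))) ⟩
      wsum a′ (λ U → sumV (λ T → (1 + a′) ^ ∣ T ∣ * h U T)) ∎
    where
      open ≤-Reasoning
      L : Bool → Bool → ℕ
      L u t = wsum a′ (λ W → disjSum W (λ T → h (u ∷ (W ∪ T)) (t ∷ T)))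
      r : Bool → Bool → Subset m → ℕ
      r u t U = sumV (λ T → (1 + a′) ^ ∣ T ∣ * h (u ∷ U) (t ∷ T))
      R : Bool → Bool → ℕ
      R u t = wsum a′ (r u t)
      eq : ∀ a p q r → (1 + a) * q + p + a * r ≡ p + a * (q + r) + q
      eq = solve-∀
      lem : ∀ a p q r → p + a * (q + r) ≤ ((1 + a) * q + p) + a * r
      lem a p q r = ≤-trans (m≤m+n _ q) (≤-reflexive (sym (eq a p q r)))
      pull : ∀ U → sumV (λ T → (1 + a′) * (1 + a′) ^ ∣ T ∣ * h (true ∷ U) (true ∷ T)) ≡ (1 + a′) * r true true U
      pull U = trans (sumV-cong {m} (λ T → *-assoc (1 + a′) ((1 + a′) ^ ∣ T ∣) (h (true ∷ U) (true ∷ T))))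
        (sumV-*ˡ {m} (1 + a′) (λ T → (1 + a′) ^ ∣ T ∣ * h (true ∷ U) (true ∷ T)))
      top : wsum a′ (λ U → sumV (λ T → (1 + a′) * (1 + a′) ^ ∣ T ∣ * h (true ∷ U) (true ∷ T)) + r true false U)
        ≡ (1 + a′) * R true true + R true false
      top = trans (wsum-cong {m} a′ (λ U → cong (_+ r true false U) (pull U)))
        (trans (wsum-+ {m} a′ (λ U → (1 + a′) * r true true U) (r true false)) (cong (_+ R true false) (wsum-*ˡ {m} a′ (1 + a′) (r true true))))

  -- Fragments and a single exposure round

  x∈p─q⇒x∉q : ∀ {m} (p q : Subset m) {x} → x ∈ₛ (p ─ q) → x ∉ₛ q
  x∈p─q⇒x∉q (_ ∷ p) (true ∷ q) {zero} () Vec.here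
  x∈p─q⇒x∉q (_ ∷ p) (true ∷ q) {suc x} (Vec.there h) (Vec.there k) = x∈p─q⇒x∉q p q h k
  x∈p─q⇒x∉q (_ ∷ p) (false ∷ q) {suc x} (Vec.there h) (Vec.there k) = x∈p─q⇒x∉q p q h k

  ⊆-∣∣⇒⊇ : ∀ {m} {p q : Subset m} → p ⊆ q → ∣ q ∣ ≤ ∣ p ∣ → q ⊆ p
  ⊆-∣∣⇒⊇ {p = p} p⊆q le {x} x∈q with x ∈ₛ? p
  ... | yes x∈p = x∈p
  ... | no x∉p = ⊥-elim (<⇒≱ (p⊂q⇒∣p∣<∣q∣ (p⊆q , x , x∈q , x∉p)) le)

  module Fragments {M : ℕ} {P : Set} (X : List P) (S : P → Subset M) where

    -- The fragment of `x` has at most `k` edges. The residual set may come from another square `y`,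
    -- so a round can make progress without completing `S x` itself. For `k = 0` the condition says
    -- that some square lies in `V`.
    Good : ℕ → Subset M → P → Set
    Good k V x = Any (λ y → (S y ─ V) ⊆ S x × ∣ S y ─ V ∣ ≤ k) X

    good? : ∀ k V x → Dec (Good k V x)
    good? k V x = Any.any? (λ y → ((S y ─ V) ⊆? S x) ×-dec (∣ S y ─ V ∣ ≤? k)) X

    good : ℕ → Subset M → ℕ
    good k V = ∑ X (λ x → ⟦ good? k V x ⟧)

    containing : Subset M → ℕ
    containing T = ∑ X (λ x → sub T (S x))

    -- This is `length X` times the sum of a^|T| P(T ⊆ S) over the T ⊆ F with more than `k`
    -- elements, since `containing` counts instead of averaging.
    tail : ℕ → ℕ → Subset M → ℕ
    tail a k F = sumV (λ T → a ^ ∣ T ∣ * (sub T F * ⟦ k <? ∣ T ∣ ⟧ * containing T))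

    module _ (V : Subset M) (k k′ : ℕ) where

      private
        Frag : Subset M → P → Set
        Frag U y = (S y ─ V) ⊆ U × ∣ S y ─ V ∣ ≤ k

        frag? : ∀ U → Decidable (Frag U)
        frag? U y = ((S y ─ V) ⊆? U) ×-dec (∣ S y ─ V ∣ ≤? k)

      -- The indicator that T is a large subset of the fragment picked by `find`. Neither `W` nor
      -- `x` enters the choice, so for fixed T the sum over `x` can be carried out separately and
      -- yields `containing T`.
      canonical : ∀ {U} → Dec (Any (Frag U) X) → Subset M → ℕ
      canonical (yes any) T = sub T (S (proj₁ (find any)) ─ V) * ⟦ k′ <? ∣ T ∣ ⟧
      canonical (no _) T = 0

      cost : Subset M → Subset M → ℕ
      cost U T = canonical (Any.any? (frag? U) X) T

      -- T = F ─ W for a fragment F leaving the least outside W; by minimality T lies in every fragment F′ ⊆ W ∪ T,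
      -- in particular in the one that canonical picks from W ∪ T alone.
      good-step : ∀ W x → ⟦ good? k V x ⟧ ≤ ⟦ good? k′ (V ∪ W) x ⟧ + disjSum W (λ T → cost (W ∪ T) T * sub T (S x))
      good-step W x with good? k V x
      ... | no _ = z≤n
      -- The minimum is over fragments inside `W ∪ S x`, not only inside `S x`: the one picked from
      -- `W ∪ T` is only known to satisfy the weaker condition, and minimality has to apply to it.
      ... | yes g with argmin (frag? (W ∪ S x)) (λ y → ∣ S y ─ V ─ W ∣) X
                         (Any.map (λ (s , c) → (λ {t} t∈ → x∈p∪q⁺ {p = W} {q = S x} (inj₂ (s t∈))) , c) g)
      ... | y , y∈ , (F⊆ , F≤k) , min = go (∣ S y ─ V ─ W ∣ ≤? k′)
        where
          T = S y ─ V ─ W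
          T⊆S : T ⊆ S x
          T⊆S t∈ with x∈p∪q⁻ W (S x) (F⊆ (p─q⊆p (S y ─ V) W t∈))
          ... | inj₁ t∈W = ⊥-elim (x∈p─q⇒x∉q (S y ─ V) W t∈ t∈W)
          ... | inj₂ t∈S = t∈S
          F⊆W∪T : (S y ─ V) ⊆ (W ∪ T)
          F⊆W∪T {t} t∈ with t ∈ₛ? W
          ... | yes t∈W = x∈p∪q⁺ {p = W} {q = T} (inj₁ t∈W)
          ... | no t∉W = x∈p∪q⁺ {p = W} {q = T} (inj₂ (x∈p∧x∉q⇒x∈p─q t∈ t∉W))
          canonical≡1 : (d : Dec (Any (Frag (W ∪ T)) X)) → k′ < ∣ T ∣ → canonical d T ≡ 1
          canonical≡1 (no none) _ = ⊥-elim (none (lose y∈ ((λ {t} → F⊆W∪T {t}) , F≤k)))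
          canonical≡1 (yes any) lt with find any
          ... | z , z∈ , (Fz⊆ , Fz≤k) = cong₂ _*_ (sub-⊆ T (S z ─ V) T⊆Fz) (⟦⟧-true (k′ <? ∣ T ∣) lt)
            where
              Fz─W⊆T : (S z ─ V ─ W) ⊆ T
              Fz─W⊆T t∈ with x∈p∪q⁻ W T (Fz⊆ (p─q⊆p (S z ─ V) W t∈))
              ... | inj₁ t∈W = ⊥-elim (x∈p─q⇒x∉q (S z ─ V) W t∈ t∈W)
              ... | inj₂ t∈T = t∈T
              Fz⊆W∪S : (S z ─ V) ⊆ (W ∪ S x)
              Fz⊆W∪S t∈ with x∈p∪q⁻ W T (Fz⊆ t∈)
              ... | inj₁ t∈W = x∈p∪q⁺ {p = W} {q = S x} (inj₁ t∈W)
              ... | inj₂ t∈T = x∈p∪q⁺ {p = W} {q = S x} (inj₂ (T⊆S t∈T))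
              T⊆Fz : T ⊆ (S z ─ V)
              T⊆Fz t∈ = p─q⊆p (S z ─ V) W (⊆-∣∣⇒⊇ Fz─W⊆T (min z∈ ((λ {t} → Fz⊆W∪S {t}) , Fz≤k)) t∈)
          f : Subset M → ℕ
          f T′ = cost (W ∪ T′) T′ * sub T′ (S x)
          go : Dec (∣ T ∣ ≤ k′) → 1 ≤ ⟦ good? k′ (V ∪ W) x ⟧ + disjSum W f
          go (yes le) = ≤-trans (≤-reflexive (sym (⟦⟧-true (good? k′ (V ∪ W) x)
            (lose y∈ (subst (λ Z → Z ⊆ S x × ∣ Z ∣ ≤ k′) (p─q─r≡p─q∪r (S y) V W) ((λ {t} → T⊆S {t}) , le)))))) (m≤m+n _ _)
          go (no gt) = ≤-trans (≤-trans (≤-reflexive (sym (cong₂ _*_ (canonical≡1 (Any.any? (frag? (W ∪ T)) X) (≰⇒> gt)) (sub-⊆ T (S x) T⊆S))))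
            (disjSum-─ (S y ─ V) W f)) (m≤n+m _ ⟦ good? k′ (V ∪ W) x ⟧)

      -- Sum `good-step` over `x`, average over W and substitute U = W ∪ T. For each U the T that
      -- count are subsets of one fragment, so the hypothesis bounds their total; if U contains no
      -- fragment the total is 0. The multiplier `c` expresses an error of `Q / c` without division.
      round : ∀ a′ c Q → (∀ F y → y ∈ X → F ⊆ S y → ∣ F ∣ ≤ k → c * tail (1 + a′) k′ F ≤ Q) →
        (1 + a′) ^ M * (c * good k V) ≤ wsum a′ (λ W → c * good k′ (V ∪ W)) + (1 + a′) ^ M * Q
      round a′ c Q hyp = begin
          A * (c * good k V) ≡⟨ sym (wsum-const {M} a′ _) ⟩
          wsum {M} a′ (λ _ → c * good k V) ≤⟨ wsum-mono a′ (λ W → *-monoʳ-≤ c (pointwise W)) ⟩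
          wsum a′ (λ W → c * (good k′ (V ∪ W) + disjSum W (λ T → h (W ∪ T) T)))
            ≡⟨ trans (wsum-cong a′ (λ W → *-distribˡ-+ c (good k′ (V ∪ W)) (disjSum W (λ T → h (W ∪ T) T)))) (wsum-+ a′ (λ W → c * good k′ (V ∪ W)) _) ⟩
          G + wsum a′ (λ W → c * disjSum W (λ T → h (W ∪ T) T)) ≡⟨ cong (G +_) (wsum-*ˡ a′ c (λ W → disjSum W (λ T → h (W ∪ T) T))) ⟩
          G + c * wsum a′ (λ W → disjSum W (λ T → h (W ∪ T) T)) ≤⟨ +-monoʳ-≤ G (*-monoʳ-≤ c (wsum-disjSum a′ h)) ⟩
          G + c * wsum a′ (λ U → sumV (λ T → (1 + a′) ^ ∣ T ∣ * h U T)) ≡⟨ cong (G +_) (sym (wsum-*ˡ a′ c (λ U → sumV (λ T → (1 + a′) ^ ∣ T ∣ * h U T)))) ⟩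
          G + wsum a′ (λ U → c * sumV (λ T → (1 + a′) ^ ∣ T ∣ * h U T)) ≤⟨ +-monoʳ-≤ G (wsum-mono a′ (λ U → bound U (Any.any? (frag? U) X))) ⟩
          G + wsum {M} a′ (λ _ → Q) ≡⟨ cong (G +_) (wsum-const {M} a′ Q) ⟩
          G + A * Q ∎
        where
          open ≤-Reasoning
          A = (1 + a′) ^ M
          G = wsum a′ (λ W → c * good k′ (V ∪ W))
          h : Subset M → Subset M → ℕ
          h U T = cost U T * containing T
          pointwise : ∀ W → good k V ≤ good k′ (V ∪ W) + disjSum W (λ T → h (W ∪ T) T)
          pointwise W = ≤-trans (∑-mono X (good-step W)) (≤-reflexive (trans (∑-+ X _ _) (cong (good k′ (V ∪ W) +_)
            (trans (disjSum-∑ W X (λ x T → cost (W ∪ T) T * sub T (S x))) (disjSum-cong W (λ T → ∑-*ˡ X (cost (W ∪ T) T) (λ x → sub T (S x))))))))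
            where
              disjSum-cong : ∀ {m} (W : Subset m) {f g : Subset m → ℕ} → (∀ T → f T ≡ g T) → disjSum W f ≡ disjSum W g
              disjSum-cong [] e = e []
              disjSum-cong (true ∷ W) e = disjSum-cong W (λ T → e (false ∷ T))
              disjSum-cong (false ∷ W) e = cong₂ _+_ (disjSum-cong W (λ T → e (true ∷ T))) (disjSum-cong W (λ T → e (false ∷ T)))
          bound : ∀ U (d : Dec (Any (Frag U) X)) → c * sumV (λ T → (1 + a′) ^ ∣ T ∣ * (canonical d T * containing T)) ≤ Q
          bound U (no _) = ≤-trans (≤-reflexive (trans (cong (c *_) (trans (sumV-cong {M} (λ T → *-zeroʳ ((1 + a′) ^ ∣ T ∣))) (sumV-0 {M}))) (*-zeroʳ c))) z≤n
          bound U (yes any) with find any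
          ... | z , z∈ , (_ , Fz≤k) = hyp (S z ─ V) z z∈ (p─q⊆p (S z) V) Fz≤k

    expMoment : ℕ → Subset M → ℕ
    expMoment B F = ∑ X (λ x → B ^ ∣ F ∩ S x ∣)

    -- For a fixed `x` the sets T that survive are the subsets of `F ∩ S x`, so exchanging the sums
    -- leaves a binomial sum for each `x`.
    sumV-expMoment : ∀ b F → sumV (λ T → b ^ ∣ T ∣ * (sub T F * containing T)) ≡ expMoment (1 + b) F
    sumV-expMoment b F = begin
        sumV (λ T → b ^ ∣ T ∣ * (sub T F * containing T)) ≡⟨ sumV-cong {M} (λ T → trans (sym (*-assoc (b ^ ∣ T ∣) (sub T F) (containing T))) (sym (∑-*ˡ X (b ^ ∣ T ∣ * sub T F) (λ x → sub T (S x))))) ⟩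
        sumV (λ T → ∑ X (λ x → b ^ ∣ T ∣ * sub T F * sub T (S x))) ≡⟨ sumV-∑ {M} X (λ x T → b ^ ∣ T ∣ * sub T F * sub T (S x)) ⟩
        ∑ X (λ x → sumV (λ T → b ^ ∣ T ∣ * sub T F * sub T (S x)))
          ≡⟨ ∑-cong X (λ x → trans (sumV-cong {M} (λ T → trans (*-assoc (b ^ ∣ T ∣) (sub T F) (sub T (S x))) (cong (b ^ ∣ T ∣ *_) (sub-∩ T F (S x))))) (sumV-sub b (F ∩ S x))) ⟩
        expMoment (1 + b) F ∎
      where open ≡-Reasoning

    -- Markov's inequality for an exponential weight: a set with more than `k` elements satisfies
    -- x^(k+1) ≤ x^|T|, and this power is absorbed by replacing `a` with `x * a`.
    tail-markov : ∀ x a k F → 1 ≤ x → x ^ suc k * tail a k F ≤ expMoment (1 + x * a) F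
    tail-markov x a k F 1≤x = begin
        x ^ suc k * tail a k F ≡⟨ sym (sumV-*ˡ {M} (x ^ suc k) _) ⟩
        sumV (λ T → x ^ suc k * (a ^ ∣ T ∣ * (sub T F * ⟦ k <? ∣ T ∣ ⟧ * containing T))) ≤⟨ sumV-mono pt ⟩
        sumV (λ T → (x * a) ^ ∣ T ∣ * (sub T F * containing T)) ≡⟨ sumV-expMoment (x * a) F ⟩
        expMoment (1 + x * a) F ∎
      where
        open ≤-Reasoning
        rearrange : ∀ X A s N → X * (A * (s * 1 * N)) ≡ X * A * (s * N)
        rearrange = solve-∀
        vanish : ∀ X A s N → X * (A * (s * 0 * N)) ≡ 0
        vanish = solve-∀
        instance _ = >-nonZero 1≤x
        pt : ∀ T → x ^ suc k * (a ^ ∣ T ∣ * (sub T F * ⟦ k <? ∣ T ∣ ⟧ * containing T)) ≤ (x * a) ^ ∣ T ∣ * (sub T F * containing T)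
        pt T = by (k <? ∣ T ∣)
         where
          by : (d : Dec (k < ∣ T ∣)) → x ^ suc k * (a ^ ∣ T ∣ * (sub T F * ⟦ d ⟧ * containing T)) ≤ (x * a) ^ ∣ T ∣ * (sub T F * containing T)
          by (yes lt) = ≤-trans (≤-reflexive (rearrange (x ^ suc k) (a ^ ∣ T ∣) (sub T F) (containing T)))
            (*-monoˡ-≤ (sub T F * containing T) (≤-trans (*-monoˡ-≤ (a ^ ∣ T ∣) (^-monoʳ-≤ x lt)) (≤-reflexive (sym (^-distribʳ-* ∣ T ∣ x a)))))
          by (no _) = ≤-trans (≤-reflexive (vanish (x ^ suc k) (a ^ ∣ T ∣) (sub T F) (containing T))) z≤n

    -- The tail at 0 misses only T = ∅, whose share of the moment is exactly `length X`. Unlike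
    -- Markov's inequality this stays sharp when the moment is barely above `length X`.
    tail-zero : ∀ a F → tail a 0 F + length X ≤ expMoment (1 + a) F
    tail-zero a F = begin
        tail a 0 F + length X ≡⟨ cong₂ _+_ refl (sym empty) ⟩
        tail a 0 F + sumV (λ T → ⟦ ∣ T ∣ ≟ 0 ⟧ * containing T) ≡⟨ sym (sumV-+ {M} _ _) ⟩
        sumV (λ T → a ^ ∣ T ∣ * (sub T F * ⟦ 0 <? ∣ T ∣ ⟧ * containing T) + ⟦ ∣ T ∣ ≟ 0 ⟧ * containing T) ≤⟨ sumV-mono pt ⟩
        sumV (λ T → a ^ ∣ T ∣ * (sub T F * containing T)) ≡⟨ sumV-expMoment a F ⟩
        expMoment (1 + a) F ∎
      where
        open ≤-Reasoning
        sub-∅ : ∀ {m} (T G : Subset m) → ∣ T ∣ ≡ 0 → sub T G ≡ 1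
        sub-∅ [] [] e = refl
        sub-∅ (false ∷ T) (_ ∷ G) e = sub-∅ T G e
        count∅ : ∀ {m} → (f : Subset m → ℕ) (c : ℕ) → (∀ T → ∣ T ∣ ≡ 0 → f T ≡ c) → sumV (λ T → ⟦ ∣ T ∣ ≟ 0 ⟧ * f T) ≡ c
        count∅ {zero} f c h = trans (+-identityʳ _) (h [] refl)
        count∅ {suc m} f c h = cong₂ _+_ (sumV-0 {m}) (count∅ {m} (λ T → f (false ∷ T)) c (λ T e → h (false ∷ T) e))
        empty : sumV (λ T → ⟦ ∣ T ∣ ≟ 0 ⟧ * containing T) ≡ length X
        empty = count∅ {M} containing (length X) (λ T e → trans (∑-cong X (λ x → sub-∅ T (S x) e)) (sym (length-∑ X)))
        e1 : ∀ A s N → A * (s * 1 * N) + 0 ≡ A * (s * N)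
        e1 = solve-∀
        e2 : ∀ s N → 1 * (s * 0 * N) + 1 * N ≡ 1 * (1 * N)
        e2 = solve-∀
        pt : ∀ T → a ^ ∣ T ∣ * (sub T F * ⟦ 0 <? ∣ T ∣ ⟧ * containing T) + ⟦ ∣ T ∣ ≟ 0 ⟧ * containing T ≤ a ^ ∣ T ∣ * (sub T F * containing T)
        pt T = by ∣ T ∣ refl
         where
          by : ∀ j → ∣ T ∣ ≡ j → a ^ j * (sub T F * ⟦ 0 <? j ⟧ * containing T) + ⟦ j ≟ 0 ⟧ * containing T ≤ a ^ j * (sub T F * containing T)
          by zero eq = ≤-reflexive (trans (e2 (sub T F) (containing T)) (cong (λ z → 1 * (z * containing T)) (sym (sub-∅ T F eq))))
          by (suc j) eq = ≤-reflexive (e1 (a ^ suc j) (sub T F) (containing T))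

  -- Enumerating injective sequences

  infix 4 _∈?_

  _∈?_ : ∀ {n} (x : Fin n) xs → Dec (x ∈ xs)
  x ∈? xs = Any.any? (x Fin.≟_) xs

  ∉⇒Unique-∷ : ∀ {A : Set} {x : A} {xs} → x ∉ xs → Unique xs → Unique (x ∷ xs)
  ∉⇒Unique-∷ x∉ u = All.tabulate (λ { y∈ refl → x∉ y∈ }) ∷ u

  Unique-concatMap : ∀ {A B : Set} {f : A → List B} {xs} → Unique xs → (∀ x → Unique (f x)) →
    (∀ {x y z} → z ∈ f x → z ∈ f y → x ≡ y) → Unique (concatMap f xs)
  Unique-concatMap [] uf inj = []
  Unique-concatMap {f = f} {x ∷ xs} (x∉ ∷ u) uf inj = Unique.++⁺ (uf x) (Unique-concatMap u uf inj)
    (λ (p , q) → let y , y∈ , q′ = find (∈-concatMap⁻ f {xs = xs} q) in All.lookup x∉ y∈ (inj p q′))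

  module _ {n : ℕ} where

    avail : List (Fin n) → List (Fin n)
    avail used = filter (λ x → ¬? (x ∈? used)) (allFin n)

    -- Entries are chosen one at a time among the values still free, so a sum over permutations
    -- unfolds into the successive exposure of positions.
    inj : List (Fin n) → (l : ℕ) → List (Vec (Fin n) l)
    inj used zero = [] ∷ []
    inj used (suc l) = concatMap (λ x → map (x ∷_) (inj (x ∷ used) l)) (avail used)

    Injectiveᵥ : ∀ {l} → Vec (Fin n) l → Set
    Injectiveᵥ v = ∀ i j → lookup v i ≡ lookup v j → i ≡ j

    avail-∉ : ∀ {used x} → x ∈ avail used → x ∉ used
    avail-∉ {used} x∈ = proj₂ (∈-filter⁻ (λ x → ¬? (x ∈? used)) {xs = allFin n} x∈)

    avail-Unique : ∀ used → Unique (avail used)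
    avail-Unique used = Unique.filter⁺ (λ x → ¬? (x ∈? used)) (Unique.allFin⁺ n)

    length-avail : ∀ N used → Unique used → N + length used ≡ n → length (avail used) ≡ N
    length-avail N used u e = +-cancelʳ-≡ (length used) _ _ (trans (≤-antisym
        (≤-trans (≤-reflexive (sym (length-++ (avail used)))) (≤-trans (length-Unique-⊆ {ys = allFin n} both (λ {x} _ → ∈-allFin x)) (≤-reflexive (length-tabulate id))))
        (≤-trans (≤-reflexive (sym (length-tabulate {n = n} id))) (≤-trans (length-Unique-⊆ (Unique.allFin⁺ n) cover) (≤-reflexive (length-++ (avail used)))))) (sym e))
      where
        both : Unique (avail used ++ used)
        both = Unique.++⁺ (avail-Unique used) u (λ (p , q) → avail-∉ {used} p q)
        cover : ∀ {x} → x ∈ allFin n → x ∈ avail used ++ used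
        cover {x} x∈ with x ∈? used
        ... | yes p = ∈-++⁺ʳ (avail used) p
        ... | no p = ∈-++⁺ˡ (∈-filter⁺ (λ x → ¬? (x ∈? used)) x∈ p)

    ∑-inj : ∀ used l (f : Vec (Fin n) (suc l) → ℕ) →
      ∑ (inj used (suc l)) f ≡ ∑ (avail used) (λ x → ∑ (inj (x ∷ used) l) (f ∘ (x ∷_)))
    ∑-inj used l f = trans (∑-concatMap (λ x → map (x ∷_) (inj (x ∷ used) l)) (avail used) f)
      (∑-cong (avail used) (λ x → ∑-map (x ∷_) (inj (x ∷ used) l) f))

    ∑-inj-1 : ∀ N used → Unique used → N + length used ≡ n → ∑ (inj used N) (λ _ → 1) ≡ N !
    ∑-inj-1 zero used u e = refl
    ∑-inj-1 (suc N) used u e = trans (∑-inj used N (λ _ → 1)) (trans (≤-antisym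
        (∑-mono-∈ (avail used) (λ x∈ → ≤-reflexive (step x∈)))
        (∑-mono-∈ (avail used) (λ x∈ → ≤-reflexive (sym (step x∈)))))
        (trans (∑-const (avail used) (N !)) (cong (_* N !) (length-avail (suc N) used u e))))
      where
        step : ∀ {x} → x ∈ avail used → ∑ (inj (x ∷ used) N) (λ _ → 1) ≡ N !
        step {x} x∈ = ∑-inj-1 N (x ∷ used) (∉⇒Unique-∷ (avail-∉ {used} x∈) u) (trans (+-suc N (length used)) e)

    inj-sound : ∀ {l used} {v : Vec (Fin n) l} → v ∈ inj used l → Injectiveᵥ v × (∀ i → lookup v i ∉ used)
    inj-sound {zero} v∈ = (λ ()) , λ ()
    inj-sound {suc l} {used} v∈ with find (∈-concatMap⁻ (λ x → map (x ∷_) (inj (x ∷ used) l)) {xs = avail used} v∈)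
    ... | x , x∈ , v∈x with ∈-map⁻ (x ∷_) v∈x
    ... | w , w∈ , refl with inj-sound w∈
    ... | wi , w∉ = vi , v∉
      where
        vi : Injectiveᵥ (x ∷ w)
        vi zero zero e = refl
        vi zero (suc j) e = ⊥-elim (w∉ j (here (sym e)))
        vi (suc i) zero e = ⊥-elim (w∉ i (here e))
        vi (suc i) (suc j) e = cong suc (wi i j e)
        v∉ : ∀ i → lookup (x ∷ w) i ∉ used
        v∉ zero = avail-∉ {used} x∈
        v∉ (suc i) h = w∉ i (there h)

    inj-complete : ∀ {l used} (v : Vec (Fin n) l) → Injectiveᵥ v → (∀ i → lookup v i ∉ used) → v ∈ inj used l
    inj-complete [] _ _ = here refl
    inj-complete {suc l} {used} (x ∷ w) vi v∉ = ∈-concatMap⁺ (λ x → map (x ∷_) (inj (x ∷ used) l))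
      (lose (∈-filter⁺ (λ x → ¬? (x ∈? used)) (∈-allFin x) (v∉ zero)) (∈-map⁺ (x ∷_) (inj-complete w wi w∉)))
      where
        wi : Injectiveᵥ w
        wi i j e = Fin.suc-injective (vi (suc i) (suc j) e)
        w∉ : ∀ i → lookup w i ∉ x ∷ used
        w∉ i (here e) with vi (suc i) zero e
        ... | ()
        w∉ i (there h) = v∉ (suc i) h

    inj-Unique : ∀ l used → Unique (inj used l)
    inj-Unique zero used = [] ∷ []
    inj-Unique (suc l) used = Unique-concatMap (avail-Unique used) (λ x → Unique.map⁺ ∷-injectiveʳ (inj-Unique l (x ∷ used))) same-head
      where
        same-head : ∀ {x y v} → v ∈ map (x ∷_) (inj (x ∷ used) l) → v ∈ map (y ∷_) (inj (y ∷ used) l) → x ≡ y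
        same-head {x} {y} p q with ∈-map⁻ (x ∷_) p | ∈-map⁻ (y ∷_) q
        ... | _ , _ , refl | _ , _ , e = ∷-injectiveˡ e

  -- s (r + 1) ⋯ s (r + l)
  ∏ : (ℕ → ℕ) → ℕ → ℕ → ℕ
  ∏ s r zero = 1
  ∏ s r (suc l) = s (suc l + r) * ∏ s r l

  ∏-id : ∀ r l → ∏ id r l * r ! ≡ (l + r) !
  ∏-id r zero = +-identityʳ _
  ∏-id r (suc l) = trans (*-assoc (suc l + r) (∏ id r l) (r !)) (cong (suc (l + r) *_) (∏-id r l))

  -- Exposing positions one vertex at a time

  module Exposure {n : ℕ} (_~_ : Fin n → Fin n → Set) (_~?_ : ∀ x y → Dec (x ~ y))
    (~-sym : ∀ {x y} → x ~ y → y ~ x) (nb : Fin n → List (Fin n)) (~⇒∈nb : ∀ {x y} → x ~ y → y ∈ nb x)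
    (length-nb : ∀ x → length (nb x) ≤ 4) (B : ℕ) (1≤B : 1 ≤ B) where

    private instance
      B≢0 : NonZero B
      B≢0 = >-nonZero 1≤B

    adj : Maybe (Fin n) → Fin n → ℕ
    adj nothing y = 0
    adj (just x) y = ⟦ x ~? y ⟧

    -- The entries are positions and `p₂`, `p₁` are the two exposed just before. The exponent counts
    -- adjacent pairs at most two steps apart in the order of exposure, the only pairs that edges of
    -- F produce in the order along the cycle.
    Γ : Maybe (Fin n) → Maybe (Fin n) → List (Fin n) → ℕ
    Γ p₂ p₁ [] = 1
    Γ p₂ p₁ (y ∷ ys) = B ^ (adj p₂ y + adj p₁ y) * Γ p₁ (just y) ys

    -- A supermartingale condition: with `N` positions free, exposing one more multiplies the
    -- expected weighted potential `h` by at most `s N / N`. It is demanded only while `N ≥ L`.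
    Step : (Maybe (Fin n) → Maybe (Fin n) → ℕ) → (ℕ → ℕ) → ℕ → Set
    Step h s L = ∀ N used p₂ p₁ → Unique used → N + length used ≡ n → L ≤ N →
      ∑ (avail used) (λ x → B ^ (adj p₂ x + adj p₁ x) * h p₁ (just x)) ≤ h p₂ p₁ * s N

    -- Induction on the number `l` of positions to expose. Afterwards the weight is 1, which `h ≥ 1`
    -- absorbs, and the other `r` vertices are placed in `r !` ways. At least `r ≥ L` positions are
    -- free throughout.
    transfer : ∀ {h s L} → Step h s L → (∀ p₂ p₁ → 1 ≤ h p₂ p₁) →
      ∀ l r N used p₂ p₁ → N ≡ l + r → L ≤ r → Unique used → N + length used ≡ n →
      ∑ (inj used N) (λ v → Γ p₂ p₁ (take l (toList v))) ≤ h p₂ p₁ * (∏ s r l * r !)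
    transfer {h} step h≥1 zero r N used p₂ p₁ refl L≤r u e = begin
        ∑ (inj used N) (λ v → 1) ≡⟨ ∑-inj-1 N used u e ⟩
        N ! ≡⟨ sym (trans (+-identityʳ _) (+-identityʳ _)) ⟩
        1 * (1 * N !) ≤⟨ *-monoˡ-≤ (1 * N !) (h≥1 p₂ p₁) ⟩
        h p₂ p₁ * (1 * N !) ∎
      where open ≤-Reasoning
    transfer {h} {s} {L} step h≥1 (suc l) r (suc N) used p₂ p₁ refl L≤r u e = begin
        ∑ (inj used (suc N)) (λ v → Γ p₂ p₁ (take (suc l) (toList v)))
          ≡⟨ ∑-inj used N (λ v → Γ p₂ p₁ (take (suc l) (toList v))) ⟩
        ∑ (avail used) (λ x → ∑ (inj (x ∷ used) N) (λ v → w x * Γ p₁ (just x) (take l (toList v))))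
          ≡⟨ ∑-cong (avail used) (λ x → ∑-*ˡ (inj (x ∷ used) N) (w x) (λ v → Γ p₁ (just x) (take l (toList v)))) ⟩
        ∑ (avail used) (λ x → w x * ∑ (inj (x ∷ used) N) (λ v → Γ p₁ (just x) (take l (toList v))))
          ≤⟨ ∑-mono-∈ (avail used) (λ {x} x∈ → *-monoʳ-≤ (w x) (transfer step h≥1 l r N (x ∷ used) p₁ (just x) refl L≤r
               (∉⇒Unique-∷ (avail-∉ {used = used} x∈) u) (trans (+-suc N (length used)) e))) ⟩
        ∑ (avail used) (λ x → w x * (h p₁ (just x) * R)) ≡⟨ ∑-cong (avail used) (λ x → trans (sym (*-assoc (w x) (h p₁ (just x)) R)) (*-comm (w x * h p₁ (just x)) R)) ⟩
        ∑ (avail used) (λ x → R * (w x * h p₁ (just x))) ≡⟨ ∑-*ˡ (avail used) R (λ x → w x * h p₁ (just x)) ⟩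
        R * ∑ (avail used) (λ x → w x * h p₁ (just x))
          ≤⟨ *-monoʳ-≤ R (step (suc N) used p₂ p₁ u e (≤-trans L≤r (≤-trans (m≤n+m r l) (n≤1+n _)))) ⟩
        R * (h p₂ p₁ * s (suc N)) ≡⟨ rearrange (∏ s r l) (r !) (h p₂ p₁) (s (suc N)) ⟩
        h p₂ p₁ * (s (suc N) * ∏ s r l * r !) ∎
      where
        open ≤-Reasoning
        w : Fin n → ℕ
        w x = B ^ (adj p₂ x + adj p₁ x)
        R = ∏ s r l * r !
        rearrange : ∀ p f h s → p * f * (h * s) ≡ h * (s * p * f)
        rearrange = solve-∀

    nbM : Maybe (Fin n) → List (Fin n)
    nbM nothing = []
    nbM (just x) = nb x

    length-nbM : ∀ p → length (nbM p) ≤ 4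
    length-nbM nothing = z≤n
    length-nbM (just x) = length-nb x

    adj≤1 : ∀ p y → adj p y ≤ 1
    adj≤1 nothing y = z≤n
    adj≤1 (just x) y = ⟦⟧≤1 (x ~? y)

    adj-∉ : ∀ p {y} → y ∉ nbM p → adj p y ≡ 0
    adj-∉ nothing _ = refl
    adj-∉ (just x) {y} y∉ = ⟦⟧-false (x ~? y) (λ x~y → y∉ (~⇒∈nb x~y))

    exceptional : ∀ {f : Fin n → ℕ} {D N used} ys → Unique used → N + length used ≡ n →
      (∀ x → x ∉ ys → f x ≤ 1) → (∀ x → f x ≤ D) → ∑ (avail used) f ≤ N + length ys * D
    exceptional {f} {D} {N} {used} ys u e f≤1 f≤D = begin
        ∑ (avail used) f ≤⟨ ∑-mono (avail used) pt ⟩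
        ∑ (avail used) (λ x → 1 + D * ⟦ x ∈? ys ⟧) ≡⟨ trans (∑-+ (avail used) (λ _ → 1) (λ x → D * ⟦ x ∈? ys ⟧))
           (cong₂ _+_ (trans (sym (length-∑ (avail used))) (length-avail N used u e)) (∑-*ˡ (avail used) D (λ x → ⟦ x ∈? ys ⟧))) ⟩
        N + D * ∑ (avail used) (λ x → ⟦ x ∈? ys ⟧) ≤⟨ +-monoʳ-≤ N (*-monoʳ-≤ D (∑-Unique-⟦⟧ (_∈? ys) ys (avail-Unique used) id)) ⟩
        N + D * length ys ≡⟨ cong (N +_) (*-comm D (length ys)) ⟩
        N + length ys * D ∎
      where
        open ≤-Reasoning
        pt : ∀ x → f x ≤ 1 + D * ⟦ x ∈? ys ⟧
        pt x = by (x ∈? ys)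
          where
            by : (d : Dec (x ∈ ys)) → f x ≤ 1 + D * ⟦ d ⟧
            by (yes _) = ≤-trans (f≤D x) (≤-trans (≤-reflexive (sym (*-identityʳ D))) (n≤1+n _))
            by (no ∉) = ≤-trans (f≤1 x ∉) (m≤m+n 1 _)

    -- Only the at most eight neighbours of the last two positions gain anything, each at most B²,
    -- so the gains add at most another `n`. No supply of free positions is required, which allows
    -- all `n` vertices to be exposed.
    step-crude : 8 * (B * B) ≤ n → Step (λ _ _ → 1) (λ _ → 2 * n) 0
    step-crude 8B²≤n N used p₂ p₁ u e _ = begin
        ∑ (avail used) (λ x → B ^ (adj p₂ x + adj p₁ x) * 1) ≤⟨ exceptional ys u e out all ⟩
        N + length ys * (B * B) ≤⟨ +-mono-≤ (m+n≤o⇒m≤o N (≤-reflexive e)) (≤-trans (*-monoˡ-≤ (B * B) len) 8B²≤n) ⟩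
        n + n ≡⟨ double n ⟩
        1 * (2 * n) ∎
      where
        open ≤-Reasoning
        double : ∀ n → n + n ≡ 1 * (2 * n)
        double = solve-∀
        ys = nbM p₂ ++ nbM p₁
        len : length ys ≤ 8
        len = ≤-trans (≤-reflexive (length-++ (nbM p₂))) (+-mono-≤ (length-nbM p₂) (length-nbM p₁))
        out : ∀ x → x ∉ ys → B ^ (adj p₂ x + adj p₁ x) * 1 ≤ 1
        out x x∉ rewrite adj-∉ p₂ (x∉ ∘ ∈-++⁺ˡ) | adj-∉ p₁ (x∉ ∘ ∈-++⁺ʳ (nbM p₂)) = ≤-refl
        all : ∀ x → B ^ (adj p₂ x + adj p₁ x) * 1 ≤ B * B
        all x = ≤-trans (≤-reflexive (*-identityʳ _)) (≤-trans (^-monoʳ-≤ B (+-mono-≤ (adj≤1 p₂ x) (adj≤1 p₁ x))) (≤-reflexive (cong (B *_) (*-identityʳ B))))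

    nb² : Fin n → List (Fin n)
    nb² x = concatMap nb (nb x)

    nb²M : Maybe (Fin n) → List (Fin n)
    nb²M nothing = []
    nb²M (just x) = nb² x

    length-nb²M : ∀ p → length (nb²M p) ≤ 16
    length-nb²M nothing = z≤n
    length-nb²M (just x) = ≤-trans (go (nb x)) (*-monoˡ-≤ 4 (length-nb x))
      where
        go : ∀ ys → length (concatMap nb ys) ≤ length ys * 4
        go [] = z≤n
        go (y ∷ ys) = ≤-trans (≤-reflexive (length-++ (nb y))) (+-mono-≤ (length-nb y) (go ys))

    close : Maybe (Fin n) → Maybe (Fin n) → ℕ
    close p nothing = 0
    close p (just y) = ⟦ y ∈? nb²M p ⟧

    close≤1 : ∀ p q → close p q ≤ 1
    close≤1 p nothing = z≤n
    close≤1 p (just y) = ⟦⟧≤1 (y ∈? nb²M p)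

    -- A position adjacent to both of the last two is a common neighbour, which would make the one a
    -- second neighbour of the other.
    far-adj : ∀ p₂ p₁ x → close p₂ p₁ ≡ 0 → adj p₂ x + adj p₁ x ≤ 1
    far-adj nothing p₁ x _ = adj≤1 p₁ x
    far-adj (just z) nothing x _ = ≤-trans (≤-reflexive (+-identityʳ _)) (adj≤1 (just z) x)
    far-adj (just z) (just y) x far = by (z ~? x) (y ~? x)
      where
        by : (d : Dec (z ~ x)) (d′ : Dec (y ~ x)) → ⟦ d ⟧ + ⟦ d′ ⟧ ≤ 1
        by (no _) d′ = ⟦⟧≤1 d′
        by (yes _) (no _) = ≤-refl
        by (yes p) (yes q) with trans (sym (⟦⟧-true (y ∈? nb² z) (∈-concatMap⁺ nb (lose (~⇒∈nb p) (~⇒∈nb (~-sym q)))))) far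
        ... | ()

    -- The potential doubles when the last two exposed positions have a common neighbour:
    -- only then can the next vertex gain B², which a remaining supply of N ≥ 48 B² positions absorbs.
    potential : Maybe (Fin n) → Maybe (Fin n) → ℕ
    potential p₂ p₁ = 1 + close p₂ p₁

    -- The exceptional positions are the 4 + 4 neighbours of the last two, together with the 16
    -- second neighbours of the last one, where the potential becomes 2: 24 in all. If the last two
    -- are far apart each gains at most 2 B, giving 48 B. If they are close, the total N + 48 B² is
    -- at most 2 N, and the factor 2 is already present in the potential.
    step-potential : Step potential (λ N → N + 48 * B) (48 * (B * B))
    step-potential N used p₂ p₁ u e big = by (close p₂ p₁) refl
      where
        open ≤-Reasoning
        ys = nbM p₂ ++ nbM p₁ ++ nb²M p₁
        len : length ys ≤ 24
        len = ≤-trans (≤-reflexive (trans (length-++ (nbM p₂)) (cong (length (nbM p₂) +_) (length-++ (nbM p₁)))))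
          (+-mono-≤ (length-nbM p₂) (+-mono-≤ (length-nbM p₁) (length-nb²M p₁)))
        f : Fin n → ℕ
        f x = B ^ (adj p₂ x + adj p₁ x) * potential p₁ (just x)
        out : ∀ x → x ∉ ys → f x ≤ 1
        out x x∉ rewrite adj-∉ p₂ (x∉ ∘ ∈-++⁺ˡ) | adj-∉ p₁ (x∉ ∘ ∈-++⁺ʳ (nbM p₂) ∘ ∈-++⁺ˡ)
          | ⟦⟧-false (x ∈? nb²M p₁) (x∉ ∘ ∈-++⁺ʳ (nbM p₂) ∘ ∈-++⁺ʳ (nbM p₁)) = ≤-refl
        gain : ∀ j → (∀ x → adj p₂ x + adj p₁ x ≤ j) → ∀ x → f x ≤ B ^ j * 2
        gain j h x = *-mono-≤ (^-monoʳ-≤ B (h x)) (s≤s (close≤1 p₁ (just x)))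
        total : ∀ j → (∀ x → adj p₂ x + adj p₁ x ≤ j) → ∑ (avail used) f ≤ N + 24 * (B ^ j * 2)
        total j h = ≤-trans (exceptional ys u e out (gain j h)) (+-monoʳ-≤ N (*-monoˡ-≤ (B ^ j * 2) len))
        e₁ : ∀ N B → N + 24 * (B * 1 * 2) ≡ 1 * (N + 48 * B)
        e₁ = solve-∀
        e₂ : ∀ B → 24 * (B * (B * 1) * 2) ≡ 48 * (B * B)
        e₂ = solve-∀
        e₃ : ∀ N B → N + N + 96 * B ≡ 2 * (N + 48 * B)
        e₃ = solve-∀
        by : ∀ c → close p₂ p₁ ≡ c → ∑ (avail used) f ≤ potential p₂ p₁ * (N + 48 * B)
        by zero eq rewrite eq = ≤-trans (total 1 (λ x → far-adj p₂ p₁ x eq)) (≤-reflexive (e₁ N B))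
        by (suc c) eq = begin
          ∑ (avail used) f ≤⟨ total 2 (λ x → +-mono-≤ (adj≤1 p₂ x) (adj≤1 p₁ x)) ⟩
          N + 24 * (B * (B * 1) * 2) ≡⟨ cong (N +_) (e₂ B) ⟩
          N + 48 * (B * B) ≤⟨ +-monoʳ-≤ N big ⟩
          N + N ≤⟨ m≤m+n (N + N) (96 * B) ⟩
          N + N + 96 * B ≡⟨ e₃ N B ⟩
          2 * (N + 48 * B) ≤⟨ *-monoˡ-≤ (N + 48 * B) (s≤s (≤-trans (s≤s z≤n) (≤-reflexive (sym eq)))) ⟩
          potential p₂ p₁ * (N + 48 * B) ∎

    ∑Γ-crude : 8 * (B * B) ≤ n → ∑ (inj [] n) (λ v → Γ nothing nothing (take n (toList v))) ≤ (2 * n) ^ n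
    ∑Γ-crude 8B²≤n = ≤-trans (transfer (step-crude 8B²≤n) (λ _ _ → ≤-refl) n 0 n [] nothing nothing (sym (+-identityʳ n)) z≤n [] (+-identityʳ n))
        (≤-reflexive (trans (+-identityʳ _) (trans (*-identityʳ _) (∏-const n))))
      where
        ∏-const : ∀ l → ∏ (λ _ → 2 * n) 0 l ≡ (2 * n) ^ l
        ∏-const zero = refl
        ∏-const (suc l) = cong (2 * n *_) (∏-const l)

    -- Each exposure costs (N + 48 B) / N, which is at most 1 + 1/B because at least 48 B² positions
    -- stay free; the powers of `B` clear the denominators.
    ∑Γ-potential : ∀ l → 48 * (B * B) + l ≤ n →
      B ^ l * ∑ (inj [] n) (λ v → Γ nothing nothing (take l (toList v))) ≤ suc B ^ l * n !
    ∑Γ-potential l le = begin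
        B ^ l * ∑ (inj [] n) (λ v → Γ nothing nothing (take l (toList v)))
          ≤⟨ *-monoʳ-≤ (B ^ l) (transfer {h = potential} step-potential (λ _ _ → s≤s z≤n) l r n [] nothing nothing n≡ 48B²≤r [] (+-identityʳ n)) ⟩
        B ^ l * (1 * (∏ (λ N → N + 48 * B) r l * r !)) ≡⟨ rearrange (B ^ l) (∏ (λ N → N + 48 * B) r l) (r !) ⟩
        B ^ l * ∏ (λ N → N + 48 * B) r l * r ! ≤⟨ *-monoˡ-≤ (r !) (ratio l) ⟩
        suc B ^ l * ∏ id r l * r ! ≡⟨ *-assoc (suc B ^ l) (∏ id r l) (r !) ⟩
        suc B ^ l * (∏ id r l * r !) ≡⟨ cong (suc B ^ l *_) (trans (∏-id r l) (cong _! (sym n≡))) ⟩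
        suc B ^ l * n ! ∎
      where
        open ≤-Reasoning
        r = n ∸ l
        n≡ : n ≡ l + r
        n≡ = sym (m+[n∸m]≡n (≤-trans (m≤n+m l _) le))
        48B²≤r : 48 * (B * B) ≤ r
        48B²≤r = m+n≤o⇒m≤o∸n (48 * (B * B)) le
        rearrange : ∀ a b c → a * (1 * (b * c)) ≡ a * b * c
        rearrange = solve-∀
        factor : ∀ B N → B * (N + 48 * B) ≡ B * N + 48 * (B * B)
        factor = solve-∀
        ratio : ∀ l → B ^ l * ∏ (λ N → N + 48 * B) r l ≤ suc B ^ l * ∏ id r l
        ratio zero = ≤-refl
        ratio (suc l) = begin
          B * B ^ l * ((suc l + r + 48 * B) * ∏ (λ N → N + 48 * B) r l) ≡⟨ [m*n]*[o*p]≡[m*o]*[n*p] B (B ^ l) (suc l + r + 48 * B) (∏ (λ N → N + 48 * B) r l) ⟩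
          B * (suc l + r + 48 * B) * (B ^ l * ∏ (λ N → N + 48 * B) r l) ≤⟨ *-mono-≤ one (ratio l) ⟩
          suc B * (suc l + r) * (suc B ^ l * ∏ id r l) ≡⟨ sym ([m*n]*[o*p]≡[m*o]*[n*p] (suc B) (suc B ^ l) (suc l + r) (∏ id r l)) ⟩
          suc B * suc B ^ l * ((suc l + r) * ∏ id r l) ∎
          where
            one : B * (suc l + r + 48 * B) ≤ suc B * (suc l + r)
            one = ≤-trans (≤-reflexive (factor B (suc l + r))) (≤-trans (+-monoʳ-≤ (B * (suc l + r)) (≤-trans 48B²≤r (m≤n+m r (suc l)))) (≤-reflexive (+-comm (B * (suc l + r)) (suc l + r))))

  -- Edge sets as lists, and nearness along a sequence

  select : ∀ {A : Set} (ps : List A) → Subset (length ps) → List A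
  select [] [] = []
  select (p ∷ ps) (true ∷ G) = p ∷ select ps G
  select (p ∷ ps) (false ∷ G) = select ps G

  length-select : ∀ {A : Set} (ps : List A) G → length (select ps G) ≡ ∣ G ∣
  length-select [] [] = refl
  length-select (p ∷ ps) (true ∷ G) = cong suc (length-select ps G)
  length-select (p ∷ ps) (false ∷ G) = length-select ps G

  ∈-select⁻ : ∀ {A : Set} (ps : List A) G {q} → q ∈ select ps G → ∃ λ k → List.lookup ps k ≡ q × k ∈ₛ G
  ∈-select⁻ [] [] ()
  ∈-select⁻ (p ∷ ps) (true ∷ G) (here refl) = zero , refl , Vec.here
  ∈-select⁻ (p ∷ ps) (true ∷ G) (there q∈) with ∈-select⁻ ps G q∈
  ... | k , e , k∈ = suc k , e , Vec.there k∈
  ∈-select⁻ (p ∷ ps) (false ∷ G) q∈ with ∈-select⁻ ps G q∈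
  ... | k , e , k∈ = suc k , e , Vec.there k∈

  ∈-select⁺ : ∀ {A : Set} (ps : List A) G {k} → k ∈ₛ G → List.lookup ps k ∈ select ps G
  ∈-select⁺ (p ∷ ps) (true ∷ G) {zero} Vec.here = here refl
  ∈-select⁺ (p ∷ ps) (true ∷ G) {suc k} (Vec.there h) = there (∈-select⁺ ps G h)
  ∈-select⁺ (p ∷ ps) (false ∷ G) {suc k} (Vec.there h) = ∈-select⁺ ps G h

  select-Unique : ∀ {A : Set} (ps : List A) G → Unique ps → Unique (select ps G)
  select-Unique [] [] [] = []
  select-Unique (p ∷ ps) (false ∷ G) (_ ∷ u) = select-Unique ps G u
  select-Unique (p ∷ ps) (true ∷ G) (p∉ ∷ u) = ∉⇒Unique-∷
    (λ p∈ → let k , e , _ = ∈-select⁻ ps G p∈ in All.lookup p∉ (subst (_∈ ps) e (∈-lookup {xs = ps} k)) refl) (select-Unique ps G u)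

  data Near {A : Set} : List A → A → A → Set where
    next : ∀ {a b xs} → Near (a ∷ b ∷ xs) a b
    skip : ∀ {a b c xs} → Near (a ∷ c ∷ b ∷ xs) a b
    later : ∀ {a b x xs} → Near xs a b → Near (x ∷ xs) a b

  module _ {A : Set} where

    -- Deleting other entries only brings two entries closer: a `skip` may turn into a `next`. Hence
    -- only the vertices met by F have to be exposed.
    Near-filter : ∀ {P : A → Set} (P? : Decidable P) {xs a b} → Near xs a b → P a → P b → Near (filter P? xs) a b
    Near-filter P? {a ∷ b ∷ _} next pa pb with P? a
    ... | no ¬p = ⊥-elim (¬p pa)
    ... | yes _ with P? b
    ... | no ¬p = ⊥-elim (¬p pb)
    ... | yes _ = next
    Near-filter P? {a ∷ c ∷ b ∷ _} skip pa pb with P? a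
    ... | no ¬p = ⊥-elim (¬p pa)
    ... | yes _ with P? c
    ... | yes _ with P? b
    ...   | no ¬p = ⊥-elim (¬p pb)
    ...   | yes _ = skip
    Near-filter P? {a ∷ c ∷ b ∷ _} skip pa pb | yes _ | no _ with P? b
    ...   | no ¬p = ⊥-elim (¬p pb)
    ...   | yes _ = next
    Near-filter P? {x ∷ xs} (later h) pa pb with P? x
    ... | yes _ = later (Near-filter P? h pa pb)
    ... | no _ = Near-filter P? h pa pb

    Near-tabulate₁ : ∀ {m} (f : Fin m → A) i j → toℕ j ≡ suc (toℕ i) → Near (List.tabulate f) (f i) (f j)
    Near-tabulate₁ f zero (suc zero) e = next
    Near-tabulate₁ f (suc i) (suc j) e = later (Near-tabulate₁ (f ∘ suc) i j (suc-injective e))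

    Near-tabulate₂ : ∀ {m} (f : Fin m → A) i j → toℕ j ≡ suc (suc (toℕ i)) → Near (List.tabulate f) (f i) (f j)
    Near-tabulate₂ f zero (suc (suc zero)) e = skip
    Near-tabulate₂ f (suc i) (suc j) e = later (Near-tabulate₂ (f ∘ suc) i j (suc-injective e))

    withPrev : Maybe A → A → List (A × A)
    withPrev nothing y = []
    withPrev (just x) y = (x , y) ∷ []

    -- p₂ and p₁ are the two entries preceding the list.
    nearPairs : Maybe A → Maybe A → List A → List (A × A)
    nearPairs p₂ p₁ [] = []
    nearPairs p₂ p₁ (y ∷ ys) = withPrev p₂ y ++ withPrev p₁ y ++ nearPairs p₁ (just y) ys

    Near⇒∈ : ∀ {xs a b} → Near xs a b → ∀ p₂ p₁ → (a , b) ∈ nearPairs p₂ p₁ xs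
    Near⇒∈ {a ∷ b ∷ _} next p₂ p₁ = ∈-++⁺ʳ (withPrev p₂ a) (∈-++⁺ʳ (withPrev p₁ a) (∈-++⁺ʳ (withPrev p₁ b) (here refl)))
    Near⇒∈ {a ∷ c ∷ b ∷ _} skip p₂ p₁ = ∈-++⁺ʳ (withPrev p₂ a) (∈-++⁺ʳ (withPrev p₁ a) (∈-++⁺ʳ (withPrev p₁ c) (there (here refl))))
    Near⇒∈ {x ∷ _} (later h) p₂ p₁ = ∈-++⁺ʳ (withPrev p₂ x) (∈-++⁺ʳ (withPrev p₁ x) (Near⇒∈ h p₁ (just x)))

  -- Bijectivity and relabelling of permutations

  injective⇒surjective : ∀ {n} (f : Fin n → Fin n) → (∀ {i j} → f i ≡ f j → i ≡ j) → ∀ y → ∃ λ i → f i ≡ y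
  injective⇒surjective {n} f f-inj y with y ∈? List.tabulate f
  ... | yes y∈ = let i , e = ∈-tabulate⁻ y∈ in i , sym e
  ... | no y∉ = ⊥-elim (<⇒≱ (n<1+n n) (≤-trans (≤-reflexive (cong suc (sym (length-tabulate f))))
    (≤-trans (length-Unique-⊆ {ys = allFin n} (∉⇒Unique-∷ y∉ (Unique.tabulate⁺ f-inj)) (λ {x} _ → ∈-allFin x)) (≤-reflexive (length-tabulate id)))))

  lookup-ext : ∀ {A : Set} {n} (v w : Vec A n) → (∀ i → lookup v i ≡ lookup w i) → v ≡ w
  lookup-ext v w h = trans (sym (tabulate∘lookup v)) (trans (tabulate-cong h) (tabulate∘lookup w))

  Unique⇒Injectiveᵥ : ∀ {n l} (v : Vec (Fin n) l) → Unique (toList v) → Injectiveᵥ v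
  Unique⇒Injectiveᵥ (x ∷ v) (x∉ ∷ u) = go
    where
      ∈-toList : ∀ {n l} (v : Vec (Fin n) l) i → lookup v i ∈ toList v
      ∈-toList (x ∷ v) zero = here refl
      ∈-toList (x ∷ v) (suc i) = there (∈-toList v i)
      go : Injectiveᵥ (x ∷ v)
      go zero zero e = refl
      go zero (suc j) e = ⊥-elim (All.lookup x∉ (∈-toList v j) e)
      go (suc i) zero e = ⊥-elim (All.lookup x∉ (∈-toList v i) (sym e))
      go (suc i) (suc j) e = cong suc (Unique⇒Injectiveᵥ v u i j e)

  -- Composition with the fixed injective `u` maps the permutations injectively to permutations, so
  -- a uniform permutation stays uniform when the vertices are listed in any chosen order.
  reorder : ∀ {n} (u : Vec (Fin n) n) → Injectiveᵥ u → (f : Vec (Fin n) n → ℕ) →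
    ∑ (inj [] n) (λ π → f (Vec.map (lookup π) u)) ≤ ∑ (inj [] n) f
  reorder {n} u u-inj f = ≤-trans (≤-reflexive (sym (∑-map φ (inj [] n) f)))
      (∑-Unique-⊆ f (Unique.map⁺ φ-inj (inj-Unique n [])) φ∈)
    where
      φ : Vec (Fin n) n → Vec (Fin n) n
      φ π = Vec.map (lookup π) u
      φ-inj : ∀ {π π′} → φ π ≡ φ π′ → π ≡ π′
      φ-inj {π} {π′} e = lookup-ext π π′ (λ a → let i , ui≡a = injective⇒surjective (lookup u) (λ {i} {j} → u-inj i j) a in
        subst (λ a → lookup π a ≡ lookup π′ a) ui≡a
          (trans (sym (lookup-map i (lookup π) u)) (trans (cong (λ v → lookup v i) e) (lookup-map i (lookup π′) u))))
      φ∈ : ∀ {y} → y ∈ map φ (inj [] n) → y ∈ inj [] n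
      φ∈ y∈ with ∈-map⁻ φ y∈
      ... | π , π∈ , refl = inj-complete (φ π) (λ i j e → u-inj i j (proj₁ (inj-sound π∈) (lookup u i) (lookup u j)
              (trans (sym (lookup-map i (lookup π) u)) (trans e (lookup-map j (lookup π) u))))) (λ _ ())

  listToVec : ∀ {A : Set} (xs : List A) {j} → length xs ≡ j → Σ (Vec A j) λ v → toList v ≡ xs
  listToVec xs refl = Vec.fromList xs , toList∘fromList xs

  -- Edges of the complete graph and cyclic shifts

  pairRow : ∀ {n} → Fin n → Fin n → List (Fin n × Fin n)
  pairRow i j = if toℕ i <ᵇ toℕ j then (i , j) ∷ [] else []

  ∈-pairRow : ∀ {n} (i j : Fin n) {q} → q ∈ pairRow i j → q ≡ (i , j) × toℕ i < toℕ j
  ∈-pairRow i j q∈ with toℕ i <ᵇ toℕ j in eq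
  ∈-pairRow i j (here refl) | true = refl , <ᵇ⇒< _ _ (subst Bool.T (sym eq) _)

  ∈-pairRow⁺ : ∀ {n} (i j : Fin n) → toℕ i < toℕ j → (i , j) ∈ pairRow i j
  ∈-pairRow⁺ i j lt with toℕ i <ᵇ toℕ j in eq
  ... | true = here refl
  ... | false = ⊥-elim (subst Bool.T eq (<⇒<ᵇ lt))

  ∈-pairs⁻ : ∀ {n} {u v : Fin n} → (u , v) ∈ pairs n → toℕ u < toℕ v
  ∈-pairs⁻ {n} q∈ with find (∈-concatMap⁻ (λ i → concatMap (pairRow i) (allFin n)) {xs = allFin n} q∈)
  ... | i , _ , q∈i with find (∈-concatMap⁻ (pairRow i) {xs = allFin n} q∈i)
  ... | j , _ , q∈ij with ∈-pairRow i j q∈ij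
  ... | refl , lt = lt

  ∈-pairs⁺ : ∀ {n} {u v : Fin n} → toℕ u < toℕ v → (u , v) ∈ pairs n
  ∈-pairs⁺ {n} {u} {v} lt = ∈-concatMap⁺ (λ i → concatMap (pairRow i) (allFin n)) (lose (∈-allFin u)
    (∈-concatMap⁺ (pairRow u) (lose (∈-allFin v) (∈-pairRow⁺ u v lt))))

  pairs-Unique : ∀ n → Unique (pairs n)
  pairs-Unique n = Unique-concatMap (Unique.allFin⁺ n) (λ i → Unique-concatMap (Unique.allFin⁺ n) (row i)
      (λ {j} {j′} p q → cong proj₂ (trans (sym (proj₁ (∈-pairRow i j p))) (proj₁ (∈-pairRow i j′ q)))))
      (λ {i} {i′} p q → trans (sym (fst i p)) (fst i′ q))
    where
      row : ∀ i j → Unique (pairRow {n} i j)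
      row i j with toℕ i <ᵇ toℕ j
      ... | true = [] ∷ []
      ... | false = []
      fst : ∀ i {q} → q ∈ concatMap (pairRow {n} i) (allFin n) → proj₁ q ≡ i
      fst i q∈ with find (∈-concatMap⁻ (pairRow i) {xs = allFin n} q∈)
      ... | j , _ , q∈ij = cong proj₁ (proj₁ (∈-pairRow i j q∈ij))

  sort₂ : ∀ {n} → Fin n × Fin n → Fin n × Fin n
  sort₂ (u , v) = if does (toℕ u <? toℕ v) then (u , v) else (v , u)

  sort₂-< : ∀ {n} {u v : Fin n} → toℕ u < toℕ v → sort₂ (u , v) ≡ (u , v)
  sort₂-< {u = u} {v} lt with toℕ u <ᵇ toℕ v in eq
  ... | true = refl
  ... | false = ⊥-elim (subst Bool.T eq (<⇒<ᵇ lt))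

  sort₂-> : ∀ {n} {u v : Fin n} → toℕ u < toℕ v → sort₂ (v , u) ≡ (u , v)
  sort₂-> {u = u} {v} lt with toℕ v <ᵇ toℕ u in eq
  ... | false = refl
  ... | true = ⊥-elim (<-asym lt (<ᵇ⇒< _ _ (subst Bool.T (sym eq) _)))

  sort₂-cases : ∀ {n} (r : Fin n × Fin n) → sort₂ r ≡ r ⊎ sort₂ r ≡ (proj₂ r , proj₁ r)
  sort₂-cases (u , v) with toℕ u <ᵇ toℕ v
  ... | true = inj₁ refl
  ... | false = inj₂ refl

  module _ {n : ℕ} .{{_ : NonZero n}} where

    toℕ-shift : ∀ k (i : Fin n) → toℕ (shift k i) ≡ (toℕ i + k) % n
    toℕ-shift = go
      where
        go : ∀ {n} .{{_ : NonZero n}} k (i : Fin n) → toℕ (shift k i) ≡ (toℕ i + k) % n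
        go {suc n} k i = toℕ-fromℕ< _

    shift-shift : ∀ a b (i : Fin n) → shift a (shift b i) ≡ shift (b + a) i
    shift-shift a b i = toℕ-injective (begin
        toℕ (shift a (shift b i)) ≡⟨ toℕ-shift a (shift b i) ⟩
        (toℕ (shift b i) + a) % n ≡⟨ cong (λ z → (z + a) % n) (toℕ-shift b i) ⟩
        ((toℕ i + b) % n + a) % n ≡⟨ %-distribˡ-+ ((toℕ i + b) % n) a n ⟩
        ((toℕ i + b) % n % n + a % n) % n ≡⟨ cong (λ z → (z + a % n) % n) (m%n%n≡m%n (toℕ i + b) n) ⟩
        ((toℕ i + b) % n + a % n) % n ≡⟨ sym (%-distribˡ-+ (toℕ i + b) a n) ⟩
        (toℕ i + b + a) % n ≡⟨ cong (_% n) (+-assoc (toℕ i) b a) ⟩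
        (toℕ i + (b + a)) % n ≡⟨ sym (toℕ-shift (b + a) i) ⟩
        toℕ (shift (b + a) i) ∎)
      where open ≡-Reasoning

    shift-comm : ∀ a b (i : Fin n) → shift a (shift b i) ≡ shift b (shift a i)
    shift-comm a b i = trans (shift-shift a b i) (trans (cong (λ z → shift z i) (+-comm b a)) (sym (shift-shift b a i)))

    shift-n : ∀ (i : Fin n) → shift n i ≡ i
    shift-n i = toℕ-injective (trans (toℕ-shift n i) (trans ([m+n]%n≡m%n (toℕ i) n) (m<n⇒m%n≡m (toℕ<n i))))

    unshift : ∀ {c} → c ≤ n → ∀ (i : Fin n) → shift (n ∸ c) (shift c i) ≡ i
    unshift {c} c≤n i = trans (shift-shift (n ∸ c) c i) (trans (cong (λ z → shift z i) (m+[n∸m]≡n c≤n)) (shift-n i))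

    shift-unshift : ∀ {c} → c ≤ n → ∀ (i : Fin n) → shift c (shift (n ∸ c) i) ≡ i
    shift-unshift {c} c≤n i = trans (shift-comm c (n ∸ c) i) (unshift c≤n i)

    shift-no-wrap : ∀ c (i : Fin n) → toℕ i + c < n → toℕ (shift c i) ≡ toℕ i + c
    shift-no-wrap c i lt = trans (toℕ-shift c i) (m<n⇒m%n≡m lt)

    shift-wrap-≡ : ∀ c (i : Fin n) → c ≤ n → n ≤ toℕ i + c → toℕ (shift c i) + n ≡ toℕ i + c
    shift-wrap-≡ c i c≤n ge = trans (cong (_+ n) (trans (toℕ-shift c i) (trans (sym (m≤n⇒[n∸m]%m≡n%m ge)) (m<n⇒m%n≡m lt)))) (m∸n+n≡m ge)
      where
        lt : (toℕ i + c) ∸ n < n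
        lt = ≤-trans (+-cancelʳ-≤ n _ _ (≤-trans (≤-reflexive (cong suc (m∸n+n≡m ge))) (≤-trans (+-monoˡ-≤ c (toℕ<n i)) (≤-reflexive (+-comm n c))))) c≤n

    shift-wrap : ∀ c (i : Fin n) → c ≤ n → n ≤ toℕ i + c → toℕ (shift c i) < c
    shift-wrap c i c≤n ge = +-cancelʳ-< n _ _ (≤-trans (s≤s (≤-reflexive (shift-wrap-≡ c i c≤n ge))) (≤-trans (+-monoˡ-≤ c (toℕ<n i)) (≤-reflexive (+-comm n c))))

    shift-≢ : ∀ c (i : Fin n) → 0 < c → c < n → shift c i ≢ i
    shift-≢ c i 0<c c<n e with toℕ i + c <? n
    ... | yes lt = <⇒≢ 0<c (sym (+-cancelˡ-≡ (toℕ i) c 0 (trans (sym (shift-no-wrap c i lt)) (trans (cong toℕ e) (sym (+-identityʳ (toℕ i)))))))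
    ... | no ≮ = <⇒≢ c<n (sym (+-cancelˡ-≡ (toℕ i) _ _ (trans (cong (λ z → toℕ z + n) (sym e)) (shift-wrap-≡ c i (<⇒≤ c<n) (≮⇒≥ ≮)))))

  -- Squares of Hamilton cycles as a family of edge sets

  module Cycle (n : ℕ) (3≤n : 3 ≤ n) where

    private instance
      n≢0 : NonZero n
      n≢0 = >-nonZero (≤-trans (s≤s z≤n) 3≤n)

    infix 4 _~_ _~?_

    _~_ : Fin n → Fin n → Set
    x ~ y = (y ≡ shift 1 x ⊎ y ≡ shift 2 x) ⊎ (x ≡ shift 1 y ⊎ x ≡ shift 2 y)

    abstract
      _~?_ : ∀ x y → Dec (x ~ y)
      x ~? y = ((y Fin.≟ shift 1 x) ⊎-dec (y Fin.≟ shift 2 x)) ⊎-dec ((x Fin.≟ shift 1 y) ⊎-dec (x Fin.≟ shift 2 y))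

    ~-sym : ∀ {x y} → x ~ y → y ~ x
    ~-sym = Sum.swap

    1≤n : 1 ≤ n
    1≤n = ≤-trans (s≤s z≤n) 3≤n

    2≤n : 2 ≤ n
    2≤n = ≤-trans (s≤s (s≤s z≤n)) 3≤n

    nb : Fin n → List (Fin n)
    nb x = shift 1 x ∷ shift 2 x ∷ shift (n ∸ 1) x ∷ shift (n ∸ 2) x ∷ []

    ~⇒∈nb : ∀ {x y} → x ~ y → y ∈ nb x
    ~⇒∈nb (inj₁ (inj₁ e)) = here e
    ~⇒∈nb (inj₁ (inj₂ e)) = there (here e)
    ~⇒∈nb {x} {y} (inj₂ (inj₁ e)) = there (there (here (trans (sym (unshift 1≤n y)) (cong (shift (n ∸ 1)) (sym e)))))
    ~⇒∈nb {x} {y} (inj₂ (inj₂ e)) = there (there (there (here (trans (sym (unshift 2≤n y)) (cong (shift (n ∸ 2)) (sym e))))))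

    Perms : List (Vec (Fin n) n)
    Perms = inj [] n

    EdgeAdj : Vec (Fin n) n → Fin n × Fin n → Set
    EdgeAdj π (u , v) = lookup π u ~ lookup π v

    edgeAdj? : ∀ π → Decidable (EdgeAdj π)
    edgeAdj? π (u , v) = lookup π u ~? lookup π v

    -- A permutation π places vertex u at position π u of the cycle.
    S : Vec (Fin n) n → Subset (numPairs n)
    S π = tabulate (λ k → does (edgeAdj? π (List.lookup (pairs n) k)))

    ∈-S⁻ : ∀ π {k} → k ∈ₛ S π → EdgeAdj π (List.lookup (pairs n) k)
    ∈-S⁻ π {k} k∈ = decided (edgeAdj? π (List.lookup (pairs n) k))
        (trans (sym (lookup∘tabulate (λ k → does (edgeAdj? π (List.lookup (pairs n) k))) k)) ([]=⇒lookup k∈))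
      where
        decided : ∀ {P : Set} (d : Dec P) → does d ≡ true → P
        decided (yes p) _ = p

    ∈-S⁺ : ∀ π {k} → EdgeAdj π (List.lookup (pairs n) k) → k ∈ₛ S π
    ∈-S⁺ π {k} p = lookup⇒[]= k (S π) (trans (lookup∘tabulate (λ k → does (edgeAdj? π (List.lookup (pairs n) k))) k)
      (dec-true (edgeAdj? π (List.lookup (pairs n) k)) p))

    open Fragments Perms S public

    sort₂-adj : ∀ π r → EdgeAdj π (sort₂ r) → EdgeAdj π r
    sort₂-adj π r h with sort₂ r | sort₂-cases r
    ... | _ | inj₁ refl = h
    ... | _ | inj₂ refl = ~-sym h

    -- Distinct edges of `F ∩ S π` come from distinct sorted pairs, all among the adjacent members
    -- of `rs`. The list may also hold pairs outside F; they only weaken the bound.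
    edgeCount : ∀ F π rs → (∀ {q} → q ∈ select (pairs n) F → ∃ λ r → r ∈ rs × q ≡ sort₂ r) →
      ∣ F ∩ S π ∣ ≤ length (filter (edgeAdj? π) rs)
    edgeCount F π rs cover = ≤-trans (≤-reflexive (sym (length-select (pairs n) (F ∩ S π))))
      (≤-trans (length-Unique-⊆ (select-Unique (pairs n) (F ∩ S π) (pairs-Unique n)) incl) (≤-reflexive (length-map sort₂ (filter (edgeAdj? π) rs))))
      where
        incl : ∀ {q} → q ∈ select (pairs n) (F ∩ S π) → q ∈ map sort₂ (filter (edgeAdj? π) rs)
        incl q∈ with ∈-select⁻ (pairs n) (F ∩ S π) q∈
        ... | k , refl , k∈ with x∈p∩q⁻ F (S π) k∈
        ... | k∈F , k∈S with cover (∈-select⁺ (pairs n) F k∈F)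
        ... | r , r∈ , e = subst (_∈ map sort₂ (filter (edgeAdj? π) rs)) (sym e)
          (∈-map⁺ sort₂ (∈-filter⁺ (edgeAdj? π) r∈ (sort₂-adj π r (subst (EdgeAdj π) e (∈-S⁻ π k∈S)))))

    Hop : ℕ → Set
    Hop c = c ≡ 1 ⊎ c ≡ 2

    Hop-≤2 : ∀ {c} → Hop c → c ≤ 2
    Hop-≤2 (inj₁ refl) = s≤s z≤n
    Hop-≤2 (inj₂ refl) = ≤-refl

    -- Edges of the square of the cycle listed by `ρ`, in the orientation used by `pairs n`.
    CycEdge : (Fin n → Fin n) → Fin n × Fin n → Set
    CycEdge ρ q = ∃₂ λ i c → Hop c × q ≡ sort₂ (ρ i , ρ (shift c i))

    CycEdge-rotate : ∀ ρ {s} → s ≤ n → ∀ {q} → CycEdge ρ q → CycEdge (ρ ∘ shift s) q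
    CycEdge-rotate ρ {s} s≤n (i , c , hop , e) = shift (n ∸ s) i , c , hop , trans e (cong sort₂ (cong₂ _,_
      (cong ρ (sym (shift-unshift s≤n i)))
      (cong ρ (trans (cong (shift c) (sym (shift-unshift s≤n i))) (shift-comm c s (shift (n ∸ s) i))))))

    module _ (τ : Vec (Fin n) n) (τ∈ : τ ∈ Perms) where

      private
        τ-inj : ∀ {i j} → lookup τ i ≡ lookup τ j → i ≡ j
        τ-inj {i} {j} = proj₁ (inj-sound τ∈) i j

      vertexAt : Fin n → Fin n
      vertexAt y = proj₁ (injective⇒surjective (lookup τ) τ-inj y)

      lookup-vertexAt : ∀ y → lookup τ (vertexAt y) ≡ y
      lookup-vertexAt y = proj₂ (injective⇒surjective (lookup τ) τ-inj y)

      vertexAt-lookup : ∀ a → vertexAt (lookup τ a) ≡ a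
      vertexAt-lookup a = τ-inj (lookup-vertexAt (lookup τ a))

      vertexAt-injective : ∀ {i j} → vertexAt i ≡ vertexAt j → i ≡ j
      vertexAt-injective {i} {j} e = trans (sym (lookup-vertexAt i)) (trans (cong (lookup τ) e) (lookup-vertexAt j))

      cycEdges : ∀ F → F ⊆ S τ → ∀ {q} → q ∈ select (pairs n) F → CycEdge vertexAt q
      cycEdges F F⊆ {q} q∈ with ∈-select⁻ (pairs n) F q∈
      ... | k , e , k∈ = by (∈-S⁻ τ (F⊆ k∈))
        where
          u = proj₁ (List.lookup (pairs n) k)
          v = proj₂ (List.lookup (pairs n) k)
          u<v : toℕ u < toℕ v
          u<v = ∈-pairs⁻ (∈-lookup {xs = pairs n} k)
          edge : ∀ a b c → Hop c → (u , v) ≡ sort₂ (a , b) → lookup τ b ≡ shift c (lookup τ a) → CycEdge vertexAt q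
          edge a b c hop e′ h = lookup τ a , c , hop , trans (sym e) (trans e′ (cong sort₂ (cong₂ _,_ (sym (vertexAt-lookup a))
            (trans (sym (vertexAt-lookup b)) (cong vertexAt h)))))
          by : lookup τ u ~ lookup τ v → CycEdge vertexAt q
          by (inj₁ (inj₁ h)) = edge u v 1 (inj₁ refl) (sym (sort₂-< u<v)) h
          by (inj₁ (inj₂ h)) = edge u v 2 (inj₂ refl) (sym (sort₂-< u<v)) h
          by (inj₂ (inj₁ h)) = edge v u 1 (inj₁ refl) (sym (sort₂-> u<v)) h
          by (inj₂ (inj₂ h)) = edge v u 2 (inj₂ refl) (sym (sort₂-> u<v)) h

    -- Cutting the cycle into a list breaks only the hops that pass its end, and those land on the
    -- first two entries. They are dealt with either by paying for them or by starting the list at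
    -- two vertices that F avoids.
    hop-near : ∀ (ρ : Fin n → Fin n) i c → Hop c → Near (List.tabulate ρ) (ρ i) (ρ (shift c i)) ⊎ toℕ (shift c i) < 2
    hop-near ρ i c hop with toℕ i + c <? n
    ... | no ≮ = inj₂ (≤-trans (shift-wrap c i (≤-trans (Hop-≤2 hop) 2≤n) (≮⇒≥ ≮)) (Hop-≤2 hop))
    hop-near ρ i .1 (inj₁ refl) | yes lt = inj₁ (Near-tabulate₁ ρ i _ (trans (shift-no-wrap 1 i lt) (+-comm (toℕ i) 1)))
    hop-near ρ i .2 (inj₂ refl) | yes lt = inj₁ (Near-tabulate₂ ρ i _ (trans (shift-no-wrap 2 i lt) (+-comm (toℕ i) 2)))

    pos₀ pos₁ : Fin n
    pos₀ = fromℕ< 1≤n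
    pos₁ = fromℕ< 2≤n

    toℕ<2 : ∀ (j : Fin n) → toℕ j < 2 → j ≡ pos₀ ⊎ j ≡ pos₁
    toℕ<2 j lt = by (toℕ j) refl lt
      where
        by : ∀ t → toℕ j ≡ t → t < 2 → j ≡ pos₀ ⊎ j ≡ pos₁
        by 0 e _ = inj₁ (toℕ-injective (trans e (sym (toℕ-fromℕ< 1≤n))))
        by 1 e _ = inj₂ (toℕ-injective (trans e (sym (toℕ-fromℕ< 2≤n))))
        by (suc (suc t)) e (s≤s (s≤s ()))

    -- Exponential moments of the intersection with a random square

    module Moments (B : ℕ) (1≤B : 1 ≤ B) where

      open Exposure _~_ _~?_ (λ {x} {y} → ~-sym {x} {y}) nb ~⇒∈nb (λ _ → ≤-refl) B 1≤B

      private instance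
        B≢0 : NonZero B
        B≢0 = >-nonZero 1≤B

      Γ-nearPairs : ∀ π p₂ p₁ us → Γ (Maybe.map (lookup π) p₂) (Maybe.map (lookup π) p₁) (map (lookup π) us)
        ≡ B ^ length (filter (edgeAdj? π) (nearPairs p₂ p₁ us))
      Γ-nearPairs π p₂ p₁ [] = refl
      Γ-nearPairs π p₂ p₁ (y ∷ us) = begin
          B ^ (adj (Maybe.map (lookup π) p₂) (lookup π y) + adj (Maybe.map (lookup π) p₁) (lookup π y)) * Γ _ _ (map (lookup π) us)
            ≡⟨ cong₂ (λ e g → B ^ e * g) (cong₂ _+_ (adj-prev p₂) (adj-prev p₁)) (Γ-nearPairs π p₁ (just y) us) ⟩
          B ^ (#f (withPrev p₂ y) + #f (withPrev p₁ y)) * B ^ #f (nearPairs p₁ (just y) us) ≡⟨ sym (^-distribˡ-+-* B (#f (withPrev p₂ y) + #f (withPrev p₁ y)) _) ⟩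
          B ^ (#f (withPrev p₂ y) + #f (withPrev p₁ y) + #f (nearPairs p₁ (just y) us))
            ≡⟨ cong (B ^_) (trans (+-assoc (#f (withPrev p₂ y)) _ _) (sym (trans (#f-++ (withPrev p₂ y) _) (cong (#f (withPrev p₂ y) +_) (#f-++ (withPrev p₁ y) _))))) ⟩
          B ^ #f (nearPairs p₂ p₁ (y ∷ us)) ∎
        where
          open ≡-Reasoning
          #f : List (Fin n × Fin n) → ℕ
          #f rs = length (filter (edgeAdj? π) rs)
          #f-++ : ∀ rs ss → #f (rs ++ ss) ≡ #f rs + #f ss
          #f-++ rs ss = trans (cong length (filter-++ (edgeAdj? π) rs ss)) (length-++ (filter (edgeAdj? π) rs))
          adj-prev : ∀ p → adj (Maybe.map (lookup π) p) (lookup π y) ≡ #f (withPrev p y)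
          adj-prev nothing = refl
          adj-prev (just x) = trans (sym (+-identityʳ _)) (∑-⟦⟧ (edgeAdj? π) ((x , y) ∷ []))

      -- `us` is the order of exposure and `rest` completes it to a listing of all vertices, so that
      -- `reorder` applies. Edges of F that are not near in `us` go into `extra`, and each is
      -- granted its full factor `B`.
      expMoment-Γ : ∀ F us rest extra → Unique (us ++ rest) → length (us ++ rest) ≡ n →
        (∀ {q} → q ∈ select (pairs n) F → ∃ λ r → r ∈ extra ++ nearPairs nothing nothing us × q ≡ sort₂ r) →
        expMoment B F ≤ B ^ length extra * ∑ Perms (λ v → Γ nothing nothing (take (length us) (toList v)))
      expMoment-Γ F us rest extra u len cover with listToVec (us ++ rest) len
      ... | w , w≡ = begin
          expMoment B F ≤⟨ ∑-mono Perms pt ⟩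
          ∑ Perms (λ π → B ^ length extra * f (Vec.map (lookup π) w)) ≡⟨ ∑-*ˡ Perms (B ^ length extra) (λ π → f (Vec.map (lookup π) w)) ⟩
          B ^ length extra * ∑ Perms (λ π → f (Vec.map (lookup π) w)) ≤⟨ *-monoʳ-≤ (B ^ length extra) (reorder w (Unique⇒Injectiveᵥ w (subst Unique (sym w≡) u)) f) ⟩
          B ^ length extra * ∑ Perms f ∎
        where
          open ≤-Reasoning
          f : Vec (Fin n) n → ℕ
          f v = Γ nothing nothing (take (length us) (toList v))
          take-us : ∀ {A : Set} (us rest : List A) → take (length us) (us ++ rest) ≡ us
          take-us [] rest = refl
          take-us (x ∷ us) rest = cong (x ∷_) (take-us us rest)
          exposed : ∀ π → take (length us) (toList (Vec.map (lookup π) w)) ≡ map (lookup π) us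
          exposed π = trans (cong (take (length us)) (trans (toList-map (lookup π) w) (cong (map (lookup π)) w≡)))
            (trans (take-map (length us) (us ++ rest)) (cong (map (lookup π)) (take-us us rest)))
          pt : ∀ π → B ^ ∣ F ∩ S π ∣ ≤ B ^ length extra * f (Vec.map (lookup π) w)
          pt π = begin
            B ^ ∣ F ∩ S π ∣ ≤⟨ ^-monoʳ-≤ B (edgeCount F π (extra ++ near) cover) ⟩
            B ^ length (filter (edgeAdj? π) (extra ++ near)) ≡⟨ cong (λ z → B ^ z) (trans (cong length (filter-++ (edgeAdj? π) extra near)) (length-++ (filter (edgeAdj? π) extra))) ⟩
            B ^ (length (filter (edgeAdj? π) extra) + length (filter (edgeAdj? π) near)) ≤⟨ ^-monoʳ-≤ B (+-monoˡ-≤ (length (filter (edgeAdj? π) near)) (length-filter (edgeAdj? π) extra)) ⟩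
            B ^ (length extra + length (filter (edgeAdj? π) near)) ≡⟨ ^-distribˡ-+-* B (length extra) _ ⟩
            B ^ length extra * B ^ length (filter (edgeAdj? π) near) ≡⟨ cong (B ^ length extra *_) (sym (trans (cong (Γ nothing nothing) (exposed π)) (Γ-nearPairs π nothing nothing us))) ⟩
            B ^ length extra * f (Vec.map (lookup π) w) ∎
            where near = nearPairs nothing nothing us

      -- All vertices are exposed along `τ`. The factor B⁴ pays for the four hops of length 1 or 2
      -- that end in the first two positions, which include every hop across the end of the list.
      expMoment-crude : 8 * (B * B) ≤ n → ∀ F τ → τ ∈ Perms → F ⊆ S τ → expMoment B F ≤ B ^ 4 * (2 * n) ^ n
      expMoment-crude 8B²≤n F τ τ∈ F⊆ = ≤-trans
          (expMoment-Γ F us [] wraps (subst Unique (sym ++-[]) (Unique.tabulate⁺ (vertexAt-injective τ τ∈))) (trans (cong length ++-[]) (length-tabulate ρ)) cover)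
          (*-monoʳ-≤ (B ^ 4) (≤-trans (≤-reflexive (cong (λ l → ∑ Perms (λ v → Γ nothing nothing (take l (toList v)))) (length-tabulate ρ))) (∑Γ-crude 8B²≤n)))
        where
          ρ = vertexAt τ τ∈
          us = List.tabulate ρ
          ++-[] : us ++ [] ≡ us
          ++-[] = ++-identityʳ us
          wrap : ℕ → Fin n → Fin n × Fin n
          wrap c j = ρ (shift (n ∸ c) j) , ρ j
          wraps = wrap 1 pos₀ ∷ wrap 1 pos₁ ∷ wrap 2 pos₀ ∷ wrap 2 pos₁ ∷ []
          ∈-wraps : ∀ c → Hop c → ∀ j → j ≡ pos₀ ⊎ j ≡ pos₁ → wrap c j ∈ wraps
          ∈-wraps _ (inj₁ refl) _ (inj₁ refl) = here refl
          ∈-wraps _ (inj₁ refl) _ (inj₂ refl) = there (here refl)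
          ∈-wraps _ (inj₂ refl) _ (inj₁ refl) = there (there (here refl))
          ∈-wraps _ (inj₂ refl) _ (inj₂ refl) = there (there (there (here refl)))
          cover : ∀ {q} → q ∈ select (pairs n) F → ∃ λ r → r ∈ wraps ++ nearPairs nothing nothing us × q ≡ sort₂ r
          cover q∈ with cycEdges τ τ∈ F F⊆ q∈
          ... | i , c , hop , e with hop-near ρ i c hop
          ... | inj₁ near = _ , ∈-++⁺ʳ wraps (Near⇒∈ near nothing nothing) , e
          ... | inj₂ lt = _ , ∈-++⁺ˡ (subst (_∈ wraps) (cong (λ z → ρ z , ρ (shift c i)) (unshift (≤-trans (Hop-≤2 hop) 2≤n) i))
                  (∈-wraps c hop (shift c i) (toℕ<2 (shift c i) lt))) , e

      -- F meets at most 2k vertices, and only these are exposed. Since 4k < n, two consecutive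
      -- vertices of the cycle avoid F; the list is rotated to start there, so no edge of F crosses
      -- its end and nothing extra is paid.
      expMoment-small : ∀ k F τ → τ ∈ Perms → F ⊆ S τ → ∣ F ∣ ≤ k → 4 * k < n → 48 * (B * B) + 2 * k ≤ n →
        B ^ (2 * k) * expMoment B F ≤ suc B ^ (2 * k) * n !
      expMoment-small k F τ τ∈ F⊆ F≤k 4k<n room = small
        where
          endpoints : Fin n × Fin n → List (Fin n)
          endpoints (u , v) = u ∷ v ∷ []
          ends : List (Fin n)
          ends = concatMap endpoints (select (pairs n) F)
          length-ends : length ends ≤ 2 * k
          length-ends = ≤-trans (≤-reflexive (trans (count (select (pairs n) F)) (cong (2 *_) (length-select (pairs n) F)))) (*-monoʳ-≤ 2 F≤k)
            where
              count : ∀ (qs : List (Fin n × Fin n)) → length (concatMap endpoints qs) ≡ 2 * length qs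
              count [] = refl
              count (q ∷ qs) = trans (cong (2 +_) (count qs)) (sym (*-distribˡ-+ 2 1 (length qs)))
          ends-∈ : ∀ {r} → sort₂ r ∈ select (pairs n) F → proj₁ r ∈ ends × proj₂ r ∈ ends
          ends-∈ {r} q∈ = Sum.[ (λ e → first e , second e) , (λ e → second e , first e) ]′ (sort₂-cases r)
            where
              first : ∀ {a b} → sort₂ r ≡ (a , b) → a ∈ ends
              first e = ∈-concatMap⁺ endpoints (lose (subst (_∈ select (pairs n) F) e q∈) (here refl))
              second : ∀ {a b} → sort₂ r ≡ (a , b) → b ∈ ends
              second e = ∈-concatMap⁺ endpoints (lose (subst (_∈ select (pairs n) F) e q∈) (there (here refl)))
          ρ = vertexAt τ τ∈
          -- A starting point `s` fails only if it is the position of an endpoint of F or comes just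
          -- before one; that excludes at most 2k + 2k positions.
          cut : ∃ λ s → ρ s ∉ ends × ρ (shift 1 s) ∉ ends
          cut with Fin.any? (λ s → ¬? (ρ s ∈? ends) ×-dec ¬? (ρ (shift 1 s) ∈? ends))
          ... | yes p = p
          ... | no none = ⊥-elim (<⇒≱ 4k<n (begin
              n ≡⟨ sym (length-tabulate {n = n} id) ⟩
              length (allFin n) ≤⟨ length-Unique-⊆ (Unique.allFin⁺ n) covered ⟩
              length (map (lookup τ) ends ++ map (shift (n ∸ 1) ∘ lookup τ) ends)
                ≡⟨ trans (length-++ (map (lookup τ) ends)) (cong₂ _+_ (length-map (lookup τ) ends) (length-map (shift (n ∸ 1) ∘ lookup τ) ends)) ⟩
              length ends + length ends ≤⟨ +-mono-≤ length-ends length-ends ⟩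
              2 * k + 2 * k ≡⟨ four k ⟩
              4 * k ∎))
            where
              open ≤-Reasoning
              four : ∀ k → 2 * k + 2 * k ≡ 4 * k
              four = solve-∀
              covered : ∀ {s} → s ∈ allFin n → s ∈ map (lookup τ) ends ++ map (shift (n ∸ 1) ∘ lookup τ) ends
              covered {s} _ with ρ s ∈? ends | ρ (shift 1 s) ∈? ends
              ... | yes p | _ = ∈-++⁺ˡ (subst (_∈ map (lookup τ) ends) (lookup-vertexAt τ τ∈ s) (∈-map⁺ (lookup τ) p))
              ... | no _ | yes p = ∈-++⁺ʳ (map (lookup τ) ends) (subst (_∈ map (shift (n ∸ 1) ∘ lookup τ) ends)
                      (trans (cong (shift (n ∸ 1)) (lookup-vertexAt τ τ∈ (shift 1 s))) (unshift 1≤n s)) (∈-map⁺ (shift (n ∸ 1) ∘ lookup τ) p))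
              ... | no p | no p′ = ⊥-elim (none (s , p , p′))
          s = proj₁ cut
          ρ′ : Fin n → Fin n
          ρ′ = ρ ∘ shift (toℕ s)
          shift-injective : ∀ {i j} → shift (toℕ s) i ≡ shift (toℕ s) j → i ≡ j
          shift-injective {i} {j} e = trans (sym (unshift (<⇒≤ (toℕ<n s)) i)) (trans (cong (shift (n ∸ toℕ s)) e) (unshift (<⇒≤ (toℕ<n s)) j))
          at₀ : ρ′ pos₀ ≡ ρ s
          at₀ = cong ρ (toℕ-injective (trans (toℕ-shift (toℕ s) pos₀) (trans (cong (λ z → (z + toℕ s) % n) (toℕ-fromℕ< 1≤n)) (m<n⇒m%n≡m (toℕ<n s)))))
          at₁ : ρ′ pos₁ ≡ ρ (shift 1 s)
          at₁ = cong ρ (toℕ-injective (trans (toℕ-shift (toℕ s) pos₁) (trans (cong (λ z → (z + toℕ s) % n) (toℕ-fromℕ< 2≤n))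
            (trans (cong (_% n) (+-comm 1 (toℕ s))) (sym (toℕ-shift 1 s))))))
          untouched : ∀ j → toℕ j < 2 → ρ′ j ∉ ends
          untouched j lt with toℕ<2 j lt
          ... | inj₁ refl = λ h → proj₁ (proj₂ cut) (subst (_∈ ends) at₀ h)
          ... | inj₂ refl = λ h → proj₂ (proj₂ cut) (subst (_∈ ends) at₁ h)
          vs = List.tabulate ρ′
          vs-Unique : Unique vs
          vs-Unique = Unique.tabulate⁺ (λ e → shift-injective (vertexAt-injective τ τ∈ e))
          us = filter (_∈? ends) vs
          rest = filter (λ v → ¬? (v ∈? ends)) vs
          all-Unique : Unique (us ++ rest)
          all-Unique = Unique.++⁺ (Unique.filter⁺ (_∈? ends) vs-Unique) (Unique.filter⁺ (λ v → ¬? (v ∈? ends)) vs-Unique)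
            (λ (p , q) → proj₂ (∈-filter⁻ (λ v → ¬? (v ∈? ends)) {xs = vs} q) (proj₂ (∈-filter⁻ (_∈? ends) {xs = vs} p)))
          length-all : length (us ++ rest) ≡ n
          length-all = ≤-antisym
              (≤-trans (length-Unique-⊆ {ys = allFin n} all-Unique (λ {x} _ → ∈-allFin x)) (≤-reflexive (length-tabulate id)))
              (≤-trans (≤-reflexive (sym (length-tabulate ρ′))) (length-Unique-⊆ vs-Unique split))
            where
              split : ∀ {v} → v ∈ vs → v ∈ us ++ rest
              split {v} v∈ with v ∈? ends
              ... | yes p = ∈-++⁺ˡ (∈-filter⁺ (_∈? ends) v∈ p)
              ... | no p = ∈-++⁺ʳ us (∈-filter⁺ (λ v → ¬? (v ∈? ends)) v∈ p)
          l≤2k : length us ≤ 2 * k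
          l≤2k = ≤-trans (length-Unique-⊆ (Unique.filter⁺ (_∈? ends) vs-Unique) (λ v∈ → proj₂ (∈-filter⁻ (_∈? ends) {xs = vs} v∈))) length-ends
          cover : ∀ {q} → q ∈ select (pairs n) F → ∃ λ r → r ∈ [] ++ nearPairs nothing nothing us × q ≡ sort₂ r
          cover {q} q∈ = place (CycEdge-rotate ρ {toℕ s} (<⇒≤ (toℕ<n s)) (cycEdges τ τ∈ F F⊆ q∈))
            where
              place : CycEdge ρ′ q → ∃ λ r → r ∈ nearPairs nothing nothing us × q ≡ sort₂ r
              place (i , c , hop , e) = Sum.[ (λ near → r , Near⇒∈ (Near-filter (_∈? ends) near (proj₁ r∈) (proj₂ r∈)) nothing nothing , e)
                  , (λ lt → ⊥-elim (untouched (shift c i) lt (proj₂ r∈))) ]′ (hop-near ρ′ i c hop)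
                where
                  r = ρ′ i , ρ′ (shift c i)
                  r∈ = ends-∈ {r} (subst (_∈ select (pairs n) F) e q∈)
          l = length us
          Σl = ∑ Perms (λ v → Γ nothing nothing (take l (toList v)))
          -- Only `l` vertices are exposed; the `d` missing factors are padded with B ≤ B + 1.
          d = 2 * k ∸ l
          2k≡ : 2 * k ≡ d + l
          2k≡ = sym (m∸n+n≡m l≤2k)
          small : B ^ (2 * k) * expMoment B F ≤ suc B ^ (2 * k) * n !
          small = begin
            B ^ (2 * k) * expMoment B F ≤⟨ *-monoʳ-≤ (B ^ (2 * k)) (≤-trans (expMoment-Γ F us rest [] all-Unique length-all cover) (≤-reflexive (+-identityʳ Σl))) ⟩
            B ^ (2 * k) * Σl ≡⟨ trans (cong (λ z → B ^ z * Σl) 2k≡) (trans (cong (_* Σl) (^-distribˡ-+-* B d l)) (*-assoc (B ^ d) (B ^ l) Σl)) ⟩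
            B ^ d * (B ^ l * Σl) ≤⟨ *-mono-≤ (^-monoˡ-≤ d (n≤1+n B)) (∑Γ-potential l (≤-trans (+-monoʳ-≤ (48 * (B * B)) l≤2k) room)) ⟩
            suc B ^ d * (suc B ^ l * n !) ≡⟨ sym (trans (cong (λ z → suc B ^ z * n !) 2k≡) (trans (cong (_* n !) (^-distribˡ-+-* (suc B) d l)) (*-assoc (suc B ^ d) (suc B ^ l) (n !)))) ⟩
            suc B ^ (2 * k) * n ! ∎
            where open ≤-Reasoning

  -- Elementary estimates around (1 + 1/B)^B ≤ 4

  -- Bernoulli's inequality (1 - 1/(B+1))^j ≥ 1 - j/(B+1) with denominators cleared and d = B + 1 -
  -- j. One factor moves at a time, as (B + 1) d ≤ B (d + 1) for d ≤ B.
  bernoulli : ∀ B j d → j + d ≡ suc B → suc B ^ j * d ≤ B ^ j * suc B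
  bernoulli B zero d refl = ≤-refl
  bernoulli B (suc j) d e = begin
      suc B * suc B ^ j * d ≡⟨ e₁ B (suc B ^ j) d ⟩
      suc B ^ j * (B * d + d) ≤⟨ *-monoʳ-≤ (suc B ^ j) (+-monoʳ-≤ (B * d) d≤B) ⟩
      suc B ^ j * (B * d + B) ≡⟨ e₂ B (suc B ^ j) d ⟩
      B * (suc B ^ j * suc d) ≤⟨ *-monoʳ-≤ B (bernoulli B j (suc d) (trans (+-suc j d) e)) ⟩
      B * (B ^ j * suc B) ≡⟨ sym (*-assoc B (B ^ j) (suc B)) ⟩
      B * B ^ j * suc B ∎
    where
      open ≤-Reasoning
      d≤B : d ≤ B
      d≤B = ≤-trans (m≤n+m d j) (≤-reflexive (suc-injective e))
      e₁ : ∀ B p d → suc B * p * d ≡ p * (B * d + d)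
      e₁ = solve-∀
      e₂ : ∀ B p d → p * (B * d + B) ≡ B * (p * suc d)
      e₂ = solve-∀

  pow-half : ∀ B j → 2 * j ≤ suc B → suc B ^ j ≤ 2 * B ^ j
  pow-half B j le = *-cancelʳ-≤ _ _ (suc B) (begin
      suc B ^ j * suc B ≤⟨ *-monoʳ-≤ (suc B ^ j) (+-cancelˡ-≤ (2 * j) _ _ (≤-trans (+-monoˡ-≤ (suc B) le) (≤-reflexive (sym two)))) ⟩
      suc B ^ j * (2 * d) ≡⟨ e₁ (suc B ^ j) d ⟩
      2 * (suc B ^ j * d) ≤⟨ *-monoʳ-≤ 2 (bernoulli B j d jd) ⟩
      2 * (B ^ j * suc B) ≡⟨ sym (*-assoc 2 (B ^ j) (suc B)) ⟩
      2 * B ^ j * suc B ∎)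
    where
      open ≤-Reasoning
      d = suc B ∸ j
      jd : j + d ≡ suc B
      jd = m+[n∸m]≡n (≤-trans (m≤m+n j _) le)
      two : 2 * j + 2 * d ≡ suc B + suc B
      two = trans (sym (*-distribˡ-+ 2 j d)) (trans (cong (2 *_) jd) (cong (suc B +_) (+-identityʳ (suc B))))
      e₁ : ∀ p d → p * (2 * d) ≡ 2 * (p * d)
      e₁ = solve-∀

  -- Bernoulli is useful up to about B/2, where it gives the ratio 2; the two halves of the exponent
  -- then give 2 · 2.
  pow-self : ∀ B → suc B ^ B ≤ 4 * B ^ B
  pow-self B = begin
      suc B ^ B ≡⟨ trans (cong (suc B ^_) (sym B≡)) (^-distribˡ-+-* (suc B) i j) ⟩
      suc B ^ i * suc B ^ j ≤⟨ *-mono-≤ (pow-half B i 2i≤) (pow-half B j 2j≤) ⟩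
      2 * B ^ i * (2 * B ^ j) ≡⟨ e₁ (B ^ i) (B ^ j) ⟩
      4 * (B ^ i * B ^ j) ≡⟨ cong (4 *_) (trans (sym (^-distribˡ-+-* B i j)) (cong (B ^_) B≡)) ⟩
      4 * B ^ B ∎
    where
      open ≤-Reasoning
      i = ⌊ B /2⌋
      j = ⌈ B /2⌉
      B≡ : i + j ≡ B
      B≡ = ⌊n/2⌋+⌈n/2⌉≡n B
      e₁ : ∀ p q → 2 * p * (2 * q) ≡ 4 * (p * q)
      e₁ = solve-∀
      2i≤ : 2 * i ≤ suc B
      2i≤ = ≤-trans (+-monoʳ-≤ i (≤-trans (≤-reflexive (+-identityʳ i)) (⌊n/2⌋≤⌈n/2⌉ B))) (≤-trans (≤-reflexive B≡) (n≤1+n B))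
      2j≤ : 2 * j ≤ suc B
      2j≤ = ≤-trans (+-mono-≤ (⌊n/2⌋≤⌈n/2⌉ (suc B)) (≤-reflexive (+-identityʳ j))) (≤-trans (≤-reflexive (+-comm ⌈ suc B /2⌉ j)) (≤-reflexive (⌊n/2⌋+⌈n/2⌉≡n (suc B))))

  pow-ratio : ∀ B j m → .{{_ : NonZero B}} → m ≤ B * j → suc B ^ m ≤ 4 ^ j * B ^ m
  pow-ratio B j m le = *-cancelʳ-≤ _ _ (B ^ d) {{m^n≢0 B d}} (begin
      suc B ^ m * B ^ d ≤⟨ *-monoʳ-≤ (suc B ^ m) (^-monoˡ-≤ d (n≤1+n B)) ⟩
      suc B ^ m * suc B ^ d ≡⟨ trans (sym (^-distribˡ-+-* (suc B) m d)) (cong (suc B ^_) md) ⟩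
      suc B ^ (B * j) ≡⟨ sym (^-*-assoc (suc B) B j) ⟩
      (suc B ^ B) ^ j ≤⟨ ^-monoˡ-≤ j (pow-self B) ⟩
      (4 * B ^ B) ^ j ≡⟨ trans (^-distribʳ-* j 4 (B ^ B)) (cong (4 ^ j *_) (^-*-assoc B B j)) ⟩
      4 ^ j * B ^ (B * j) ≡⟨ cong (4 ^ j *_) (trans (cong (B ^_) (sym md)) (^-distribˡ-+-* B m d)) ⟩
      4 ^ j * (B ^ m * B ^ d) ≡⟨ sym (*-assoc (4 ^ j) (B ^ m) (B ^ d)) ⟩
      4 ^ j * B ^ m * B ^ d ∎)
    where
      open ≤-Reasoning
      d = B * j ∸ m
      md : m + d ≡ B * j
      md = m+[n∸m]≡n le

  n^n≤4^n*n! : ∀ n → n ^ n ≤ 4 ^ n * n !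
  n^n≤4^n*n! zero = ≤-refl
  n^n≤4^n*n! (suc n) = begin
      suc n * suc n ^ n ≤⟨ *-monoʳ-≤ (suc n) (≤-trans (pow-self n) (*-monoʳ-≤ 4 (n^n≤4^n*n! n))) ⟩
      suc n * (4 * (4 ^ n * n !)) ≡⟨ e (suc n) (4 ^ n) (n !) ⟩
      4 * 4 ^ n * (suc n * n !) ∎
    where
      open ≤-Reasoning
      e : ∀ s p f → s * (4 * (p * f)) ≡ 4 * p * (s * f)
      e = solve-∀

  n≤2^n : ∀ n → n ≤ 2 ^ n
  n≤2^n zero = z≤n
  n≤2^n (suc n) = ≤-trans (+-mono-≤ (m^n>0 2 n) (n≤2^n n)) (≤-reflexive (cong (2 ^ n +_) (sym (+-identityʳ (2 ^ n)))))

  -- The form in which Markov's inequality is used: the gain `x` has to beat both the excess `Y` of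
  -- the moment and the inverse `c` of the permitted error.
  absorb : ∀ {c Y x t Q} → .{{_ : NonZero Y}} → c * Y ≤ x → x * t ≤ Y * Q → c * t ≤ Q
  absorb {c} {Y} {x} {t} {Q} cY≤x xt≤YQ = *-cancelˡ-≤ Y (≤-trans (≤-reflexive (e Y c t)) (≤-trans (*-monoˡ-≤ t cY≤x) xt≤YQ))
    where
      e : ∀ Y c t → Y * (c * t) ≡ c * Y * t
      e = solve-∀

  -- Composing exposure rounds

  wsum∪ : ∀ {M} → ℕ → (Subset M → ℕ) → Subset M → ℕ
  wsum∪ a′ f V = wsum a′ (λ W → f (V ∪ W))

  -- The estimate for the later rounds holds from every exposed set `V ∪ W`, so it can be averaged
  -- over W; the errors of the rounds therefore add up.
  sprinkle : ∀ {M} a′ Q R Aʲ (f g G : Subset M → ℕ) → let A = (1 + a′) ^ M in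
    (∀ V → A * f V ≤ wsum∪ a′ g V + A * Q) → (∀ V → Aʲ * g V ≤ G V + Aʲ * R) →
    ∀ V → (A * Aʲ) * f V ≤ wsum∪ a′ G V + (A * Aʲ) * (Q + R)
  sprinkle {M} a′ Q R Aʲ f g G h₁ h₂ V = begin
      A * Aʲ * f V ≡⟨ e₁ A Aʲ (f V) ⟩
      Aʲ * (A * f V) ≤⟨ *-monoʳ-≤ Aʲ (h₁ V) ⟩
      Aʲ * (wsum∪ a′ g V + A * Q) ≡⟨ *-distribˡ-+ Aʲ (wsum∪ a′ g V) (A * Q) ⟩
      Aʲ * wsum∪ a′ g V + Aʲ * (A * Q) ≡⟨ cong (_+ Aʲ * (A * Q)) (sym (wsum-*ˡ a′ Aʲ (λ W → g (V ∪ W)))) ⟩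
      wsum a′ (λ W → Aʲ * g (V ∪ W)) + Aʲ * (A * Q) ≤⟨ +-monoˡ-≤ (Aʲ * (A * Q)) (wsum-mono a′ (λ W → h₂ (V ∪ W))) ⟩
      wsum a′ (λ W → G (V ∪ W) + Aʲ * R) + Aʲ * (A * Q) ≡⟨ cong (_+ Aʲ * (A * Q)) (trans (wsum-+ a′ (λ W → G (V ∪ W)) (λ _ → Aʲ * R)) (cong (wsum∪ a′ G V +_) (wsum-const {M} a′ (Aʲ * R)))) ⟩
      wsum∪ a′ G V + A * (Aʲ * R) + Aʲ * (A * Q) ≡⟨ e₂ (wsum∪ a′ G V) A Aʲ R Q ⟩
      wsum∪ a′ G V + A * Aʲ * (Q + R) ∎
    where
      open ≤-Reasoning
      A = (1 + a′) ^ M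
      e₁ : ∀ A B f → A * B * f ≡ B * (A * f)
      e₁ = solve-∀
      e₂ : ∀ w A B R Q → w + A * (B * R) + B * (A * Q) ≡ w + A * B * (Q + R)
      e₂ = solve-∀

  -- The base `B` of the moments: Markov's inequality replaces the inverse density `1 + a′` by `x`
  -- times it, and the binomial theorem adds 1.
  base : ℕ → ℕ → ℕ
  base x a′ = 1 + x * (1 + a′)

  -- The four rounds

  module Main (n a′ x E : ℕ) (3≤n : 3 ≤ n) (x≡ : x ≡ 2 ^ 32)
    (64B²≤n : 64 * (base x a′ * base x a′) ≤ n) (n≤256B² : n ≤ 256 * (base x a′ * base x a′))
    (B-large : (4 * E + 1) * (2 * E) ≤ base x a′) where

    open Cycle n 3≤n

    private
      a = 1 + a′
      B = base x a′
      -- Each of the four rounds may lose a proportion 1/(4E), so the total loss is 1/E.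
      c = 4 * E
      M = numPairs n

      1≤B : 1 ≤ B
      1≤B = s≤s z≤n

      1≤x : 1 ≤ x
      1≤x = ≤-trans (m^n>0 2 32) (≤-reflexive (sym x≡))

      instance
        B≢0 : NonZero B
        B≢0 = _
        n≢0 : NonZero n
        n≢0 = >-nonZero 1≤n
        n!≢0 : NonZero (n !)
        n!≢0 = n !≢0

      open Moments B 1≤B

      length-Perms : length Perms ≡ n !
      length-Perms = trans (length-∑ Perms) (∑-inj-1 n [] [] (+-identityʳ n))

      xʲ : ∀ j → x ^ j ≡ 2 ^ (32 * j)
      xʲ j = trans (cong (_^ j) x≡) (^-*-assoc 2 32 j)

      4ʲ : ∀ j → 4 ^ j ≡ 2 ^ (2 * j)
      4ʲ j = ^-*-assoc 2 2 j

      E≤B : E ≤ B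
      E≤B = ≤-trans (≤-trans (m≤m+n E _) (m≤n*m (2 * E) (4 * E + 1) {{>-nonZero (m≤n+m 1 (4 * E))}})) B-large

      B≤B² : B ≤ B * B
      B≤B² = m≤m*n B B

      c≤ : c ≤ 2 ^ (4 * E)
      c≤ = n≤2^n (4 * E)

      k₀ = n / 8

      8k₀≤n : 8 * k₀ ≤ n
      8k₀≤n = ≤-trans (≤-reflexive (*-comm 8 k₀)) (m/n*n≤m n 8)

      n≤8[1+k₀] : n ≤ 8 * suc k₀
      n≤8[1+k₀] = ≤-trans (≤-reflexive (m≡m%n+[m/n]*n n 8)) (≤-trans (+-monoˡ-≤ (k₀ * 8) (<⇒≤ (m%n<n n 8))) (≤-reflexive (*-comm (suc k₀) 8)))

      -- c B⁴ 8ⁿ ≤ 2^(4n) ≤ x^(1 + n/8)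
      tail₀ : ∀ F y → y ∈ Perms → F ⊆ S y → ∣ F ∣ ≤ M → c * tail a k₀ F ≤ n !
      tail₀ F y y∈ F⊆ _ = absorb {c} {B ^ 4 * 8 ^ n} {{m*n≢0 (B ^ 4) (8 ^ n) {{m^n≢0 B 4}} {{m^n≢0 8 n}}}} big (begin
          x ^ suc k₀ * tail a k₀ F ≤⟨ tail-markov x a k₀ F 1≤x ⟩
          expMoment B F ≤⟨ expMoment-crude (≤-trans (*-monoˡ-≤ (B * B) (m≤m+n 8 56)) 64B²≤n) F y y∈ F⊆ ⟩
          B ^ 4 * (2 * n) ^ n ≡⟨ cong (B ^ 4 *_) (^-distribʳ-* n 2 n) ⟩
          B ^ 4 * (2 ^ n * n ^ n) ≤⟨ *-monoʳ-≤ (B ^ 4) (*-monoʳ-≤ (2 ^ n) (n^n≤4^n*n! n)) ⟩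
          B ^ 4 * (2 ^ n * (4 ^ n * n !)) ≡⟨ cong (B ^ 4 *_) (trans (sym (*-assoc (2 ^ n) (4 ^ n) (n !))) (cong (_* n !) (sym (^-distribʳ-* n 2 4)))) ⟩
          B ^ 4 * (8 ^ n * n !) ≡⟨ sym (*-assoc (B ^ 4) (8 ^ n) (n !)) ⟩
          B ^ 4 * 8 ^ n * n ! ∎)
        where
          open ≤-Reasoning
          e₁ : ∀ E B n → 4 * E + (B * 4 + 3 * n) ≡ (4 * E + 4 * B) + 3 * n
          e₁ = solve-∀
          e₂ : ∀ b n → 4 * b + 4 * b + 3 * n ≡ 8 * b + 3 * n
          e₂ = solve-∀
          e₃ : ∀ n → n + 3 * n ≡ 4 * n
          e₃ = solve-∀
          e₄ : ∀ k → 4 * (8 * k) ≡ 32 * k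
          e₄ = solve-∀
          expo : 4 * E + (B * 4 + 3 * n) ≤ 32 * suc k₀
          expo = begin
            4 * E + (B * 4 + 3 * n) ≡⟨ e₁ E B n ⟩
            (4 * E + 4 * B) + 3 * n ≤⟨ +-monoˡ-≤ (3 * n) (+-mono-≤ (*-monoʳ-≤ 4 (≤-trans E≤B B≤B²)) (*-monoʳ-≤ 4 B≤B²)) ⟩
            4 * (B * B) + 4 * (B * B) + 3 * n ≡⟨ e₂ (B * B) n ⟩
            8 * (B * B) + 3 * n ≤⟨ +-monoˡ-≤ (3 * n) (≤-trans (*-monoˡ-≤ (B * B) (m≤m+n 8 56)) 64B²≤n) ⟩
            n + 3 * n ≡⟨ e₃ n ⟩
            4 * n ≤⟨ *-monoʳ-≤ 4 n≤8[1+k₀] ⟩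
            4 * (8 * suc k₀) ≡⟨ e₄ (suc k₀) ⟩
            32 * suc k₀ ∎
          big : c * (B ^ 4 * 8 ^ n) ≤ x ^ suc k₀
          big = begin
            c * (B ^ 4 * 8 ^ n) ≤⟨ *-mono-≤ c≤ (*-monoˡ-≤ (8 ^ n) (^-monoˡ-≤ 4 (n≤2^n B))) ⟩
            2 ^ (4 * E) * ((2 ^ B) ^ 4 * 8 ^ n) ≡⟨ cong (2 ^ (4 * E) *_) (cong₂ _*_ (^-*-assoc 2 B 4) (^-*-assoc 2 3 n)) ⟩
            2 ^ (4 * E) * (2 ^ (B * 4) * 2 ^ (3 * n)) ≡⟨ trans (cong (2 ^ (4 * E) *_) (sym (^-distribˡ-+-* 2 (B * 4) (3 * n)))) (sym (^-distribˡ-+-* 2 (4 * E) (B * 4 + 3 * n))) ⟩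
            2 ^ (4 * E + (B * 4 + 3 * n)) ≤⟨ ^-monoʳ-≤ 2 expo ⟩
            2 ^ (32 * suc k₀) ≡⟨ sym (xʲ (suc k₀)) ⟩
            x ^ suc k₀ ∎

      -- In powers of 2, the gain x^(k′+1) has exponent 32 (k′ + 1), which must cover 2 j for the
      -- moment excess 4^j and 4 E for `c`. As `j` is about 2k / B, the new size k′ is of order k /
      -- B.
      tail-small : ∀ k k′ j → 4 * k < n → 48 * (B * B) + 2 * k ≤ n → 2 * k ≤ B * j → 4 * E + 2 * j ≤ 32 * suc k′ →
        ∀ F y → y ∈ Perms → F ⊆ S y → ∣ F ∣ ≤ k → c * tail a k′ F ≤ n !
      tail-small k k′ j 4k<n room 2k≤Bj expo F y y∈ F⊆ F≤k = absorb {c} {4 ^ j} {{m^n≢0 4 j}} big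
          (≤-trans (tail-markov x a k′ F 1≤x) (*-cancelˡ-≤ (B ^ (2 * k)) {{m^n≢0 B (2 * k)}} (begin
            B ^ (2 * k) * expMoment B F ≤⟨ expMoment-small k F y y∈ F⊆ F≤k 4k<n room ⟩
            suc B ^ (2 * k) * n ! ≤⟨ *-monoˡ-≤ (n !) (pow-ratio B j (2 * k) 2k≤Bj) ⟩
            4 ^ j * B ^ (2 * k) * n ! ≡⟨ e (4 ^ j) (B ^ (2 * k)) (n !) ⟩
            B ^ (2 * k) * (4 ^ j * n !) ∎)))
        where
          open ≤-Reasoning
          e : ∀ p q r → p * q * r ≡ q * (p * r)
          e = solve-∀
          big : c * 4 ^ j ≤ x ^ suc k′
          big = begin
            c * 4 ^ j ≤⟨ *-mono-≤ c≤ (≤-reflexive (4ʲ j)) ⟩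
            2 ^ (4 * E) * 2 ^ (2 * j) ≡⟨ sym (^-distribˡ-+-* 2 (4 * E) (2 * j)) ⟩
            2 ^ (4 * E + 2 * j) ≤⟨ ^-monoʳ-≤ 2 expo ⟩
            2 ^ (32 * suc k′) ≡⟨ sym (xʲ (suc k′)) ⟩
            x ^ suc k′ ∎

      -- Room is exhausted exactly: 48 B² ≤ 3n/4 and 2 k₀ ≤ n/4. The upper bound on `n` gives 2 k₀ ≤
      -- 64 B², hence j = 64 B and an excess of 2^(128 B), against a gain of 2^(160 B + 32) from
      -- fragments of more than 5 B edges; the surplus covers `c`.
      tail₁ : ∀ F y → y ∈ Perms → F ⊆ S y → ∣ F ∣ ≤ k₀ → c * tail a (5 * B) F ≤ n !
      tail₁ = tail-small k₀ (5 * B) (64 * B) 4k₀<n room 2k₀≤ expo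
        where
          open ≤-Reasoning
          e₁ : ∀ k → 8 * k ≡ 4 * k + 4 * k
          e₁ = solve-∀
          e₂ : ∀ b k → 4 * (48 * b + 2 * k) ≡ 3 * (64 * b) + 8 * k
          e₂ = solve-∀
          e₃ : ∀ n → 3 * n + n ≡ 4 * n
          e₃ = solve-∀
          e₄ : ∀ k → 4 * (2 * k) ≡ 8 * k
          e₄ = solve-∀
          e₅ : ∀ B → 256 * (B * B) ≡ 4 * (B * (64 * B))
          e₅ = solve-∀
          e₆ : ∀ B → 32 * suc (5 * B) ≡ (4 * B + 2 * (64 * B)) + (28 * B + 32)
          e₆ = solve-∀
          4k₀<n : 4 * k₀ < n
          4k₀<n = ≰⇒> (λ n≤ → <⇒≱ (m<m+n n 1≤n) (≤-trans (+-mono-≤ n≤ n≤) (≤-trans (≤-reflexive (sym (e₁ k₀))) 8k₀≤n)))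
          room : 48 * (B * B) + 2 * k₀ ≤ n
          room = *-cancelˡ-≤ 4 (begin
            4 * (48 * (B * B) + 2 * k₀) ≡⟨ e₂ (B * B) k₀ ⟩
            3 * (64 * (B * B)) + 8 * k₀ ≤⟨ +-mono-≤ (*-monoʳ-≤ 3 64B²≤n) 8k₀≤n ⟩
            3 * n + n ≡⟨ e₃ n ⟩
            4 * n ∎)
          2k₀≤ : 2 * k₀ ≤ B * (64 * B)
          2k₀≤ = *-cancelˡ-≤ 4 (begin
            4 * (2 * k₀) ≡⟨ e₄ k₀ ⟩
            8 * k₀ ≤⟨ 8k₀≤n ⟩
            n ≤⟨ n≤256B² ⟩
            256 * (B * B) ≡⟨ e₅ B ⟩
            4 * (B * (64 * B)) ∎)
          expo : 4 * E + 2 * (64 * B) ≤ 32 * suc (5 * B)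
          expo = ≤-trans (+-monoˡ-≤ (2 * (64 * B)) (*-monoʳ-≤ 4 E≤B)) (≤-trans (m≤m+n _ (28 * B + 32)) (≤-reflexive (sym (e₆ B))))

      room-5B : ∀ k → k ≤ 5 * B → 4 * k < n × 48 * (B * B) + 2 * k ≤ n
      room-5B k k≤ = ≤-trans (s≤s (≤-trans (*-monoʳ-≤ 4 k≤) (≤-reflexive (e₁ B)))) (≤-trans (+-mono-≤ (≤-trans 1≤B B≤B²) (*-monoʳ-≤ 20 B≤B²)) (≤-trans (*-monoˡ-≤ (B * B) (m≤m+n 21 43)) 64B²≤n))
          , ≤-trans (+-monoʳ-≤ (48 * (B * B)) (≤-trans (*-monoʳ-≤ 2 k≤) (≤-trans (≤-reflexive (e₂ B)) (*-monoʳ-≤ 10 B≤B²))))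
            (≤-trans (≤-reflexive (e₃ (B * B))) (≤-trans (*-monoˡ-≤ (B * B) (m≤m+n 58 6)) 64B²≤n))
        where
          e₁ : ∀ B → 4 * (5 * B) ≡ 20 * B
          e₁ = solve-∀
          e₂ : ∀ B → 2 * (5 * B) ≡ 10 * B
          e₂ = solve-∀
          e₃ : ∀ b → 48 * b + 10 * b ≡ 58 * b
          e₃ = solve-∀

      -- For k = 5 B the moment excess is the constant 4^10, and sets with more than `E` elements
      -- gain 2^(32 E + 32), enough for `c` as well.
      tail₂ : ∀ F y → y ∈ Perms → F ⊆ S y → ∣ F ∣ ≤ 5 * B → c * tail a E F ≤ n !
      tail₂ = tail-small (5 * B) E 10 (proj₁ (room-5B (5 * B) ≤-refl)) (proj₂ (room-5B (5 * B) ≤-refl)) (≤-reflexive (e₁ B))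
          (≤-trans (m≤m+n _ (28 * E + 12)) (≤-reflexive (sym (e₂ E))))
        where
          e₁ : ∀ B → 2 * (5 * B) ≡ B * 10
          e₁ = solve-∀
          e₂ : ∀ E → 32 * suc E ≡ 4 * E + 20 + (28 * E + 12)
          e₂ = solve-∀

      -- Bernoulli bounds (1 + 1/B)^(2E) by (B + 1) / (B + 1 - 2E), and `B-large` makes this at most
      -- 1 + 1/c. Removing the share of T = ∅ leaves at most 1/c; the term `c * (d * n !)` is added
      -- on both sides to avoid subtraction.
      tail₃ : ∀ F y → y ∈ Perms → F ⊆ S y → ∣ F ∣ ≤ E → c * tail a 0 F ≤ n !
      tail₃ F y y∈ F⊆ F≤E = *-cancelˡ-≤ d {{>-nonZero d>0}} (+-cancelʳ-≤ (c * (d * n !)) _ _ (begin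
          d * (c * t) + c * (d * n !) ≡⟨ e₁ d c t (n !) ⟩
          c * (d * (t + n !)) ≤⟨ *-monoʳ-≤ c core ⟩
          c * (suc B * n !) ≡⟨ sym (*-assoc c (suc B) (n !)) ⟩
          c * suc B * n ! ≤⟨ *-monoˡ-≤ (n !) budget ⟩
          (c + 1) * d * n ! ≡⟨ e₂ c d (n !) ⟩
          d * n ! + c * (d * n !) ∎))
        where
          open ≤-Reasoning
          t = tail a 0 F
          j = 2 * E
          d = suc B ∸ j
          j≤B : j ≤ B
          j≤B = ≤-trans (m≤n*m (2 * E) (4 * E + 1) {{>-nonZero (m≤n+m 1 (4 * E))}}) B-large
          jd : j + d ≡ suc B
          jd = m+[n∸m]≡n (≤-trans j≤B (n≤1+n B))
          d>0 : 0 < d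
          d>0 = m<n⇒0<n∸m (s≤s j≤B)
          e₁ : ∀ d c t q → d * (c * t) + c * (d * q) ≡ c * (d * (t + q))
          e₁ = solve-∀
          e₂ : ∀ c d q → (c + 1) * d * q ≡ d * q + c * (d * q)
          e₂ = solve-∀
          e₃ : ∀ c s → s + c * s ≡ (c + 1) * s
          e₃ = solve-∀
          e₄ : ∀ d p q → p * (d * q) ≡ d * (p * q)
          e₄ = solve-∀
          e₅ : ∀ d p q → d * (p * q) ≡ p * d * q
          e₅ = solve-∀
          budget : c * suc B ≤ (c + 1) * d
          budget = +-cancelˡ-≤ ((c + 1) * j) _ _ (begin
            (c + 1) * j + c * suc B ≤⟨ +-monoˡ-≤ (c * suc B) (≤-trans B-large (n≤1+n B)) ⟩
            suc B + c * suc B ≡⟨ e₃ c (suc B) ⟩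
            (c + 1) * suc B ≡⟨ cong ((c + 1) *_) (sym jd) ⟩
            (c + 1) * (j + d) ≡⟨ *-distribˡ-+ (c + 1) j d ⟩
            (c + 1) * j + (c + 1) * d ∎)
          -- The base `1 + a` given by `tail-zero` is raised to `B`, for which the estimate by
          -- exposure is available.
          moment : t + n ! ≤ expMoment B F
          moment = ≤-trans (≤-reflexive (cong (t +_) (sym length-Perms))) (≤-trans (tail-zero a F)
            (∑-mono Perms (λ π → ^-monoˡ-≤ ∣ F ∩ S π ∣ (s≤s (m≤n*m a x {{>-nonZero 1≤x}})))))
          room = room-5B E (≤-trans E≤B (m≤n*m B 5))
          core : d * (t + n !) ≤ suc B * n !
          core = *-cancelˡ-≤ (B ^ j) {{m^n≢0 B j}} (begin
            B ^ j * (d * (t + n !)) ≡⟨ e₄ d (B ^ j) (t + n !) ⟩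
            d * (B ^ j * (t + n !)) ≤⟨ *-monoʳ-≤ d (≤-trans (*-monoʳ-≤ (B ^ j) moment) (expMoment-small E F y y∈ F⊆ F≤E (proj₁ room) (proj₂ room))) ⟩
            d * (suc B ^ j * n !) ≡⟨ e₅ d (suc B ^ j) (n !) ⟩
            suc B ^ j * d * n ! ≤⟨ *-monoˡ-≤ (n !) (bernoulli B j d jd) ⟩
            B ^ j * suc B * n ! ≡⟨ *-assoc (B ^ j) (suc B) (n !) ⟩
            B ^ j * (suc B * n !) ∎)

    -- After division by E A⁴ this says that the union of four random sets contains a square with
    -- probability at least 1 - 1/E. Before any exposure all n! permutations are good for k = M; at
    -- the end a single permutation good for k = 0 already forces a square inside V, so the number
    -- of good ones is at most `n ! * ind V`.
    four-rounds : ∀ (ind : Subset M → ℕ) → (∀ V y → y ∈ Perms → S y ⊆ V → ind V ≡ 1) → let A = (1 + a′) ^ M in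
      E * (A * (A * (A * (A * 1)))) ≤ E * wsum∪ a′ (wsum∪ a′ (wsum∪ a′ (wsum∪ a′ ind))) Subset.⊥ + A * (A * (A * (A * 1)))
    four-rounds ind ind≡1 = *-cancelˡ-≤ (4 * n !) {{m*n≢0 4 (n !)}} (begin
        4 * n ! * (E * A⁴) ≡⟨ e₁ (n !) E A⁴ ⟩
        A⁴ * (c * n !) ≡⟨ cong (λ z → A⁴ * (c * z)) (sym good-start) ⟩
        A⁴ * f M Subset.⊥ ≤⟨ chain Subset.⊥ ⟩
        wsum∪ a′ (wsum∪ a′ (wsum∪ a′ (wsum∪ a′ G))) Subset.⊥ + A⁴ * (n ! + (n ! + (n ! + (n ! + 0))))
          ≡⟨ cong (_+ A⁴ * (n ! + (n ! + (n ! + (n ! + 0))))) (pull (wsum∪ a′ (wsum∪ a′ (wsum∪ a′ G))) (wsum∪ a′ (wsum∪ a′ (wsum∪ a′ ind)))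
               (pull (wsum∪ a′ (wsum∪ a′ G)) (wsum∪ a′ (wsum∪ a′ ind)) (pull (wsum∪ a′ G) (wsum∪ a′ ind) (pull G ind (λ _ → refl)))) Subset.⊥) ⟩
        c * n ! * w + A⁴ * (n ! + (n ! + (n ! + (n ! + 0)))) ≡⟨ e₂ (n !) E w A⁴ ⟩
        4 * n ! * (E * w + A⁴) ∎)
      where
        open ≤-Reasoning
        A = (1 + a′) ^ M
        A⁴ = A * (A * (A * (A * 1)))
        w = wsum∪ a′ (wsum∪ a′ (wsum∪ a′ (wsum∪ a′ ind))) Subset.⊥
        e₁ : ∀ q E A → 4 * q * (E * A) ≡ A * (4 * E * q)
        e₁ = solve-∀
        e₂ : ∀ q E w A → 4 * E * q * w + A * (q + (q + (q + (q + 0)))) ≡ 4 * q * (E * w + A)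
        e₂ = solve-∀
        f : ℕ → Subset M → ℕ
        f k V = c * good k V
        G : Subset M → ℕ
        G V = c * n ! * ind V
        pull : ∀ (f g : Subset M → ℕ) → (∀ V → f V ≡ c * n ! * g V) → ∀ V → wsum∪ a′ f V ≡ c * n ! * wsum∪ a′ g V
        pull f g h V = trans (wsum-cong a′ (λ W → h (V ∪ W))) (wsum-*ˡ a′ (c * n !) (λ W → g (V ∪ W)))
        good-start : good M Subset.⊥ ≡ n !
        good-start = trans (≤-antisym (∑-mono Perms (λ x → ⟦⟧≤1 (good? M Subset.⊥ x)))
            (∑-mono-∈ Perms (λ {x} x∈ → ≤-reflexive (sym (⟦⟧-true (good? M Subset.⊥ x) (lose x∈ ((λ {t} → p─q⊆p (S x) Subset.⊥ {t}) , ∣p∣≤n (S x ─ Subset.⊥))))))))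
          (∑-inj-1 n [] [] (+-identityʳ n))
        good-end : ∀ V → f 0 V ≤ G V
        good-end V with Any.any? (λ x → good? 0 V x) Perms
        ... | no none = ≤-trans (≤-reflexive (trans (cong (c *_) none-good) (*-zeroʳ c))) z≤n
          where
            none-good : good 0 V ≡ 0
            none-good = ≤-antisym (≤-trans (∑-mono-∈ Perms (λ {x} x∈ → ≤-reflexive (⟦⟧-false (good? 0 V x) (λ g → none (lose x∈ g))))) (≤-reflexive (trans (∑-const Perms 0) (*-zeroʳ (length Perms))))) z≤n
        ... | yes any with find any
        ... | x , _ , g with find g
        ... | y , y∈ , (_ , ≤0) = ≤-trans (*-monoʳ-≤ c (≤-trans (∑-mono Perms (λ x → ⟦⟧≤1 (good? 0 V x))) (≤-reflexive (∑-inj-1 n [] [] (+-identityʳ n)))))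
            (≤-reflexive (sym (trans (cong (c * n ! *_) (ind≡1 V y y∈ Sy⊆V)) (*-identityʳ (c * n !)))))
          where
            Sy⊆V : S y ⊆ V
            Sy⊆V {t} t∈ with t ∈ₛ? V
            ... | yes t∈V = t∈V
            ... | no t∉V = ⊥-elim (<⇒≱ (pos (S y ─ V) (x∈p∧x∉q⇒x∈p─q t∈ t∉V)) ≤0)
              where
                pos : ∀ {m} (p : Subset m) {t} → t ∈ₛ p → 0 < ∣ p ∣
                pos (true ∷ p) _ = s≤s z≤n
                pos (false ∷ p) (Vec.there t∈) = pos p t∈
        -- The empty chain of rounds: normalising factor 1 and error 0, which explains the trailing
        -- 1 in A⁴ and the trailing 0 in the sum of errors.
        stage₄ : ∀ V → 1 * f 0 V ≤ G V + 1 * 0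
        stage₄ V = ≤-trans (≤-reflexive (+-identityʳ (f 0 V))) (≤-trans (good-end V) (m≤m+n (G V) 0))
        chain : ∀ V → A⁴ * f M V ≤ wsum∪ a′ (wsum∪ a′ (wsum∪ a′ (wsum∪ a′ G))) V + A⁴ * (n ! + (n ! + (n ! + (n ! + 0))))
        chain = sprinkle a′ (n !) _ _ (f M) (f k₀) _ (λ V → round V M k₀ a′ c (n !) tail₀)
          (sprinkle a′ (n !) _ _ (f k₀) (f (5 * B)) _ (λ V → round V k₀ (5 * B) a′ c (n !) tail₁)
          (sprinkle a′ (n !) _ _ (f (5 * B)) (f E) _ (λ V → round V (5 * B) E a′ c (n !) tail₂)
          (sprinkle a′ (n !) _ _ (f E) (f 0) _ (λ V → round V E 0 a′ c (n !) tail₃) stage₄)))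

  -- From edge sets back to graphs

  contains-square : ∀ {n} (3≤n : 3 ≤ n) (let open Cycle n 3≤n) → ∀ V y → y ∈ Perms → S y ⊆ V → ContainsSquareHamCycle n V
  contains-square {n} 3≤n V y y∈ S⊆V = 3≤n , σ , vertexAt-injective y y∈ , λ i → edge i 1 (s≤s z≤n) 2≤n inj₁ , edge i 2 (s≤s z≤n) 3≤n inj₂
    where
      open Cycle n 3≤n
      -- `y` sends vertices to positions, whereas a Hamilton cycle is given by the vertex at each
      -- position; hence the inverse.
      σ = vertexAt y y∈
      instance
        n≢0 : NonZero n
        n≢0 = >-nonZero 1≤n
      index : ∀ {u v} → toℕ u < toℕ v → lookup y u ~ lookup y v → ∃ λ k → List.lookup (pairs n) k ≡ (u , v) × lookup V k ≡ true
      index u<v adj = Any.index uv∈ , sym (lookup-index uv∈) , []=⇒lookup (S⊆V (∈-S⁺ y (subst (EdgeAdj y) (lookup-index uv∈) adj)))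
        where uv∈ = ∈-pairs⁺ u<v
      edge : ∀ i c → 0 < c → c < n → (∀ {j k : Fin n} → k ≡ shift c j → k ≡ shift 1 j ⊎ k ≡ shift 2 j) → Adj V (σ i) (σ (shift c i))
      edge i c 0<c c<n hop with <-cmp (toℕ (σ i)) (toℕ (σ (shift c i)))
      ... | tri< lt _ _ = let k , e , t = index lt (inj₁ step) in k , inj₁ e , t
        where step = hop (trans (lookup-vertexAt y y∈ (shift c i)) (cong (shift c) (sym (lookup-vertexAt y y∈ i))))
      ... | tri> _ _ gt = let k , e , t = index gt (inj₂ step) in k , inj₂ e , t
        where step = hop (trans (lookup-vertexAt y y∈ (shift c i)) (cong (shift c) (sym (lookup-vertexAt y y∈ i))))
      ... | tri≈ _ eq _ = ⊥-elim (shift-≢ c i 0<c c<n (sym (vertexAt-injective y y∈ (toℕ-injective eq))))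

  contains-mono : ∀ {n} {V W : Graph n} → V ⊆ W → ContainsSquareHamCycle n V → ContainsSquareHamCycle n W
  contains-mono {n} {V} {W} V⊆W (3≤n , σ , σ-inj , edges) = 3≤n , σ , σ-inj , λ i → adj (proj₁ (edges i)) , adj (proj₂ (edges i))
    where
      adj : ∀ {u v} → Adj V u v → Adj W u v
      adj (k , e , t) = k , e , []=⇒lookup (V⊆W (lookup⇒[]= k V t))

  -- Choosing the density

  crossing : ∀ (f : ℕ → ℕ) n b → f 0 ≤ n → n < f b → ∃ λ a → f a ≤ n × n < f (suc a)
  crossing f n zero f0≤ n<f = ⊥-elim (<⇒≱ n<f f0≤)
  crossing f n (suc b) f0≤ n<f with n <? f b
  ... | yes n<fb = crossing f n b f0≤ n<fb
  ... | no ≮ = b , ≮⇒≥ ≮ , n<f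

  -- 2^32 = 16^8: a fragment of n/8 edges contributes 16^n, which beats the 8^n of expMoment-crude.
  abstract
    boost : ℕ
    boost = 2 ^ 32

    boost≡2^32 : boost ≡ 2 ^ 32
    boost≡2^32 = refl

  -- Beyond this size the chosen `a′` is at least (4E + 1)(2E), which yields `B-large`; the summand
  -- 3 yields `3 ≤ n`.
  threshold : ℕ → ℕ
  threshold E = 3 + 64 * (base boost ((4 * E + 1) * (2 * E)) * base boost ((4 * E + 1) * (2 * E)))

  record Scale (n E : ℕ) : Set where
    field
      a′ : ℕ
      64B²≤n : 64 * (base boost a′ * base boost a′) ≤ n
      n≤256B² : n ≤ 256 * (base boost a′ * base boost a′)
      B-large : (4 * E + 1) * (2 * E) ≤ base boost a′
      √n≤ : n ≤ (24 * boost * (1 + a′)) * (24 * boost * (1 + a′))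

  -- Take `a′` where 64 B² crosses `n`. The next base exceeds B by `boost` ≤ B, so B at most doubles
  -- and n ≤ 64 (2B)² = 256 B². The next base is also at most 3 `boost` (1 + a′), and 64 · 3² = 24².
  scale : ∀ n E → threshold E ≤ n → Scale n E
  scale n E large = record
    { a′ = a′ ; 64B²≤n = lower ; n≤256B² = n≤256B² ; B-large = ≤-trans D≤a′ a′≤B ; √n≤ = √n≤ }
    where
      open ≤-Reasoning
      D = (4 * E + 1) * (2 * E)
      f : ℕ → ℕ
      f a = 64 * (base boost a * base boost a)
      1≤boost : 1 ≤ boost
      1≤boost = ≤-trans (m^n>0 2 32) (≤-reflexive (sym boost≡2^32))
      instance _ = >-nonZero 1≤boost
      base-mono : ∀ {a b} → a ≤ b → base boost a ≤ base boost b
      base-mono le = s≤s (*-monoʳ-≤ boost (s≤s le))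
      f-mono : ∀ {a b} → a ≤ b → f a ≤ f b
      f-mono le = *-monoʳ-≤ 64 (*-mono-≤ (base-mono le) (base-mono le))
      a≤base : ∀ a → a ≤ base boost a
      a≤base a = ≤-trans (n≤1+n a) (≤-trans (m≤n*m (1 + a) boost) (n≤1+n _))
      n<fn : n < f n
      n<fn = ≤-trans (s≤s (m≤n*m n boost)) (≤-trans (s≤s (*-monoʳ-≤ boost (n≤1+n n))) (≤-trans (m≤m*n (base boost n) (base boost n)) (m≤n*m (base boost n * base boost n) 64)))
      found = crossing f n n (≤-trans (f-mono z≤n) (≤-trans (m≤n+m (f D) 3) large)) n<fn
      a′ = proj₁ found
      lower : f a′ ≤ n
      lower = proj₁ (proj₂ found)
      upper : n < f (suc a′)
      upper = proj₂ (proj₂ found)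
      D≤a′ : D ≤ a′
      D≤a′ = ≮⇒≥ (λ lt → <⇒≱ upper (≤-trans (f-mono lt) (≤-trans (m≤n+m (f D) 3) large)))
      a′≤B : a′ ≤ base boost a′
      a′≤B = a≤base a′
      e₁ : ∀ x a → 1 + x * (2 + a) ≡ (1 + x * (1 + a)) + x
      e₁ = solve-∀
      next≤2B : base boost (suc a′) ≤ 2 * base boost a′
      next≤2B = begin
        base boost (suc a′) ≡⟨ e₁ boost a′ ⟩
        base boost a′ + boost ≤⟨ +-monoʳ-≤ (base boost a′) (≤-trans (m≤m*n boost (1 + a′)) (n≤1+n _)) ⟩
        base boost a′ + base boost a′ ≡⟨ cong (base boost a′ +_) (sym (+-identityʳ (base boost a′))) ⟩
        2 * base boost a′ ∎
      e₂ : ∀ b → 64 * (2 * b * (2 * b)) ≡ 256 * (b * b)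
      e₂ = solve-∀
      n≤256B² : n ≤ 256 * (base boost a′ * base boost a′)
      n≤256B² = ≤-trans (<⇒≤ upper) (≤-trans (*-monoʳ-≤ 64 (*-mono-≤ next≤2B next≤2B)) (≤-reflexive (e₂ (base boost a′))))
      y = boost * (1 + a′)
      next≤3y : base boost (suc a′) ≤ 3 * y
      next≤3y = begin
        base boost (suc a′) ≡⟨ e₁ boost a′ ⟩
        1 + y + boost ≤⟨ +-mono-≤ (+-monoˡ-≤ y (≤-trans 1≤boost boost≤y)) boost≤y ⟩
        y + y + y ≡⟨ e₃ y ⟩
        3 * y ∎
        where
          boost≤y : boost ≤ y
          boost≤y = m≤m*n boost (1 + a′)
          e₃ : ∀ y → y + y + y ≡ 3 * y
          e₃ = solve-∀
      e₄ : ∀ x a → 64 * (3 * (x * a) * (3 * (x * a))) ≡ (24 * x * a) * (24 * x * a)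
      e₄ = solve-∀
      √n≤ : n ≤ (24 * boost * (1 + a′)) * (24 * boost * (1 + a′))
      √n≤ = ≤-trans (<⇒≤ upper) (≤-trans (*-monoʳ-≤ 64 (*-mono-≤ next≤3y next≤3y)) (≤-reflexive (e₄ boost (1 + a′))))

open Combinatorics
open import Data.Nat using (ℕ)
import Data.Nat
open import Data.Product using (Σ; _×_)
open import Data.Rational using (ℚ; 0ℚ; 1ℚ; _≤_; _<_; _*_; _-_)
open import Relation.Nullary using (Dec)

open import Data.Bool using (Bool; true; false; if_then_else_)
open import Data.Nat as ℕ using (zero; suc)
import Data.Nat.Properties as ℕ
open import Data.Fin.Subset using (Subset; _∪_; _⊆_)
import Data.Fin.Subset as Subset
open import Data.Fin.Subset.Properties using (⊆-refl; s⊆s; out⊆; x∈p∪q⁻; x∈p∪q⁺; ∪-assoc; ∪-identityˡ)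
open import Data.Vec using ([]; _∷_)
open import Data.List as List using (List; []; _∷_)
open import Data.Integer as ℤ using (+_; +[1+_]; -[1+_])
import Data.Integer.Properties as ℤ
import Data.Rational.Unnormalised as ℚᵘ
import Data.Rational.Unnormalised.Properties as ℚᵘ
open import Data.Rational using (mkℚ; *<*; toℚᵘ; _+_; -_; 1/_; _≟_; NonZero; positive; nonNegative)
open import Data.Rational.Properties
open import Data.Product using (∃; _,_; proj₁; proj₂)
open import Data.Sum as Sum using ()
open import Function using (_∘_)
open import Level using (0ℓ)
open import Relation.Nullary using (yes; no; does)
open import Relation.Nullary.Decidable using (dec⇒maybe)
open import Relation.Binary.PropositionalEquality using (_≡_; refl; sym; trans; cong; cong₂; module ≡-Reasoning)
open import Tactic.RingSolver using (solve-∀)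
open import Tactic.RingSolver.Core.AlmostCommutativeRing using (AlmostCommutativeRing; fromCommutativeRing)

-- Rational arithmetic

ring : AlmostCommutativeRing 0ℓ 0ℓ
ring = fromCommutativeRing +-*-commutativeRing (λ x → dec⇒maybe (0ℚ ≟ x))

toℚᵘ-ℕ : ∀ n → toℚᵘ (ℕtoℚ n) ℚᵘ.≃ ℚᵘ.mkℚᵘ (+ n) 0
toℚᵘ-ℕ n = toℚᵘ-fromℚᵘ (ℚᵘ.mkℚᵘ (+ n) 0)

ℕtoℚ-+ : ∀ m n → ℕtoℚ (m ℕ.+ n) ≡ ℕtoℚ m + ℕtoℚ n
ℕtoℚ-+ m n = toℚᵘ-injective (ℚᵘ.≃-trans (toℚᵘ-ℕ (m ℕ.+ n)) (ℚᵘ.≃-sym (ℚᵘ.≃-trans (toℚᵘ-homo-+ (ℕtoℚ m) (ℕtoℚ n))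
  (ℚᵘ.≃-trans (ℚᵘ.+-cong (toℚᵘ-ℕ m) (toℚᵘ-ℕ n)) (ℚᵘ.*≡* (cong (ℤ._* ℤ.1ℤ) (cong₂ ℤ._+_ (ℤ.*-identityʳ (+ m)) (ℤ.*-identityʳ (+ n)))))))))

ℕtoℚ-* : ∀ m n → ℕtoℚ (m ℕ.* n) ≡ ℕtoℚ m * ℕtoℚ n
ℕtoℚ-* m n = toℚᵘ-injective (ℚᵘ.≃-trans (toℚᵘ-ℕ (m ℕ.* n)) (ℚᵘ.≃-sym (ℚᵘ.≃-trans (toℚᵘ-homo-* (ℕtoℚ m) (ℕtoℚ n))
  (ℚᵘ.≃-trans (ℚᵘ.*-cong (toℚᵘ-ℕ m) (toℚᵘ-ℕ n)) (ℚᵘ.*≡* (cong (ℤ._* ℤ.1ℤ) (sym (ℤ.pos-* m n))))))))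

ℕtoℚ-mono : ∀ {m n} → m ℕ.≤ n → ℕtoℚ m ≤ ℕtoℚ n
ℕtoℚ-mono {m} {n} m≤n = toℚᵘ-cancel-≤ (ℚᵘ.≤-respˡ-≃ (ℚᵘ.≃-sym (toℚᵘ-ℕ m)) (ℚᵘ.≤-respʳ-≃ (ℚᵘ.≃-sym (toℚᵘ-ℕ n))
  (ℚᵘ.*≤* (ℤ.*-monoʳ-≤-nonNeg (+ 1) (ℤ.+≤+ m≤n)))))

0≤ℕtoℚ : ∀ n → 0ℚ ≤ ℕtoℚ n
0≤ℕtoℚ n = ℕtoℚ-mono {0} {n} ℕ.z≤n

0<ℕtoℚ : ∀ n → .{{ℕ.NonZero n}} → 0ℚ < ℕtoℚ n
0<ℕtoℚ n = <-≤-trans (*<* (ℤ.+<+ (ℕ.s≤s ℕ.z≤n))) (ℕtoℚ-mono {1} {n} (ℕ.>-nonZero⁻¹ n))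

-- The denominator of ε serves as E, because a positive numerator is at least 1.
archimedes : ∀ ε → 0ℚ < ε → ∃ λ E → 1 ℕ.≤ E × 1ℚ ≤ ℕtoℚ E * ε
archimedes ε@(mkℚ +[1+ k ] d _) _ = suc d , ℕ.s≤s ℕ.z≤n , toℚᵘ-cancel-≤ (ℚᵘ.≤-respʳ-≃
    (ℚᵘ.≃-sym (ℚᵘ.≃-trans (toℚᵘ-homo-* (ℕtoℚ (suc d)) ε) (ℚᵘ.*-cong (toℚᵘ-ℕ (suc d)) ℚᵘ.≃-refl)))
    (ℚᵘ.*≤* (ℤ.+≤+ le)))
  where
    le : 1 ℕ.* suc (d ℕ.+ 0) ℕ.≤ suc (k ℕ.+ d ℕ.* suc k) ℕ.* 1
    le rewrite ℕ.+-identityʳ d | ℕ.+-identityʳ d | ℕ.*-identityʳ (k ℕ.+ d ℕ.* suc k) =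
      ℕ.s≤s (ℕ.≤-trans (ℕ.m≤m*n d (suc k)) (ℕ.m≤n+m (d ℕ.* suc k) k))
archimedes (mkℚ (+ 0) d _) (*<* (ℤ.+<+ ()))
archimedes (mkℚ (-[1+ k ]) d _) (*<* ())

*-monoˡ : ∀ {r p q} → 0ℚ ≤ r → p ≤ q → r * p ≤ r * q
*-monoˡ {r} 0≤r = *-monoˡ-≤-nonNeg r {{nonNegative 0≤r}}

0≤* : ∀ {p q} → 0ℚ ≤ p → 0ℚ ≤ q → 0ℚ ≤ p * q
0≤* {p} 0≤p 0≤q = ≤-trans (≤-reflexive (sym (*-zeroʳ p))) (*-monoˡ 0≤p 0≤q)

0≤q-p : ∀ {p q} → p ≤ q → 0ℚ ≤ q - p
0≤q-p {p} {q} p≤q = ≤-trans (≤-reflexive (sym (+-inverseʳ p))) (+-monoˡ-≤ (- p) p≤q)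

-- Expectations over random sets of rational density

mix : ℚ → ℚ → ℚ → ℚ
mix p t f = p * t + (1ℚ - p) * f

mix-mono : ∀ {p t t′ f f′} → 0ℚ ≤ p → p ≤ 1ℚ → t ≤ t′ → f ≤ f′ → mix p t f ≤ mix p t′ f′
mix-mono 0≤p p≤1 t≤ f≤ = +-mono-≤ (*-monoˡ 0≤p t≤) (*-monoˡ (0≤q-p p≤1) f≤)

mix-monoᵖ : ∀ {p q t f} → p ≤ q → f ≤ t → mix p t f ≤ mix q t f
mix-monoᵖ {p} {q} {t} {f} p≤q f≤t = ≤-trans (≤-reflexive (sym (+-identityʳ (mix p t f))))
    (≤-trans (+-monoʳ-≤ (mix p t f) (0≤* (0≤q-p p≤q) (0≤q-p f≤t))) (≤-reflexive (eq p q t f)))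
  where
    eq : ∀ p q t f → (p * t + (1ℚ - p) * f) + (q - p) * (t - f) ≡ q * t + (1ℚ - q) * f
    eq = solve-∀ ring

𝔼 : ∀ {m} → ℚ → (Subset m → ℚ) → ℚ
𝔼 {zero} p f = f []
𝔼 {suc m} p f = mix p (𝔼 p (f ∘ (true ∷_))) (𝔼 p (f ∘ (false ∷_)))

𝔼-cong : ∀ {m} p {f g : Subset m → ℚ} → (∀ W → f W ≡ g W) → 𝔼 p f ≡ 𝔼 p g
𝔼-cong {zero} p h = h []
𝔼-cong {suc m} p h = cong₂ (mix p) (𝔼-cong p (λ W → h (true ∷ W))) (𝔼-cong p (λ W → h (false ∷ W)))

𝔼-mono : ∀ {m p} {f g : Subset m → ℚ} → 0ℚ ≤ p → p ≤ 1ℚ → (∀ W → f W ≤ g W) → 𝔼 p f ≤ 𝔼 p g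
𝔼-mono {zero} 0≤p p≤1 h = h []
𝔼-mono {suc m} 0≤p p≤1 h = mix-mono 0≤p p≤1 (𝔼-mono 0≤p p≤1 (λ W → h (true ∷ W))) (𝔼-mono 0≤p p≤1 (λ W → h (false ∷ W)))

𝔼-linear : ∀ {m} p r s (f g : Subset m → ℚ) → 𝔼 p (λ W → r * f W + s * g W) ≡ r * 𝔼 p f + s * 𝔼 p g
𝔼-linear {zero} p r s f g = refl
𝔼-linear {suc m} p r s f g = trans (cong₂ (mix p) (𝔼-linear p r s (f ∘ (true ∷_)) (g ∘ (true ∷_))) (𝔼-linear p r s (f ∘ (false ∷_)) (g ∘ (false ∷_))))
    (eq p r s (𝔼 p (f ∘ (true ∷_))) (𝔼 p (g ∘ (true ∷_))) (𝔼 p (f ∘ (false ∷_))) (𝔼 p (g ∘ (false ∷_))))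
  where
    eq : ∀ p r s a b c d → p * (r * a + s * b) + (1ℚ - p) * (r * c + s * d) ≡ r * (p * a + (1ℚ - p) * c) + s * (p * b + (1ℚ - p) * d)
    eq = solve-∀ ring

𝔼-*ˡ : ∀ {m} p r (f : Subset m → ℚ) → 𝔼 p (λ W → r * f W) ≡ r * 𝔼 p f
𝔼-*ˡ {zero} p r f = refl
𝔼-*ˡ {suc m} p r f = trans (cong₂ (mix p) (𝔼-*ˡ p r (f ∘ (true ∷_))) (𝔼-*ˡ p r (f ∘ (false ∷_))))
    (eq p r (𝔼 p (f ∘ (true ∷_))) (𝔼 p (f ∘ (false ∷_))))
  where
    eq : ∀ p r a c → p * (r * a) + (1ℚ - p) * (r * c) ≡ r * (p * a + (1ℚ - p) * c)
    eq = solve-∀ ring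

Increasing : ∀ {m} → (Subset m → ℚ) → Set
Increasing f = ∀ {V W} → V ⊆ W → f V ≤ f W

Increasing-∷ : ∀ {m} {f : Subset (suc m) → ℚ} b → Increasing f → Increasing (f ∘ (b ∷_))
Increasing-∷ b inc V⊆W = inc (s⊆s V⊆W)

𝔼-false≤true : ∀ {m p} {f : Subset (suc m) → ℚ} → 0ℚ ≤ p → p ≤ 1ℚ → Increasing f → 𝔼 p (f ∘ (false ∷_)) ≤ 𝔼 p (f ∘ (true ∷_))
𝔼-false≤true {m} 0≤p p≤1 inc = 𝔼-mono {m} 0≤p p≤1 (λ W → inc (out⊆ {p = W} ⊆-refl))

-- Raising the density shifts weight in each coordinate from the `false` branch to the `true`
-- branch, where an increasing function is larger on average.
𝔼-monoᵖ : ∀ {m p q} {f : Subset m → ℚ} → 0ℚ ≤ p → p ≤ q → q ≤ 1ℚ → Increasing f → 𝔼 p f ≤ 𝔼 q f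
𝔼-monoᵖ {zero} 0≤p p≤q q≤1 inc = ≤-refl
𝔼-monoᵖ {suc m} {f = f} 0≤p p≤q q≤1 inc = ≤-trans
  (mix-mono 0≤p (≤-trans p≤q q≤1) (𝔼-monoᵖ 0≤p p≤q q≤1 (Increasing-∷ {f = f} true inc)) (𝔼-monoᵖ 0≤p p≤q q≤1 (Increasing-∷ {f = f} false inc)))
  (mix-monoᵖ p≤q (𝔼-false≤true {f = f} (≤-trans 0≤p p≤q) q≤1 inc))

-- In each coordinate the union of two independent sets has density p + q - p q ≤ p + q, and an
-- increasing function can only profit from the larger density.
𝔼-union : ∀ {m p q} {f : Subset m → ℚ} → 0ℚ ≤ p → 0ℚ ≤ q → p + q ≤ 1ℚ → Increasing f →
  𝔼 p (λ W → 𝔼 q (λ W′ → f (W ∪ W′))) ≤ 𝔼 (p + q) f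
𝔼-union {zero} _ _ _ _ = ≤-refl
𝔼-union {suc m} {p} {q} {f} 0≤p 0≤q p+q≤1 inc = ≤-trans (≤-reflexive split)
    (≤-trans (mix-mono 0≤s s≤1 (𝔼-union 0≤p 0≤q p+q≤1 (Increasing-∷ {f = f} true inc)) (𝔼-union 0≤p 0≤q p+q≤1 (Increasing-∷ {f = f} false inc)))
      (mix-monoᵖ s≤p+q (𝔼-false≤true {f = f} 0≤p+q p+q≤1 inc)))
  where
    s = p + q - p * q
    D : Bool → ℚ
    D b = 𝔼 p (λ W → 𝔼 q (λ W′ → f (b ∷ (W ∪ W′))))
    0≤p+q : 0ℚ ≤ p + q
    0≤p+q = +-mono-≤ 0≤p 0≤q
    p≤1 : p ≤ 1ℚ
    p≤1 = ≤-trans (≤-trans (≤-reflexive (sym (+-identityʳ p))) (+-monoʳ-≤ p 0≤q)) p+q≤1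
    s≡ : ∀ p q → p + q * (1ℚ - p) ≡ p + q - p * q
    s≡ = solve-∀ ring
    0≤s : 0ℚ ≤ s
    0≤s = ≤-trans (+-mono-≤ 0≤p (0≤* 0≤q (0≤q-p p≤1))) (≤-reflexive (s≡ p q))
    s≤p+q : s ≤ p + q
    s≤p+q = ≤-trans (+-monoʳ-≤ (p + q) (neg-antimono-≤ (0≤* 0≤p 0≤q))) (≤-reflexive (+-identityʳ (p + q)))
    s≤1 : s ≤ 1ℚ
    s≤1 = ≤-trans s≤p+q p+q≤1
    eq : ∀ p q t f → p * (q * t + (1ℚ - q) * t) + (1ℚ - p) * (q * t + (1ℚ - q) * f) ≡ (p + q - p * q) * t + (1ℚ - (p + q - p * q)) * f
    eq = solve-∀ ring
    split : 𝔼 p (λ W → 𝔼 q (λ W′ → f (W ∪ W′))) ≡ mix s (D true) (D false)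
    split = trans (cong₂ (mix p)
        (𝔼-linear p q (1ℚ - q) (λ W → 𝔼 q (λ W′ → f (true ∷ (W ∪ W′)))) (λ W → 𝔼 q (λ W′ → f (true ∷ (W ∪ W′)))))
        (𝔼-linear p q (1ℚ - q) (λ W → 𝔼 q (λ W′ → f (true ∷ (W ∪ W′)))) (λ W → 𝔼 q (λ W′ → f (false ∷ (W ∪ W′))))))
      (eq p q (D true) (D false))

𝔼∪ : ∀ {m} → ℚ → (Subset m → ℚ) → Subset m → ℚ
𝔼∪ p f V = 𝔼 p (λ W → f (V ∪ W))

𝔼∪-union : ∀ {m p q} {f : Subset m → ℚ} → 0ℚ ≤ p → 0ℚ ≤ q → p + q ≤ 1ℚ → Increasing f → ∀ V → 𝔼∪ p (𝔼∪ q f) V ≤ 𝔼∪ (p + q) f V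
𝔼∪-union {m} {p} {q} {f} 0≤p 0≤q p+q≤1 inc V = ≤-trans
    (≤-reflexive (𝔼-cong {m} p (λ W → 𝔼-cong {m} q (λ W′ → cong f (∪-assoc V W W′)))))
    (𝔼-union {m} 0≤p 0≤q p+q≤1 (λ W⊆W′ → inc (∪-monoʳ W⊆W′)))
  where
    ∪-monoʳ : ∀ {W W′} → W ⊆ W′ → (V ∪ W) ⊆ (V ∪ W′)
    ∪-monoʳ {W} {W′} W⊆W′ x∈ = x∈p∪q⁺ {p = V} {q = W′} (Sum.map₂ W⊆W′ (x∈p∪q⁻ V W x∈))

𝔼-four-rounds : ∀ {m q p} {f : Subset m → ℚ} → 0ℚ ≤ q → q + (q + (q + q)) ≤ p → p ≤ 1ℚ → Increasing f →
  𝔼∪ q (𝔼∪ q (𝔼∪ q (𝔼∪ q f))) Subset.⊥ ≤ 𝔼 p f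
𝔼-four-rounds {m} {q} {p} {f} 0≤q 4q≤p p≤1 inc = begin
    𝔼∪ q (𝔼∪ q (𝔼∪ q (𝔼∪ q f))) Subset.⊥ ≤⟨ 𝔼-mono {m} 0≤q q≤1 (λ W → 𝔼-mono {m} 0≤q q≤1 (λ W′ → 𝔼∪-union {f = f} 0≤q 0≤q 2q≤1 inc ((Subset.⊥ ∪ W) ∪ W′))) ⟩
    𝔼∪ q (𝔼∪ q (𝔼∪ (q + q) f)) Subset.⊥ ≤⟨ 𝔼-mono {m} 0≤q q≤1 (λ W → 𝔼∪-union {f = f} 0≤q 0≤2q 3q≤1 inc (Subset.⊥ ∪ W)) ⟩
    𝔼∪ q (𝔼∪ (q + (q + q)) f) Subset.⊥ ≤⟨ 𝔼∪-union {f = f} 0≤q 0≤3q 4q≤1 inc Subset.⊥ ⟩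
    𝔼∪ (q + (q + (q + q))) f Subset.⊥ ≡⟨ 𝔼-cong {m} (q + (q + (q + q))) (λ W → cong f (∪-identityˡ W)) ⟩
    𝔼 (q + (q + (q + q))) f ≤⟨ 𝔼-monoᵖ {m} (+-mono-≤ 0≤q 0≤3q) 4q≤p p≤1 inc ⟩
    𝔼 p f ∎
  where
    open ≤-Reasoning
    0≤2q : 0ℚ ≤ q + q
    0≤2q = +-mono-≤ 0≤q 0≤q
    0≤3q : 0ℚ ≤ q + (q + q)
    0≤3q = +-mono-≤ 0≤q 0≤2q
    grow : ∀ {r} → r ≤ q + r
    grow {r} = ≤-trans (≤-reflexive (sym (+-identityˡ r))) (+-monoˡ-≤ r 0≤q)
    4q≤1 = ≤-trans 4q≤p p≤1
    3q≤1 = ≤-trans grow 4q≤1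
    2q≤1 = ≤-trans grow 3q≤1
    q≤1 = ≤-trans grow 2q≤1

module _ (a′ : ℕ) (q : ℚ) (q*a≡1 : q * ℕtoℚ (suc a′) ≡ 1ℚ) where

  -- With q = 1/(1 + a′), the integer weights 1 and `a′` are (1 + a′) q and (1 + a′)(1 - q), so each
  -- coordinate contributes one factor 1 + a′.
  wsum-𝔼 : ∀ {m} (f : Subset m → ℕ) → ℕtoℚ (wsum a′ f) ≡ ℕtoℚ ((1 ℕ.+ a′) ℕ.^ m) * 𝔼 q (ℕtoℚ ∘ f)
  wsum-𝔼 {zero} f = sym (*-identityˡ (ℕtoℚ (f [])))
  wsum-𝔼 {suc m} f = begin
      ℕtoℚ (wsum a′ (f ∘ (true ∷_)) ℕ.+ a′ ℕ.* wsum a′ (f ∘ (false ∷_)))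
        ≡⟨ trans (ℕtoℚ-+ (wsum a′ (f ∘ (true ∷_))) _) (cong (λ z → ℕtoℚ (wsum a′ (f ∘ (true ∷_))) + z) (ℕtoℚ-* a′ (wsum a′ (f ∘ (false ∷_))))) ⟩
      ℕtoℚ (wsum a′ (f ∘ (true ∷_))) + ℕtoℚ a′ * ℕtoℚ (wsum a′ (f ∘ (false ∷_)))
        ≡⟨ cong₂ (λ t u → t + ℕtoℚ a′ * u) (wsum-𝔼 (f ∘ (true ∷_))) (wsum-𝔼 (f ∘ (false ∷_))) ⟩
      A * t + ℕtoℚ a′ * (A * u) ≡⟨ eq₁ (ℕtoℚ a′) A t u ⟩
      A * (1ℚ * t + ((1ℚ + ℕtoℚ a′) - 1ℚ) * u)
        ≡⟨ cong₂ (λ α β → A * (β * t + (α - β) * u)) (sym (ℕtoℚ-+ 1 a′)) (sym q*a≡1) ⟩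
      A * (q * ℕtoℚ (suc a′) * t + (ℕtoℚ (suc a′) - q * ℕtoℚ (suc a′)) * u) ≡⟨ eq₂ (ℕtoℚ (suc a′)) q A t u ⟩
      ℕtoℚ (suc a′) * A * mix q t u ≡⟨ cong (_* mix q t u) (sym (ℕtoℚ-* (suc a′) ((1 ℕ.+ a′) ℕ.^ m))) ⟩
      ℕtoℚ ((1 ℕ.+ a′) ℕ.^ suc m) * mix q t u ∎
    where
      open ≡-Reasoning
      A = ℕtoℚ ((1 ℕ.+ a′) ℕ.^ m)
      t = 𝔼 q (ℕtoℚ ∘ f ∘ (true ∷_))
      u = 𝔼 q (ℕtoℚ ∘ f ∘ (false ∷_))
      eq₁ : ∀ a A t u → A * t + a * (A * u) ≡ A * (1ℚ * t + ((1ℚ + a) - 1ℚ) * u)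
      eq₁ = solve-∀ ring
      eq₂ : ∀ a q A t u → A * (q * a * t + (a - q * a) * u) ≡ a * A * (q * t + (1ℚ - q) * u)
      eq₂ = solve-∀ ring

  wsum∪-𝔼∪ : ∀ {m} R (f : Subset m → ℕ) (g : Subset m → ℚ) → (∀ V → ℕtoℚ (f V) ≡ ℕtoℚ R * g V) →
    ∀ V → ℕtoℚ (wsum∪ a′ f V) ≡ ℕtoℚ ((1 ℕ.+ a′) ℕ.^ m ℕ.* R) * 𝔼∪ q g V
  wsum∪-𝔼∪ {m} R f g h V = begin
      ℕtoℚ (wsum a′ (λ W → f (V ∪ W))) ≡⟨ wsum-𝔼 (λ W → f (V ∪ W)) ⟩
      A * 𝔼 q (λ W → ℕtoℚ (f (V ∪ W))) ≡⟨ cong (A *_) (trans (𝔼-cong q (λ W → h (V ∪ W))) (𝔼-*ˡ q (ℕtoℚ R) (λ W → g (V ∪ W)))) ⟩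
      A * (ℕtoℚ R * 𝔼∪ q g V) ≡⟨ trans (sym (*-assoc A (ℕtoℚ R) (𝔼∪ q g V))) (cong (_* 𝔼∪ q g V) (sym (ℕtoℚ-* ((1 ℕ.+ a′) ℕ.^ m) R))) ⟩
      ℕtoℚ ((1 ℕ.+ a′) ℕ.^ m ℕ.* R) * 𝔼∪ q g V ∎
    where
      open ≡-Reasoning
      A = ℕtoℚ ((1 ℕ.+ a′) ℕ.^ m)

-- Probability as the expectation of an indicator

ℚsum : ∀ {A : Set} → (A → ℚ) → List A → ℚ
ℚsum f = List.foldr (λ x acc → f x + acc) 0ℚ

ℚsum-++ : ∀ {A : Set} (f : A → ℚ) xs ys → ℚsum f (xs List.++ ys) ≡ ℚsum f xs + ℚsum f ys
ℚsum-++ f [] ys = sym (+-identityˡ (ℚsum f ys))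
ℚsum-++ f (x ∷ xs) ys = trans (cong (λ z → f x + z) (ℚsum-++ f xs ys)) (sym (+-assoc (f x) (ℚsum f xs) (ℚsum f ys)))

ℚsum-map : ∀ {A B : Set} (f : B → ℚ) (g : A → B) h r → (∀ x → f (g x) ≡ r * h x) → ∀ xs → ℚsum f (List.map g xs) ≡ r * ℚsum h xs
ℚsum-map f g h r e [] = sym (*-zeroʳ r)
ℚsum-map f g h r e (x ∷ xs) = trans (cong₂ _+_ (e x) (ℚsum-map f g h r e xs)) (sym (*-distribˡ-+ r (h x) (ℚsum h xs)))

Pr-𝔼 : ∀ {m} p (b : Subset m → Bool) → ℚsum (λ G → if b G then weight p G else 0ℚ) (allVecs m) ≡ 𝔼 p (λ G → ℕtoℚ (if b G then 1 else 0))
Pr-𝔼 {zero} p b with b []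
... | true = refl
... | false = refl
Pr-𝔼 {suc m} p b = trans (ℚsum-++ F (List.map (true ∷_) (allVecs m)) (List.map (false ∷_) (allVecs m)))
    (cong₂ _+_ (half true) (half false))
  where
    F : Subset (suc m) → ℚ
    F G = if b G then weight p G else 0ℚ
    pull : ∀ c r w → (if c then r * w else 0ℚ) ≡ r * (if c then w else 0ℚ)
    pull true r w = refl
    pull false r w = sym (*-zeroʳ r)
    half : ∀ s → let r = if s then p else (1ℚ - p) in ℚsum F (List.map (s ∷_) (allVecs m)) ≡ r * 𝔼 p (λ G → ℕtoℚ (if b (s ∷ G) then 1 else 0))
    half s = trans (ℚsum-map F (s ∷_) (λ G → if b (s ∷ G) then weight p G else 0ℚ) (if s then p else (1ℚ - p)) (λ G → pull (b (s ∷ G)) (if s then p else (1ℚ - p)) (weight p G)) (allVecs m))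
      (cong ((if s then p else (1ℚ - p)) *_) (Pr-𝔼 p (b ∘ (s ∷_))))

-- The density condition is stated with squares, since √n need not be rational; this takes the root
-- once `n` is bounded by a perfect square.
square-cancel : ∀ {r s} → 0ℚ < r → 0ℚ ≤ s → r * r ≤ s * s → r ≤ s
square-cancel {r} {s} 0<r 0≤s le = ≮⇒≥ (λ s<r → <-irrefl refl (<-≤-trans (≤-<-trans (*-monoˡ 0≤s (<⇒≤ s<r)) (*-monoˡ-<-pos r {{positive 0<r}} s<r)) le))

-- The constant and the final estimate

K : ℕ
K = 96 ℕ.* boost

-- p a ≥ 4, because n ≤ (24 boost a)² and K = 4 · 24 boost.
four-rounds-fit : ∀ {n a′ p q} → n ℕ.≤ (24 ℕ.* boost ℕ.* suc a′) ℕ.* (24 ℕ.* boost ℕ.* suc a′) → 0ℚ ≤ p →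
  ℕtoℚ K * ℕtoℚ K ≤ p * p * ℕtoℚ n → 0ℚ ≤ q → q * ℕtoℚ (suc a′) ≡ 1ℚ → q + (q + (q + q)) ≤ p
four-rounds-fit {n} {a′} {p} {q} n≤ 0≤p K≤ 0≤q q*a≡1 = begin
    q + (q + (q + q)) ≡⟨ eq₁ q ⟩
    q * (1ℚ + (1ℚ + (1ℚ + 1ℚ))) ≤⟨ *-monoˡ 0≤q 4≤pa ⟩
    q * (p * α) ≡⟨ eq₂ q p α ⟩
    p * (q * α) ≡⟨ trans (cong (p *_) q*a≡1) (*-identityʳ p) ⟩
    p ∎
  where
    open ≤-Reasoning
    α = ℕtoℚ (suc a′)
    y = 24 ℕ.* boost
    1≤boost : 1 ℕ.≤ boost
    1≤boost = ℕ.≤-trans (ℕ.m^n>0 2 32) (ℕ.≤-reflexive (sym boost≡2^32))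
    instance
      boost≢0 : ℕ.NonZero boost
      boost≢0 = ℕ.>-nonZero 1≤boost
      y≢0 : ℕ.NonZero y
      y≢0 = ℕ.m*n≢0 24 boost
      K≢0 : ℕ.NonZero K
      K≢0 = ℕ.m*n≢0 96 boost
    eq₁ : ∀ q → q + (q + (q + q)) ≡ q * (1ℚ + (1ℚ + (1ℚ + 1ℚ)))
    eq₁ = solve-∀ ring
    eq₂ : ∀ q p α → q * (p * α) ≡ p * (q * α)
    eq₂ = solve-∀ ring
    eq₃ : ∀ p y → p * p * (y * y) ≡ (p * y) * (p * y)
    eq₃ = solve-∀ ring
    eq₄ : ∀ p y α → p * (y * α) ≡ y * (p * α)
    eq₄ = solve-∀ ring
    Kᵉ : ℕtoℚ K ≡ ℕtoℚ y * ℕtoℚ 4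
    Kᵉ = trans (cong ℕtoℚ (trans (ℕ.*-assoc 4 24 boost) (ℕ.*-comm 4 y))) (ℕtoℚ-* y 4)
    K≤py : ℕtoℚ K ≤ p * ℕtoℚ (y ℕ.* suc a′)
    K≤py = square-cancel (0<ℕtoℚ K) (0≤* 0≤p (0≤ℕtoℚ (y ℕ.* suc a′))) (begin
      ℕtoℚ K * ℕtoℚ K ≤⟨ K≤ ⟩
      p * p * ℕtoℚ n ≤⟨ *-monoˡ (0≤* 0≤p 0≤p) (ℕtoℚ-mono n≤) ⟩
      p * p * ℕtoℚ (y ℕ.* suc a′ ℕ.* (y ℕ.* suc a′)) ≡⟨ cong (p * p *_) (ℕtoℚ-* (y ℕ.* suc a′) (y ℕ.* suc a′)) ⟩
      p * p * (ℕtoℚ (y ℕ.* suc a′) * ℕtoℚ (y ℕ.* suc a′)) ≡⟨ eq₃ p (ℕtoℚ (y ℕ.* suc a′)) ⟩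
      (p * ℕtoℚ (y ℕ.* suc a′)) * (p * ℕtoℚ (y ℕ.* suc a′)) ∎)
    4≤pa : ℕtoℚ 4 ≤ p * α
    4≤pa = *-cancelˡ-≤-pos (ℕtoℚ y) {{positive (0<ℕtoℚ y)}} (begin
      ℕtoℚ y * ℕtoℚ 4 ≡⟨ sym Kᵉ ⟩
      ℕtoℚ K ≤⟨ K≤py ⟩
      p * ℕtoℚ (y ℕ.* suc a′) ≡⟨ trans (cong (p *_) (ℕtoℚ-* y (suc a′))) (eq₄ p (ℕtoℚ y) α) ⟩
      ℕtoℚ y * (p * α) ∎)

-- The counting gives e ≤ e P + 1 for the probability P of success in four rounds, hence P ≥ 1 - 1/E
-- ≥ 1 - ε. As 4 q ≤ p and the property is increasing, one random graph of density `p` does at least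
-- as well.
probability-bound : ∀ n (p ε : ℚ) E → 0ℚ ≤ p → p ≤ 1ℚ → ℕtoℚ K * ℕtoℚ K ≤ p * p * ℕtoℚ n →
  1 ℕ.≤ E → 1ℚ ≤ ℕtoℚ E * ε → threshold E ℕ.≤ n →
  (dec : (G : Graph n) → Dec (ContainsSquareHamCycle n G)) → 1ℚ - ε ≤ Pr n p dec
probability-bound n p ε E 0≤p p≤1 K≤ 1≤E 1≤Eε large dec = begin
    1ℚ - ε ≤⟨ *-cancelˡ-≤-pos e {{positive (0<ℕtoℚ E {{ℕ.>-nonZero 1≤E}})}} scaled ⟩
    P ≤⟨ 𝔼-four-rounds 0≤q (four-rounds-fit (Scale.√n≤ sc) 0≤p K≤ 0≤q q*a≡1) p≤1 inc ⟩
    𝔼 p (ℕtoℚ ∘ ind) ≡⟨ sym (Pr-𝔼 p (λ G → does (dec G))) ⟩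
    Pr n p dec ∎
  where
    open ≤-Reasoning
    sc = scale n E large
    a′ = Scale.a′ sc
    3≤n : 3 ℕ.≤ n
    3≤n = ℕ.≤-trans (ℕ.m≤m+n 3 _) large
    α = ℕtoℚ (suc a′)
    0<α : 0ℚ < α
    0<α = 0<ℕtoℚ (suc a′)
    instance
      α≢0 : NonZero α
      α≢0 = pos⇒nonZero α {{positive 0<α}}
    q = 1/ α
    q*a≡1 : q * α ≡ 1ℚ
    q*a≡1 = *-inverseˡ α
    0≤q : 0ℚ ≤ q
    0≤q = *-cancelʳ-≤-pos α {{positive 0<α}} (≤-trans (≤-reflexive (*-zeroˡ α)) (≤-trans (0≤ℕtoℚ 1) (≤-reflexive (sym q*a≡1))))
    ind : Graph n → ℕ
    ind G = ⟦ dec G ⟧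
    inc : Increasing (ℕtoℚ ∘ ind)
    inc {V} {W} V⊆W = ℕtoℚ-mono (by (dec V) (dec W))
      where
        by : (d : Dec (ContainsSquareHamCycle n V)) (d′ : Dec (ContainsSquareHamCycle n W)) → ⟦ d ⟧ ℕ.≤ ⟦ d′ ⟧
        by (no _) _ = ℕ.z≤n
        by (yes c) d′ = ℕ.≤-reflexive (sym (⟦⟧-true d′ (contains-mono V⊆W c)))
    e = ℕtoℚ E
    A = (1 ℕ.+ a′) ℕ.^ numPairs n
    A⁴ = A ℕ.* (A ℕ.* (A ℕ.* (A ℕ.* 1)))
    P = 𝔼∪ q (𝔼∪ q (𝔼∪ q (𝔼∪ q (ℕtoℚ ∘ ind)))) Subset.⊥
    w = wsum∪ a′ (wsum∪ a′ (wsum∪ a′ (wsum∪ a′ ind))) Subset.⊥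
    w≡ : ℕtoℚ w ≡ ℕtoℚ A⁴ * P
    w≡ = step (A ℕ.* (A ℕ.* (A ℕ.* 1))) (wsum∪ a′ (wsum∪ a′ (wsum∪ a′ ind))) (𝔼∪ q (𝔼∪ q (𝔼∪ q (ℕtoℚ ∘ ind))))
        (step (A ℕ.* (A ℕ.* 1)) (wsum∪ a′ (wsum∪ a′ ind)) (𝔼∪ q (𝔼∪ q (ℕtoℚ ∘ ind)))
        (step (A ℕ.* 1) (wsum∪ a′ ind) (𝔼∪ q (ℕtoℚ ∘ ind))
        (step 1 ind (ℕtoℚ ∘ ind) (λ V → sym (*-identityˡ (ℕtoℚ (ind V))))))) Subset.⊥
      where
        step : ∀ R (f : Subset (numPairs n) → ℕ) (g : Subset (numPairs n) → ℚ) → (∀ V → ℕtoℚ (f V) ≡ ℕtoℚ R * g V) →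
          ∀ V → ℕtoℚ (wsum∪ a′ f V) ≡ ℕtoℚ (A ℕ.* R) * 𝔼∪ q g V
        step = wsum∪-𝔼∪ a′ q q*a≡1
    A⁴≢0 : ℕ.NonZero A⁴
    A⁴≢0 = nz (nz (nz (nz _)))
      where
        nz : ∀ {R} → ℕ.NonZero R → ℕ.NonZero (A ℕ.* R)
        nz {R} h = ℕ.m*n≢0 A R {{ℕ.m^n≢0 (1 ℕ.+ a′) (numPairs n)}} {{h}}
    rounds : E ℕ.* A⁴ ℕ.≤ E ℕ.* w ℕ.+ A⁴
    rounds = Main.four-rounds n a′ boost E 3≤n boost≡2^32 (Scale.64B²≤n sc) (Scale.n≤256B² sc) (Scale.B-large sc) ind
      (λ V y y∈ S⊆V → ⟦⟧-true (dec V) (contains-square 3≤n V y y∈ S⊆V))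
    eq₁ : ∀ A e → A * e ≡ e * A
    eq₁ = solve-∀ ring
    eq₂ : ∀ A e P → e * (A * P) + A ≡ A * (e * P + 1ℚ)
    eq₂ = solve-∀ ring
    e≤ : e ≤ e * P + 1ℚ
    e≤ = *-cancelˡ-≤-pos (ℕtoℚ A⁴) {{positive (0<ℕtoℚ A⁴ {{A⁴≢0}})}} (begin
      ℕtoℚ A⁴ * e ≡⟨ trans (eq₁ (ℕtoℚ A⁴) e) (sym (ℕtoℚ-* E A⁴)) ⟩
      ℕtoℚ (E ℕ.* A⁴) ≤⟨ ℕtoℚ-mono rounds ⟩
      ℕtoℚ (E ℕ.* w ℕ.+ A⁴) ≡⟨ trans (ℕtoℚ-+ (E ℕ.* w) A⁴) (cong (_+ ℕtoℚ A⁴) (trans (ℕtoℚ-* E w) (cong (e *_) w≡))) ⟩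
      e * (ℕtoℚ A⁴ * P) + ℕtoℚ A⁴ ≡⟨ eq₂ (ℕtoℚ A⁴) e P ⟩
      ℕtoℚ A⁴ * (e * P + 1ℚ) ∎)
    eq₃ : ∀ e ε → e * (1ℚ - ε) ≡ e + - (e * ε)
    eq₃ = solve-∀ ring
    eq₄ : ∀ e P → e * P + 1ℚ + - 1ℚ ≡ e * P
    eq₄ = solve-∀ ring
    scaled : e * (1ℚ - ε) ≤ e * P
    scaled = ≤-trans (≤-reflexive (eq₃ e ε)) (≤-trans (+-mono-≤ e≤ (neg-antimono-≤ 1≤Eε)) (≤-reflexive (eq₄ e P)))

theorem1p1 : Σ ℚ λ K →
    (p : ℕ → ℚ) →
    ((n : ℕ) → (0ℚ ≤ p n) × (p n ≤ 1ℚ)) →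
    (Σ ℕ λ n₀ → (n : ℕ) → n₀ Data.Nat.≤ n → K * K ≤ p n * p n * ℕtoℚ n) →
    (ε : ℚ) → 0ℚ < ε →
    Σ ℕ λ N → (n : ℕ) → N Data.Nat.≤ n →
    (dec : (G : Graph n) → Dec (ContainsSquareHamCycle n G)) →
    1ℚ - ε ≤ Pr n (p n) dec
-- ε enters only through `E`, and `E` only affects how large `n` must be, so `K` is universal.
theorem1p1 = ℕtoℚ K , λ p p∈[0,1] (n₀ , dense) ε 0<ε →
  let E , 1≤E , 1≤Eε = archimedes ε 0<ε
  in n₀ ℕ.+ threshold E , λ n N≤n dec →
    probability-bound n (p n) ε E (proj₁ (p∈[0,1] n)) (proj₂ (p∈[0,1] n)) (dense n (ℕ.≤-trans (ℕ.m≤m+n n₀ _) N≤n))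
      1≤E 1≤Eε (ℕ.≤-trans (ℕ.m≤n+m (threshold E) n₀) N≤n) dec
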